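{- Let $n\ge 2$ be an integer and let $m\in\mathbb{Z}$ be such that $f(x)=x^n-m\in\mathbb{Z}[x]$ is irreducible over $\mathbb{Q}$ and $\nu_p(m)<n$ for every prime $p$. Let $K=\mathbb{Q}(\alpha)$ be the number field generated by a complex root $\alpha$ of $f(x)$. Then $\mathbb{Z}[\alpha]$ is the ring of integers of $K$ if and only if $\nu_p(m^p-m)=1$ for every prime $p$ dividing $n\cdot m$.
   Context: For a prime $p$, $\nu_p$ denotes the $p$-adic valuation on $\mathbb{Q}$ (with $\nu_p(0)=\infty$). -}

module Defs where

open import Algebra.Apartness.Bundles using (HeytingField; HeytingCommutativeRing)
open import Algebra.Bundles using (CommutativeRing)
open import Algebra.Bundles.Raw using (RawRing)
import Algebra.Definitions.RawSemiring as RawSemiringDefs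
open import Algebra.Morphism.Structures using (IsRingHomomorphism)
open import Data.Bool.Base using (if_then_else_)
open import Data.Integer.Base as ℤ using (ℤ)
open import Data.List.Base using (List; []; _∷_; map; foldr)
open import Data.Nat.Base as ℕ using (ℕ; zero; suc)
open import Data.Nat.Divisibility using (_∣?_)
open import Data.Product.Base using (∃-syntax; _×_)
open import Data.Rational.Base as ℚ using (ℚ; 0ℚ; ↥_; ↧ₙ_)
open import Data.Rational.Literals using (fromℤ)
import Data.Rational.Properties as ℚₚ
open import Function.Base using (_∘_)
open import Level as Level using (_⊔_)
open import Relation.Binary.PropositionalEquality.Core using (_≡_)
open import Relation.Nullary.Construct.Add.Supremum using (_⁺; [_]; ⊤⁺)
open import Relation.Nullary.Decidable.Core using (does)
open import Relation.Unary using (Pred; _∈_)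

-- The greatest e ≤ b with p ^ e ∣ k.
greatestExponent : (p k b : ℕ) → ℕ
greatestExponent p k zero    = zero
greatestExponent p k (suc b) =
  if does ((p ℕ.^ suc b) ∣? k) then suc b else greatestExponent p k b

-- For p ≥ 2 and k ≥ 1, every e with p ^ e ∣ k satisfies e < p ^ e ≤ k, so
-- bounding the search by k loses nothing.  The value is junk for k = 0.
multiplicity : (p k : ℕ) → ℕ
multiplicity p k = greatestExponent p k k

-- The p-adic valuation, with ⊤⁺ playing the role of ∞.
ν : ℕ → ℚ → ℤ ⁺
ν p q =
  if does (q ℚₚ.≟ 0ℚ)
  then ⊤⁺
  else [ ℤ.+ multiplicity p ℤ.∣ ↥ q ∣ ℤ.- ℤ.+ multiplicity p (↧ₙ q) ]

-- Polynomials in one variable, as lists of coefficients with the constant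
-- term first.  Trailing zeros are allowed, so equality is coefficientwise.
module Polynomial {c ℓ} (R : RawRing c ℓ) where
  open RawRing R

  Poly : Set c
  Poly = List Carrier

  coeff : Poly → ℕ → Carrier
  coeff []      _       = 0#
  coeff (a ∷ _) zero    = a
  coeff (_ ∷ g) (suc i) = coeff g i

  infixl 6 _⊕_
  _⊕_ : Poly → Poly → Poly
  []      ⊕ h       = h
  (a ∷ g) ⊕ []      = a ∷ g
  (a ∷ g) ⊕ (b ∷ h) = (a + b) ∷ (g ⊕ h)

  infixl 7 _⊛_
  _⊛_ : Poly → Poly → Poly
  []      ⊛ h = []
  (a ∷ g) ⊛ h = map (a *_) h ⊕ (0# ∷ (g ⊛ h))

  constant : Carrier → Poly
  constant a = a ∷ []

  X : Poly
  X = 0# ∷ 1# ∷ []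

  rawRing : RawRing c ℓ
  rawRing = record
    { Carrier = Poly
    ; _≈_     = λ g h → ∀ i → coeff g i ≈ coeff h i
    ; _+_     = _⊕_
    ; _*_     = _⊛_
    ; -_      = map (-_)
    ; 0#      = []
    ; 1#      = constant 1#
    }

  open RawSemiringDefs (RawRing.rawSemiring rawRing) public
    using (_^_; Irreducible)

  eval : Poly → Carrier → Carrier
  eval g x = foldr (λ a s → a + x * s) 0# g

  Monic : Poly → Set ℓ
  Monic g = ∃[ d ] (coeff g d ≈ 1# × (∀ i → d ℕ.< i → coeff g i ≈ 0#))

module ℤ[X] = Polynomial ℤ.+-*-rawRing
module ℚ[X] = Polynomial ℚ.+-*-rawRing

X^_-_ : ℕ → ℤ → ℤ[X].Poly
X^ n - m = (ℤ[X].X ℤ[X].^ n) ℤ[X].⊕ map ℤ.-_ (ℤ[X].constant m)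

IrreducibleOverℚ : ℤ[X].Poly → Set
IrreducibleOverℚ g = ℚ[X].Irreducible (map fromℤ g)

-- A field L with an embedding of ℚ; any ring homomorphism from ℚ to a field
-- is injective.
record FieldExtensionOfℚ c ℓ₁ ℓ₂ : Set (Level.suc (c ⊔ ℓ₁ ⊔ ℓ₂)) where
  field
    heytingField : HeytingField c ℓ₁ ℓ₂

  open HeytingField heytingField public

  rawRing : RawRing c ℓ₁
  rawRing = CommutativeRing.rawRing
    (HeytingCommutativeRing.commutativeRing heytingCommutativeRing)

  field
    ι                    : ℚ → Carrier
    ι-isRingHomomorphism : IsRingHomomorphism ℚ.+-*-rawRing rawRing ι

module _ {c ℓ₁ ℓ₂} (L : FieldExtensionOfℚ c ℓ₁ ℓ₂) where
  open FieldExtensionOfℚ L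

  evalℤ : ℤ[X].Poly → Carrier → Carrier
  evalℤ g x = Polynomial.eval rawRing (map (ι ∘ fromℤ) g) x

  IsRoot : ℤ[X].Poly → Carrier → Set ℓ₁
  IsRoot g x = evalℤ g x ≈ 0#

  -- The subfield of L generated by α.
  data ℚ⟮_⟯ (α : Carrier) : Pred Carrier (c ⊔ ℓ₁) where
    rational  : ∀ q → ι q ∈ ℚ⟮ α ⟯
    generator : α ∈ ℚ⟮ α ⟯
    plus      : ∀ {x y} → x ∈ ℚ⟮ α ⟯ → y ∈ ℚ⟮ α ⟯ → x + y ∈ ℚ⟮ α ⟯
    negate    : ∀ {x} → x ∈ ℚ⟮ α ⟯ → - x ∈ ℚ⟮ α ⟯
    times     : ∀ {x y} → x ∈ ℚ⟮ α ⟯ → y ∈ ℚ⟮ α ⟯ → x * y ∈ ℚ⟮ α ⟯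
    inverse   : ∀ {x y} → x * y ≈ 1# → x ∈ ℚ⟮ α ⟯ → y ∈ ℚ⟮ α ⟯
    respects  : ∀ {x y} → x ≈ y → x ∈ ℚ⟮ α ⟯ → y ∈ ℚ⟮ α ⟯

  ℤ[_] : Carrier → Pred Carrier ℓ₁
  ℤ[ α ] x = ∃[ g ] (x ≈ evalℤ g α)

  Integral : Pred Carrier ℓ₁
  Integral x = ∃[ g ] (ℤ[X].Monic g × IsRoot g x)

  RingOfIntegers : ∀ {ℓ} → Pred Carrier ℓ → Pred Carrier (ℓ₁ ⊔ ℓ)
  RingOfIntegers K x = x ∈ K × Integral x

{-# OPTIONS --safe #-}

-- Both directions are local at a prime p.  Writing f = X ^ n - m and A = ℤ[α],
-- suppose first that p divides m exactly once, or that p ∤ m and either p ∤ n or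
-- p² ∤ m ^ p - m.  Then p is, up to a unit, a power of h, where h = α in the first
-- case and h = α ^ k - m + p in the second, n = p ^ s k with p ∤ k; moreover
-- A / (h , p) is reduced, by the Frobenius map.  If z / p is almost integral then
-- so is h ^ (P - 1) z / p, hence z is nilpotent modulo (h , p), so z ∈ (h , p), and
-- P repetitions give z ∈ p A.  Hence no integral element has p in its denominator.
-- Conversely, α ^ (n - 1) / p is integral when p² ∣ m, and when p ∣ n, p ∤ m and
-- p² ∣ m ^ p - m there is an integral element differing from
-- (α ^ (n / p) - m) ^ (p - 1) / p by an element of A.  Elements of A are shown to be
-- integral by eliminating among the equations of multiplication on 1 , α , … ,
-- α ^ (n - 1), which keeps the leading coefficients equal to 1.

module Submission where

open import Defs
open import Algebra.Apartness.Bundles using (HeytingCommutativeRing)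
open import Algebra.Bundles using (CommutativeRing; RawRing)
import Algebra.Definitions.RawMagma as RawMagmaDefs
import Algebra.Morphism.Construct.Composition as Composition
open import Algebra.Morphism.Construct.Identity using (isRingHomomorphism)
import Algebra.Morphism.RingMonomorphism as RingMonomorphism
open import Algebra.Morphism.Structures using (IsRingHomomorphism; IsRingMonomorphism)
import Algebra.Properties.CommutativeSemiring.Exp as CommutativeExp
open import Data.Empty using (⊥)
open import Data.Fin.Base as Fin using (Fin; fromℕ; fromℕ<; inject₁; toℕ)
import Data.Fin.Properties as Finₚ
open import Data.Integer.Base as ℤ using (+_; -[1+_]; ℤ; ∣_∣)
import Data.Integer.Divisibility.Signed as ℤˢ
import Data.Integer.Properties as ℤₚ
open import Data.List.Base using ([]; _∷_; map)
import Data.List.Properties as Listₚ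
open import Data.List.Relation.Unary.All using (All; []; _∷_)
open import Data.Maybe.Base using (Maybe; just; nothing)
open import Data.Nat.Base as ℕ using (_!; _<_; _∸_; _≤_; suc; s≤s; zero; z≤n; ℕ)
open import Data.Nat.Combinatorics using (_C_; k![n∸k]!∣n!; nCk≡n!/k![n-k]!; nCn≡1)
open import Data.Nat.Coprimality as Coprimality using (Coprime; coprime-Bézout)
open import Data.Nat.DivMod as ℕᵐ using (m/n*n≡m)
import Data.Nat.Divisibility as ℕᵈ
open import Data.Nat.GCD using (module Bézout)
open import Data.Nat.Induction using (<-rec)
open import Data.Nat.ListAction using (product)
open import Data.Nat.Primality using (Prime; euclidsLemma; prime⇒irreducible; prime⇒nonTrivial; prime⇒nonZero; ¬prime[0]; ¬prime[1])
open import Data.Nat.Primality.Factorisation using (PrimeFactorisation; factorise)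
import Data.Nat.Properties as ℕₚ
open import Data.Product.Base using (_,_; _×_; proj₁; proj₂; ∃-syntax; ∃₂)
open import Data.Rational.Base as ℚ using (0ℚ; 1ℚ; ℚ; ↥_; ↧_; ↧ₙ_)
open import Data.Rational.Literals using (fromℤ)
import Data.Rational.Properties as ℚₚ
import Data.Rational.Unnormalised.Base as ℚᵘ
import Data.Rational.Unnormalised.Properties as ℚᵘₚ
open import Data.Sum.Base using ([_,_]′; _⊎_; inj₁; inj₂)
open import Function.Base using (_$_; _∘_)
open import Function.Bundles using (_⇔_; mk⇔)
open import Relation.Binary.Construct.Add.Supremum.Strict ℤ._<_ using (_<⁺_)
open import Relation.Binary.PropositionalEquality as ≡ using (_≡_; _≢_; cong; cong₂; module ≡-Reasoning)
open import Relation.Nullary.Construct.Add.Supremum using ([]-injective; [_])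
open import Relation.Nullary.Decidable using (no; yes)
open import Relation.Nullary.Negation using (contradiction; ¬_)
open import Relation.Unary using (_∈_; _≐_)
import Level

-- Integral elements enter the local argument only through their powers: one nonzero integer carries
-- every `x ^ k` into A. This property survives multiplication by elements of A and translation by
-- them, which is all that the descent uses; no ring structure on the integral elements,
-- discriminant or localisation is required, and units are needed only modulo (h , p). In L the
-- prime p is invertible, so ideals must be taken in A as a ring of its own. What is known of A is
-- that 1 , α , ... , α ^ (n - 1) is a basis over ℤ; this is where irreducibility enters. With b = m
-- - p and q = p ^ s, the relation between h and p comes from m = (h + b) ^ q. The cross terms are
-- multiples of p h, so h ^ q is p times (m - b ^ q) / p up to a multiple of h. For s > 0 this
-- number is congruent to - (m ^ p - m) / p modulo p, whence the condition on p²; for s = 0 it is 1.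
-- For p ∤ m, choose r and t with p ^ r = 1 + k t. Modulo (h , p) one has α ^ k = m, so the r-th
-- iterate of Frobenius sends α to m ^ t α. Invertibility of this substitution replaces a
-- separability argument for X ^ k - m.

module IntegerSolver {c ℓ} (R : CommutativeRing c ℓ) where
  open CommutativeRing R
  open import Algebra.Properties.Ring ring
  open import Algebra.Properties.Semiring.Mult.TCOptimised semiring
    using (×-homo-+; ×1-homo-*; 1+×) renaming (_×_ to _·_)
  open import Algebra.Solver.Ring.AlmostCommutativeRing using (fromCommutativeRing; _-Raw-AlmostCommutative⟶_)
  open import Relation.Binary.Reasoning.Setoid setoid

  -- The optimised multiples reduce `1 · 1#` to `1#`, so `con (+ 0)` and `con (+ 1)` denote `0#` and
  -- `1#` definitionally and match goals as they stand.
  int : ℤ → Carrier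
  int (+ n)    = n · 1#
  int -[1+ n ] = - (suc n · 1#)

  private
    cancel : ∀ a x y → (a + x) - (a + y) ≈ x - y
    cancel a x y = begin
      (a + x) - (a + y)       ≈⟨ +-congˡ (-‿+-comm a y) ⟨
      (a + x) + (- a + - y)   ≈⟨ +-congʳ (+-comm a x) ⟩
      (x + a) + (- a + - y)   ≈⟨ +-assoc x a _ ⟩
      x + (a + (- a + - y))   ≈⟨ +-congˡ (+-assoc a _ _) ⟨
      x + ((a + - a) + - y)   ≈⟨ +-congˡ (+-congʳ (-‿inverseʳ a)) ⟩
      x + (0# + - y)          ≈⟨ +-congˡ (+-identityˡ _) ⟩
      x - y                   ∎

  int-⊖ : ∀ m n → int (m ℤ.⊖ n) ≈ m · 1# - n · 1#
  int-⊖ m       zero    = sym (trans (+-congˡ -0#≈0#) (+-identityʳ _))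
  int-⊖ zero    (suc n) = sym (+-identityˡ _)
  int-⊖ (suc m) (suc n) = begin
    int (suc m ℤ.⊖ suc n)               ≡⟨ ≡.cong int (ℤₚ.[1+m]⊖[1+n]≡m⊖n m n) ⟩
    int (m ℤ.⊖ n)                       ≈⟨ int-⊖ m n ⟩
    m · 1# - n · 1#                     ≈⟨ cancel 1# _ _ ⟨
    (1# + m · 1#) - (1# + n · 1#)       ≈⟨ +-cong (1+× m 1#) (-‿cong (1+× n 1#)) ⟨
    suc m · 1# - suc n · 1#             ∎

  int-neg : ∀ i → int (ℤ.- i) ≈ - int i
  int-neg (+ zero)   = sym -0#≈0#
  int-neg (+ suc n)  = refl
  int-neg -[1+ n ]   = sym (-‿involutive _)

  int-+ : ∀ i j → int (i ℤ.+ j) ≈ int i + int j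
  int-+ (+ m)    (+ n)    = ×-homo-+ 1# m n
  int-+ (+ m)    -[1+ n ] = int-⊖ m (suc n)
  int-+ -[1+ m ] (+ n)    = trans (int-⊖ n (suc m)) (+-comm _ _)
  int-+ -[1+ m ] -[1+ n ] = begin
    - (suc (suc (m ℕ.+ n)) · 1#)   ≡⟨ ≡.cong (λ k → - (suc k · 1#)) (≡.sym (ℕₚ.+-suc m n)) ⟩
    - ((suc m ℕ.+ suc n) · 1#)     ≈⟨ -‿cong (×-homo-+ 1# (suc m) (suc n)) ⟩
    - (suc m · 1# + suc n · 1#)    ≈⟨ -‿+-comm _ _ ⟨
    - (suc m · 1#) - suc n · 1#    ∎
    where import Data.Nat.Properties as ℕₚ

  private
    int-*-ℕ : ∀ m n → int (+ m ℤ.* + n) ≈ int (+ m) * int (+ n)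
    int-*-ℕ m n = trans (reflexive (≡.cong int (≡.sym (ℤₚ.pos-* m n)))) (×1-homo-* m n)

  int-* : ∀ i j → int (i ℤ.* j) ≈ int i * int j
  int-* (+ m)    (+ n)    = int-*-ℕ m n
  int-* (+ m)    -[1+ n ] = begin
    int (+ m ℤ.* -[1+ n ])        ≡⟨ ≡.cong int (≡.sym (ℤₚ.neg-distribʳ-* (+ m) (+ suc n))) ⟩
    int (ℤ.- (+ m ℤ.* + suc n))   ≈⟨ int-neg (+ m ℤ.* + suc n) ⟩
    - int (+ m ℤ.* + suc n)       ≈⟨ -‿cong (int-*-ℕ m (suc n)) ⟩
    - (int (+ m) * int (+ suc n)) ≈⟨ -‿distribʳ-* _ _ ⟩
    int (+ m) * - int (+ suc n)   ∎
  int-* -[1+ m ] (+ n)    = begin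
    int (-[1+ m ] ℤ.* + n)        ≡⟨ ≡.cong int (≡.sym (ℤₚ.neg-distribˡ-* (+ suc m) (+ n))) ⟩
    int (ℤ.- (+ suc m ℤ.* + n))   ≈⟨ int-neg (+ suc m ℤ.* + n) ⟩
    - int (+ suc m ℤ.* + n)       ≈⟨ -‿cong (int-*-ℕ (suc m) n) ⟩
    - (int (+ suc m) * int (+ n)) ≈⟨ -‿distribˡ-* _ _ ⟩
    - int (+ suc m) * int (+ n)   ∎
  int-* -[1+ m ] -[1+ n ] = begin
    int (-[1+ m ] ℤ.* -[1+ n ])   ≈⟨ int-*-ℕ (suc m) (suc n) ⟩
    int (+ suc m) * int (+ suc n) ≈⟨ -‿involutive _ ⟨
    - - (int (+ suc m) * int (+ suc n)) ≈⟨ -‿cong (-‿distribˡ-* _ _) ⟩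
    - (- int (+ suc m) * int (+ suc n)) ≈⟨ -‿distribʳ-* _ _ ⟩
    - int (+ suc m) * - int (+ suc n) ∎

  private
    morphism : ℤ.+-*-rawRing -Raw-AlmostCommutative⟶ fromCommutativeRing R
    morphism = record
      { ⟦_⟧    = int
      ; +-homo = int-+
      ; *-homo = int-*
      ; -‿homo = int-neg
      ; 0-homo = refl
      ; 1-homo = refl
      }

    -- Coefficients are compared in ℤ, so the equality of the ring itself need not be decidable.
    _≟ᶜ_ : ∀ i j → Maybe (int i ≈ int j)
    i ≟ᶜ j with i ℤₚ.≟ j
    ... | yes i≡j = just (reflexive (≡.cong int i≡j))
    ... | no  _   = nothing

  open import Algebra.Solver.Ring ℤ.+-*-rawRing (fromCommutativeRing R) morphism _≟ᶜ_ public
    using (solve; _:=_; con; _:+_; _:*_; :-_; _:-_; _:^_)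

-- Polynomials as coefficient lists

module PolynomialProperties {c ℓ} (R : CommutativeRing c ℓ) where
  open CommutativeRing R
  open Polynomial (CommutativeRing.rawRing R) public using (Poly; coeff; _⊕_; _⊛_; constant; X; Monic) renaming (_^_ to _^ᵖ_)
  open import Algebra.Properties.Ring ring
  open import Relation.Binary.Reasoning.Setoid setoid
  open IntegerSolver R

  infix 4 _≋_ _∣ʳ_
  _≋_ : Poly → Poly → Set ℓ
  g ≋ h = ∀ i → coeff g i ≈ coeff h i

  _∣ʳ_ : Carrier → Carrier → Set _
  q ∣ʳ x = ∃[ t ] x ≈ q * t

  DegreeBelow : ℕ → Poly → Set ℓ
  DegreeBelow d g = ∀ i → d ≤ i → coeff g i ≈ 0#

  MonicOfDegree : ℕ → Poly → Set ℓ
  MonicOfDegree d g = coeff g d ≈ 1# × (∀ i → d < i → coeff g i ≈ 0#)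

  coeff-⊕ : ∀ g h i → coeff (g ⊕ h) i ≈ coeff g i + coeff h i
  coeff-⊕ []      h       i       = sym (+-identityˡ _)
  coeff-⊕ (a ∷ g) []      i       = sym (+-identityʳ _)
  coeff-⊕ (a ∷ g) (b ∷ h) zero    = refl
  coeff-⊕ (a ∷ g) (b ∷ h) (suc i) = coeff-⊕ g h i

  coeff-scale : ∀ a h i → coeff (map (a *_) h) i ≈ a * coeff h i
  coeff-scale a []      i       = sym (zeroʳ a)
  coeff-scale a (b ∷ h) zero    = refl
  coeff-scale a (b ∷ h) (suc i) = coeff-scale a h i

  coeff-neg : ∀ h i → coeff (map (-_) h) i ≈ - coeff h i
  coeff-neg []      i       = sym -0#≈0#
  coeff-neg (b ∷ h) zero    = refl
  coeff-neg (b ∷ h) (suc i) = coeff-neg h i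

  coeff-∷⊛-zero : ∀ a g h → coeff ((a ∷ g) ⊛ h) 0 ≈ a * coeff h 0
  coeff-∷⊛-zero a g h = begin
    coeff ((a ∷ g) ⊛ h) 0       ≈⟨ coeff-⊕ (map (a *_) h) _ 0 ⟩
    coeff (map (a *_) h) 0 + 0# ≈⟨ +-identityʳ _ ⟩
    coeff (map (a *_) h) 0      ≈⟨ coeff-scale a h 0 ⟩
    a * coeff h 0               ∎

  coeff-∷⊛-suc : ∀ a g h i → coeff ((a ∷ g) ⊛ h) (suc i) ≈ a * coeff h (suc i) + coeff (g ⊛ h) i
  coeff-∷⊛-suc a g h i = trans (coeff-⊕ (map (a *_) h) _ (suc i)) (+-congʳ (coeff-scale a h (suc i)))

  DegreeBelow-mono : ∀ {d e} g → d ≤ e → DegreeBelow d g → DegreeBelow e g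
  DegreeBelow-mono g d≤e p i e≤i = p i (ℕₚ.≤-trans d≤e e≤i)

  ⊕-DegreeBelow : ∀ {d} g h → DegreeBelow d g → DegreeBelow d h → DegreeBelow d (g ⊕ h)
  ⊕-DegreeBelow g h p q i d≤i = trans (coeff-⊕ g h i) (trans (+-cong (p i d≤i) (q i d≤i)) (+-identityˡ 0#))

  scale-DegreeBelow : ∀ {d} a g → DegreeBelow d g → DegreeBelow d (map (a *_) g)
  scale-DegreeBelow a g p i d≤i = trans (coeff-scale a g i) (trans (*-congˡ (p i d≤i)) (zeroʳ a))

  neg-DegreeBelow : ∀ {d} g → DegreeBelow d g → DegreeBelow d (map (-_) g)
  neg-DegreeBelow g p i d≤i = trans (coeff-neg g i) (trans (-‿cong (p i d≤i)) -0#≈0#)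

  ⊕-Monic : ∀ {d} g h → MonicOfDegree d g → DegreeBelow d h → MonicOfDegree d (g ⊕ h)
  ⊕-Monic {d} g h (p , q) r =
    trans (coeff-⊕ g h d) (trans (+-cong p (r d ℕₚ.≤-refl)) (+-identityʳ 1#)) ,
    λ i d<i → trans (coeff-⊕ g h i) (trans (+-cong (q i d<i) (r i (ℕₚ.<⇒≤ d<i))) (+-identityʳ 0#))

  ∣-coeff-⊛ : ∀ q g h → (∀ i → q ∣ʳ coeff g i) → ∀ i → q ∣ʳ coeff (g ⊛ h) i
  ∣-coeff-⊛ q []      h p i = 0# , sym (zeroʳ q)
  ∣-coeff-⊛ q (a ∷ g) h p zero =
    let t , e = p 0 in t * coeff h 0 ,
      trans (coeff-∷⊛-zero a g h) (trans (*-congʳ e) (*-assoc q t _))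
  ∣-coeff-⊛ q (a ∷ g) h p (suc i) =
    let t , e = p 0
        u , f = ∣-coeff-⊛ q g h (λ j → p (suc j)) i in t * coeff h (suc i) + u , (begin
      coeff ((a ∷ g) ⊛ h) (suc i)              ≈⟨ coeff-∷⊛-suc a g h i ⟩
      a * coeff h (suc i) + coeff (g ⊛ h) i    ≈⟨ +-cong (*-congʳ e) f ⟩
      q * t * coeff h (suc i) + q * u          ≈⟨ solve 4 (λ q t h u → q :* t :* h :+ q :* u := q :* (t :* h :+ u)) refl q t _ u ⟩
      q * (t * coeff h (suc i) + u)            ∎)

  -- Divisibility by `0#` is vanishing, so each induction about divisible coefficients also settles
  -- the case of zero coefficients.
  0∣⇒≈0 : ∀ {x} → 0# ∣ʳ x → x ≈ 0#
  0∣⇒≈0 (t , e) = trans e (zeroˡ t)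

  ≈0⇒∣ : ∀ {q x} → x ≈ 0# → q ∣ʳ x
  ≈0⇒∣ {q} e = 0# , trans e (sym (zeroʳ q))

  0⊛ : ∀ g h → (∀ i → coeff g i ≈ 0#) → ∀ i → coeff (g ⊛ h) i ≈ 0#
  0⊛ g h p i = 0∣⇒≈0 (∣-coeff-⊛ 0# g h (λ j → ≈0⇒∣ (p j)) i)

  -- The bounds are asymmetric, degree < d against degree ≤ e, because this gives the sharp bound <
  -- d + e without subtraction.
  ⊛-DegreeBelow : ∀ d e g h → DegreeBelow d g → DegreeBelow (suc e) h → DegreeBelow (d ℕ.+ e) (g ⊛ h)
  ⊛-DegreeBelow zero    e g       h p q i       _       = 0⊛ g h (λ j → p j z≤n) i
  ⊛-DegreeBelow (suc d) e []      h p q i       _       = refl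
  ⊛-DegreeBelow (suc d) e (a ∷ g) h p q (suc i) (s≤s r) = begin
    coeff ((a ∷ g) ⊛ h) (suc i)            ≈⟨ coeff-∷⊛-suc a g h i ⟩
    a * coeff h (suc i) + coeff (g ⊛ h) i  ≈⟨ +-cong (*-congˡ (q (suc i) (s≤s (ℕₚ.≤-trans (ℕₚ.m≤n+m e d) r)))) (⊛-DegreeBelow d e g h (λ j s → p (suc j) (s≤s s)) q i r) ⟩
    a * 0# + 0#                            ≈⟨ trans (+-identityʳ _) (zeroʳ a) ⟩
    0#                                     ∎

  ⊛-Monic : ∀ d e g h → MonicOfDegree d g → MonicOfDegree e h → MonicOfDegree (d ℕ.+ e) (g ⊛ h)
  ⊛-Monic d e g h p q = lead d e g p q , λ i → ⊛-DegreeBelow (suc d) e g h (proj₂ p) (proj₂ q) i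
    where
    lead : ∀ d e g → MonicOfDegree d g → MonicOfDegree e h → coeff (g ⊛ h) (d ℕ.+ e) ≈ 1#
    -- For `[]` monicity reads `0# ≈ 1#`, which is also the goal; the ring may be trivial.
    lead d       e       []      (p₁ , p₂) _         = p₁
    lead (suc d) e       (a ∷ g) (p₁ , p₂) (q₁ , q₂) = begin
      coeff ((a ∷ g) ⊛ h) (suc (d ℕ.+ e))                  ≈⟨ coeff-∷⊛-suc a g h _ ⟩
      a * coeff h (suc (d ℕ.+ e)) + coeff (g ⊛ h) (d ℕ.+ e) ≈⟨ +-cong (*-congˡ (q₂ _ (s≤s (ℕₚ.m≤n+m e d)))) (lead d e g (p₁ , λ i r → p₂ (suc i) (s≤s r)) (q₁ , q₂)) ⟩
      a * 0# + 1#                                          ≈⟨ trans (+-congʳ (zeroʳ a)) (+-identityˡ 1#) ⟩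
      1#                                                   ∎
    lead zero    zero    (a ∷ g) (p₁ , p₂) (q₁ , q₂) = trans (coeff-∷⊛-zero a g h) (trans (*-cong p₁ q₁) (*-identityˡ 1#))
    lead zero    (suc e) (a ∷ g) (p₁ , p₂) (q₁ , q₂) = begin
      coeff ((a ∷ g) ⊛ h) (suc e)              ≈⟨ coeff-∷⊛-suc a g h e ⟩
      a * coeff h (suc e) + coeff (g ⊛ h) e    ≈⟨ +-cong (*-cong p₁ q₁) (0⊛ g h (λ j → p₂ (suc j) (s≤s z≤n)) e) ⟩
      1# * 1# + 0#                             ≈⟨ trans (+-identityʳ _) (*-identityˡ 1#) ⟩
      1#                                       ∎

  1-Monic : MonicOfDegree 0 (constant 1#)
  1-Monic = refl , λ { (suc i) _ → refl }

  X-Monic : MonicOfDegree 1 X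
  X-Monic = refl , λ { (suc zero) (s≤s ()) ; (suc (suc i)) _ → refl }

  ^-Monic : ∀ d g k → MonicOfDegree d g → MonicOfDegree (k ℕ.* d) (g ^ᵖ k)
  ^-Monic d g zero    p = 1-Monic
  ^-Monic d g (suc k) p = ⊛-Monic d (k ℕ.* d) g (g ^ᵖ k) p (^-Monic d g k p)

  X^-Monic : ∀ k → MonicOfDegree k (X ^ᵖ k)
  X^-Monic k = ≡.subst (λ d → MonicOfDegree d (X ^ᵖ k)) (ℕₚ.*-identityʳ k) (^-Monic 1 X k X-Monic)

  constant-DegreeBelow : ∀ a → DegreeBelow 1 (constant a)
  constant-DegreeBelow a (suc i) _ = refl

  -- Only the coefficients from degree `d` upward are constrained. Dropping the head of the first
  -- factor shifts exactly these by one, as `h` vanishes above `d`, so the tail is settled by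
  -- induction; the head is then read off in degree `d`.
  monic-cancel : ∀ d q w h → MonicOfDegree d h →
                 (∀ i → d ≤ i → q ∣ʳ coeff (w ⊛ h) i) → ∀ i → q ∣ʳ coeff w i
  monic-cancel d q []      h p@(p₁ , p₂) r i = ≈0⇒∣ refl
  monic-cancel d q (a ∷ w) h p@(p₁ , p₂) r = λ { zero → head d p₁ r ; (suc i) → tail i }
    where
    tail : ∀ i → q ∣ʳ coeff w i
    tail = monic-cancel d q w h p λ i d≤i →
      let t , e = r (suc i) (ℕₚ.m≤n⇒m≤1+n d≤i) in t , (begin
        coeff (w ⊛ h) i                         ≈⟨ +-identityˡ _ ⟨
        0# + coeff (w ⊛ h) i                    ≈⟨ +-congʳ (trans (*-congˡ (p₂ (suc i) (s≤s d≤i))) (zeroʳ a)) ⟨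
        a * coeff h (suc i) + coeff (w ⊛ h) i   ≈⟨ coeff-∷⊛-suc a w h i ⟨
        coeff ((a ∷ w) ⊛ h) (suc i)             ≈⟨ e ⟩
        q * t                                   ∎)
    head : ∀ d → coeff h d ≈ 1# → (∀ i → d ≤ i → q ∣ʳ coeff ((a ∷ w) ⊛ h) i) → q ∣ʳ a
    head zero p₁ r = let t , e = r 0 z≤n in t , (begin
      a                        ≈⟨ *-identityʳ a ⟨
      a * 1#                   ≈⟨ *-congˡ p₁ ⟨
      a * coeff h 0            ≈⟨ coeff-∷⊛-zero a w h ⟨
      coeff ((a ∷ w) ⊛ h) 0    ≈⟨ e ⟩
      q * t                    ∎)
    head (suc d) p₁ r =
      let t , e = r (suc d) ℕₚ.≤-refl
          u , f = ∣-coeff-⊛ q w h tail d in t - u , (begin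
      a                                                       ≈⟨ *-identityʳ a ⟨
      a * 1#                                                  ≈⟨ *-congˡ p₁ ⟨
      a * coeff h (suc d)                                     ≈⟨ solve 2 (λ x y → x := (x :+ y) :- y) refl _ (coeff (w ⊛ h) d) ⟩
      (a * coeff h (suc d) + coeff (w ⊛ h) d) - coeff (w ⊛ h) d ≈⟨ +-cong (trans (sym (coeff-∷⊛-suc a w h d)) e) (-‿cong f) ⟩
      q * t - q * u                                           ≈⟨ solve 3 (λ q t u → q :* t :- q :* u := q :* (t :- u)) refl q t u ⟩
      q * (t - u)                                             ∎)

  monic-cancel-0 : ∀ d w h → MonicOfDegree d h →
                   (∀ i → d ≤ i → coeff (w ⊛ h) i ≈ 0#) → ∀ i → coeff w i ≈ 0#
  monic-cancel-0 d w h p r i = 0∣⇒≈0 (monic-cancel d 0# w h p (λ j s → ≈0⇒∣ (r j s)) i)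

  -- Horner recursion on the dividend: from `f = q g + r`, the remainder of `a + X f` is `a + X r`
  -- minus `t g`, where `t` is the coefficient in degree `d`. No degree of `f` has to be known.
  divide : ∀ d g → MonicOfDegree d g → ∀ f →
           ∃[ q ] ∃[ r ] DegreeBelow d r × f ≋ (q ⊛ g) ⊕ r
  divide d g p []      = [] , [] , (λ _ _ → refl) , λ _ → refl
  divide d g p@(p₁ , p₂) (a ∷ f) with divide d g p f
  ... | q , r , r< , f≋ = t ∷ q , r′ , r′< , λ i → trans (eq i) (sym (coeff-⊕ ((t ∷ q) ⊛ g) r′ i))
    where
    t = coeff (a ∷ r) d
    r′ = (a ∷ r) ⊕ map (- t *_) g
    coeff-r′ : ∀ i → coeff r′ i ≈ coeff (a ∷ r) i + - t * coeff g i
    coeff-r′ i = trans (coeff-⊕ (a ∷ r) (map (- t *_) g) i) (+-congˡ (coeff-scale (- t) g i))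
    r′< : DegreeBelow d r′
    r′< i d≤i with ℕₚ.m≤n⇒m<n∨m≡n d≤i
    ... | inj₂ ≡.refl = trans (coeff-r′ d) (trans (+-congˡ (*-congˡ p₁))
                          (solve 1 (λ c → c :+ (:- c) :* con (ℤ.+ 1) := con (ℤ.+ 0)) refl t))
      where import Data.Integer.Base as ℤ
    r′< (suc i) _ | inj₁ d<i = trans (coeff-r′ (suc i)) (trans (+-cong (r< i (ℕ.s≤s⁻¹ d<i)) (*-congˡ (p₂ (suc i) d<i)))
                          (trans (+-identityˡ _) (zeroʳ _)))
    eq : ∀ i → coeff (a ∷ f) i ≈ coeff ((t ∷ q) ⊛ g) i + coeff r′ i
    eq zero = begin
      a                                                ≈⟨ solve 3 (λ a c g → a := c :* g :+ (a :+ (:- c) :* g)) refl a t (coeff g 0) ⟩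
      t * coeff g 0 + (a + - t * coeff g 0)            ≈⟨ +-cong (coeff-∷⊛-zero t q g) (coeff-r′ 0) ⟨
      coeff ((t ∷ q) ⊛ g) 0 + coeff r′ 0               ∎
    eq (suc i) = begin
      coeff f i                                        ≈⟨ f≋ i ⟩
      coeff ((q ⊛ g) ⊕ r) i                            ≈⟨ coeff-⊕ (q ⊛ g) r i ⟩
      coeff (q ⊛ g) i + coeff r i                      ≈⟨ solve 4 (λ x r c g → x :+ r := (c :* g :+ x) :+ (r :+ (:- c) :* g)) refl _ _ t (coeff g (suc i)) ⟩
      (t * coeff g (suc i) + coeff (q ⊛ g) i) + (coeff r i + - t * coeff g (suc i)) ≈⟨ +-cong (coeff-∷⊛-suc t q g i) (coeff-r′ (suc i)) ⟨
      coeff ((t ∷ q) ⊛ g) (suc i) + coeff r′ (suc i)   ∎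

  -- From degree `d` on, dropping the head of `q` only shifts the product by one. After `e` such
  -- shifts a single coefficient of `q` is left, and `monic-cancel-0` kills everything behind it.
  quotient-Monic : ∀ e d q g → MonicOfDegree d g →
                   coeff (q ⊛ g) (e ℕ.+ d) ≈ 1# → (∀ i → e ℕ.+ d < i → coeff (q ⊛ g) i ≈ 0#) →
                   MonicOfDegree e q
  quotient-Monic e       d []      g p@(p₁ , p₂) s z = s , λ _ _ → refl
  quotient-Monic zero    d (a ∷ q) g p@(p₁ , p₂) s z = lead d p₁ s , λ { (suc i) _ → q≋0 i }
    where
    q≋0 : ∀ i → coeff q i ≈ 0#
    q≋0 = monic-cancel-0 d q g p λ i d≤i → begin
        coeff (q ⊛ g) i                         ≈⟨ +-identityˡ _ ⟨
        0# + coeff (q ⊛ g) i                    ≈⟨ +-congʳ (trans (*-congˡ (p₂ (suc i) (s≤s d≤i))) (zeroʳ a)) ⟨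
        a * coeff g (suc i) + coeff (q ⊛ g) i   ≈⟨ coeff-∷⊛-suc a q g i ⟨
        coeff ((a ∷ q) ⊛ g) (suc i)             ≈⟨ z (suc i) (s≤s d≤i) ⟩
        0#                                      ∎
    lead : ∀ d → coeff g d ≈ 1# → coeff ((a ∷ q) ⊛ g) d ≈ 1# → a ≈ 1#
    lead zero    p₁ s = begin
      a                       ≈⟨ *-identityʳ a ⟨
      a * 1#                  ≈⟨ *-congˡ p₁ ⟨
      a * coeff g 0           ≈⟨ coeff-∷⊛-zero a q g ⟨
      coeff ((a ∷ q) ⊛ g) 0   ≈⟨ s ⟩
      1#                      ∎
    lead (suc d) p₁ s = begin
      a                                       ≈⟨ trans (+-identityʳ _) (*-identityʳ a) ⟨
      a * 1# + 0#                             ≈⟨ +-cong (*-congˡ p₁) (0⊛ q g q≋0 d) ⟨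
      a * coeff g (suc d) + coeff (q ⊛ g) d   ≈⟨ coeff-∷⊛-suc a q g d ⟨
      coeff ((a ∷ q) ⊛ g) (suc d)             ≈⟨ s ⟩
      1#                                      ∎
  quotient-Monic (suc e) d (a ∷ q) g p@(p₁ , p₂) s z =
    let s′ , z′ = quotient-Monic e d q g p (trans (sym (shift (e ℕ.+ d) (ℕₚ.m≤n+m d e))) s)
                    (λ i r → trans (sym (shift i (ℕₚ.≤-trans (ℕₚ.m≤n+m d e) (ℕₚ.<⇒≤ r)))) (z (suc i) (s≤s r)))
    in s′ , λ { (suc i) (s≤s r) → z′ i r }
    where
    shift : ∀ i → d ≤ i → coeff ((a ∷ q) ⊛ g) (suc i) ≈ coeff (q ⊛ g) i
    shift i d≤i = begin
        coeff ((a ∷ q) ⊛ g) (suc i)             ≈⟨ coeff-∷⊛-suc a q g i ⟩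
        a * coeff g (suc i) + coeff (q ⊛ g) i   ≈⟨ +-congʳ (trans (*-congˡ (p₂ (suc i) (s≤s d≤i))) (zeroʳ a)) ⟩
        0# + coeff (q ⊛ g) i                    ≈⟨ +-identityˡ _ ⟩
        coeff (q ⊛ g) i                         ∎

  -- The product has no coefficient in positive degree, so `monic-cancel-0` forces the inverse `w`
  -- to vanish, and with it the product.
  monic-unit⇒0≈1 : ∀ e w q → MonicOfDegree (suc e) q → (w ⊛ q) ≋ constant 1# → 0# ≈ 1#
  monic-unit⇒0≈1 e w q p r = trans (sym (0⊛ w q (monic-cancel-0 (suc e) w q p λ { (suc i) _ → r (suc i) }) 0)) (r 0)

-- Evaluation of polynomials along a ring homomorphism

module Evaluation {c₁ ℓ₁ c₂ ℓ₂} (R : CommutativeRing c₁ ℓ₁) (S : CommutativeRing c₂ ℓ₂)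
  (φ : CommutativeRing.Carrier R → CommutativeRing.Carrier S)
  (φ-hom : IsRingHomomorphism (CommutativeRing.rawRing R) (CommutativeRing.rawRing S) φ) where
  private module R = CommutativeRing R
  open import Algebra.Properties.Semiring.Exp R.semiring using () renaming (_^_ to _R^_)
  open CommutativeRing S
  open PolynomialProperties R using (Poly; coeff; _⊕_; _⊛_; constant; X; _≋_; _^ᵖ_)
  open IsRingHomomorphism φ-hom using () renaming
    (⟦⟧-cong to φ-cong; +-homo to φ-+; *-homo to φ-*; 0#-homo to φ-0; 1#-homo to φ-1; -‿homo to φ-neg) public
  open import Relation.Binary.Reasoning.Setoid setoid
  open import Algebra.Properties.Ring ring
  open import Algebra.Properties.Semiring.Exp semiring using (_^_)
  open IntegerSolver S

  ev : Poly → Carrier → Carrier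
  ev g x = Polynomial.eval (CommutativeRing.rawRing S) (map φ g) x

  ev-zero : ∀ g x → (∀ i → coeff g i R.≈ R.0#) → ev g x ≈ 0#
  ev-zero []      x p = refl
  ev-zero (a ∷ g) x p = trans (+-cong (trans (φ-cong (p 0)) φ-0) (trans (*-congˡ (ev-zero g x (λ i → p (suc i)))) (zeroʳ x))) (+-identityˡ 0#)

  ev-cong : ∀ g h x → g ≋ h → ev g x ≈ ev h x
  ev-cong []      h       x p = sym (ev-zero h x (λ i → R.sym (p i)))
  ev-cong (a ∷ g) []      x p = ev-zero (a ∷ g) x p
  ev-cong (a ∷ g) (b ∷ h) x p = +-cong (φ-cong (p 0)) (*-congˡ (ev-cong g h x (λ i → p (suc i))))

  ev-congˣ : ∀ g {x y} → x ≈ y → ev g x ≈ ev g y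
  ev-congˣ []      p = refl
  ev-congˣ (a ∷ g) p = +-congˡ (*-cong p (ev-congˣ g p))

  ev-⊕ : ∀ g h x → ev (g ⊕ h) x ≈ ev g x + ev h x
  ev-⊕ []      h       x = sym (+-identityˡ _)
  ev-⊕ (a ∷ g) []      x = sym (+-identityʳ _)
  ev-⊕ (a ∷ g) (b ∷ h) x = begin
    φ (a R.+ b) + x * ev (g ⊕ h) x           ≈⟨ +-cong (φ-+ a b) (*-congˡ (ev-⊕ g h x)) ⟩
    (φ a + φ b) + x * (ev g x + ev h x)      ≈⟨ solve 5 (λ a b x g h → (a :+ b) :+ x :* (g :+ h) := (a :+ x :* g) :+ (b :+ x :* h)) refl _ _ x _ _ ⟩
    (φ a + x * ev g x) + (φ b + x * ev h x)  ∎

  ev-scale : ∀ a h x → ev (map (a R.*_) h) x ≈ φ a * ev h x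
  ev-scale a []      x = sym (zeroʳ _)
  ev-scale a (b ∷ h) x = begin
    φ (a R.* b) + x * ev (map (a R.*_) h) x ≈⟨ +-cong (φ-* a b) (*-congˡ (ev-scale a h x)) ⟩
    φ a * φ b + x * (φ a * ev h x)          ≈⟨ solve 4 (λ a b x h → a :* b :+ x :* (a :* h) := a :* (b :+ x :* h)) refl _ _ x _ ⟩
    φ a * (φ b + x * ev h x)                ∎

  ev-neg : ∀ h x → ev (map R.-_ h) x ≈ - ev h x
  ev-neg []      x = sym -0#≈0#
  ev-neg (b ∷ h) x = begin
    φ (R.- b) + x * ev (map R.-_ h) x ≈⟨ +-cong (φ-neg b) (*-congˡ (ev-neg h x)) ⟩
    - φ b + x * - ev h x              ≈⟨ solve 3 (λ b x h → (:- b) :+ x :* (:- h) := :- (b :+ x :* h)) refl _ x _ ⟩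
    - (φ b + x * ev h x)              ∎

  ev-⊛ : ∀ g h x → ev (g ⊛ h) x ≈ ev g x * ev h x
  ev-⊛ []      h x = sym (zeroˡ _)
  ev-⊛ (a ∷ g) h x = begin
    ev (map (a R.*_) h ⊕ (R.0# ∷ (g ⊛ h))) x           ≈⟨ ev-⊕ (map (a R.*_) h) _ x ⟩
    ev (map (a R.*_) h) x + (φ R.0# + x * ev (g ⊛ h) x) ≈⟨ +-cong (ev-scale a h x) (trans (+-cong φ-0 (*-congˡ (ev-⊛ g h x))) (+-identityˡ _)) ⟩
    φ a * ev h x + x * (ev g x * ev h x)                ≈⟨ solve 4 (λ a x g h → a :* h :+ x :* (g :* h) := (a :+ x :* g) :* h) refl _ x _ _ ⟩
    (φ a + x * ev g x) * ev h x                         ∎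

  ev-constant : ∀ a x → ev (constant a) x ≈ φ a
  ev-constant a x = trans (+-congˡ (zeroʳ x)) (+-identityʳ _)

  ev-X : ∀ x → ev X x ≈ x
  ev-X x = trans (+-cong φ-0 (*-congˡ (trans (ev-constant R.1# x) φ-1))) (trans (+-identityˡ _) (*-identityʳ x))

  ev-^ : ∀ g k x → ev (g ^ᵖ k) x ≈ ev g x ^ k
  ev-^ g zero    x = trans (ev-constant R.1# x) φ-1
  ev-^ g (suc k) x = trans (ev-⊛ g (g ^ᵖ k) x) (*-congˡ (ev-^ g k x))

  φ-^ : ∀ a k → φ (a R^ k) ≈ φ a ^ k
  φ-^ a zero    = φ-1
  φ-^ a (suc k) = trans (φ-* a _) (*-congˡ (φ-^ a k))

-- The Frobenius map

prime∣!⇒≤ : ∀ {p} → Prime p → ∀ k → p ℕᵈ.∣ k ! → p ≤ k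
prime∣!⇒≤ pp zero    p∣1  = contradiction (≡.subst Prime (ℕᵈ.∣1⇒≡1 p∣1) pp) ¬prime[1]
prime∣!⇒≤ pp (suc k) p∣k! with euclidsLemma (suc k) (k !) pp p∣k!
... | inj₁ p∣1+k = ℕᵈ.∣⇒≤ p∣1+k
... | inj₂ p∣k!′ = ℕₚ.m≤n⇒m≤1+n (prime∣!⇒≤ pp k p∣k!′)

-- The prime divides p ! = (p C k) k ! (p - k) !, but neither of the two smaller factorials.
prime∣C : ∀ {p} → Prime p → ∀ k → 0 < k → k < p → p ℕᵈ.∣ p C k
prime∣C {p} pp k 0<k k<p = case₁ (euclidsLemma (p C k) (k ! ℕ.* (p ∸ k) !) pp p∣prod)
  where
  instance _ = ℕₚ._!*_!≢0 k (p ∸ k)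
  prod≡p! : (p C k) ℕ.* (k ! ℕ.* (p ∸ k) !) ≡ p !
  prod≡p! = ≡.trans (≡.cong (ℕ._* (k ! ℕ.* (p ∸ k) !)) (nCk≡n!/k![n-k]! (ℕₚ.<⇒≤ k<p)))
                    (m/n*n≡m (k![n∸k]!∣n! (ℕₚ.<⇒≤ k<p)))
  p∣p! : ∀ {q} → 0 < q → q ℕᵈ.∣ q !
  p∣p! {suc q} _ = ℕᵈ.m∣m*n (q !)
  p∣prod : p ℕᵈ.∣ (p C k) ℕ.* (k ! ℕ.* (p ∸ k) !)
  p∣prod = ≡.subst (p ℕᵈ.∣_) (≡.sym prod≡p!) (p∣p! (ℕₚ.<-trans 0<k k<p))
  p∸k<p : p ∸ k < p
  p∸k<p = ℕₚ.∸-monoʳ-< 0<k (ℕₚ.<⇒≤ k<p)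
  case₁ : p ℕᵈ.∣ p C k ⊎ p ℕᵈ.∣ k ! ℕ.* (p ∸ k) ! → p ℕᵈ.∣ p C k
  case₁ (inj₁ q) = q
  case₁ (inj₂ q) with euclidsLemma (k !) ((p ∸ k) !) pp q
  ... | inj₁ r = contradiction (prime∣!⇒≤ pp k r) (ℕₚ.<⇒≱ k<p)
  ... | inj₂ r = contradiction (prime∣!⇒≤ pp (p ∸ k) r) (ℕₚ.<⇒≱ p∸k<p)

module Frobenius {c ℓ} (R : CommutativeRing c ℓ) where
  open CommutativeRing R
  open import Algebra.Properties.Semiring.Exp semiring using (_^_; ^-congˡ; ^-congʳ; ^-assocʳ)
  open import Algebra.Properties.Semiring.Mult semiring
    using (×-congʳ; ×-assoc-*; ×-comm-*; ×-assocˡ; ×-homo-1) renaming (_×_ to _·_)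
  open import Algebra.Properties.Semiring.Sum semiring using (sum; sum-init-last; sum-cong-≋; sum-replicate-zero)
  import Algebra.Properties.CommutativeSemiring.Binomial commutativeSemiring as Binomial
  open import Relation.Binary.Reasoning.Setoid setoid

  middleTerm : ∀ p → Carrier → Carrier → Fin p → Carrier
  middleTerm p x y j = (suc p C suc (toℕ j)) · (x ^ suc (toℕ j) * y ^ (p ∸ toℕ j))

  -- Both end terms are split off with no assumption on the characteristic, so that the same
  -- expansion serves in the field L.
  binomial-ends : ∀ p x y → (x + y) ^ suc p ≈ y ^ suc p + (sum (middleTerm p x y) + x ^ suc p)
  binomial-ends p x y = begin
    (x + y) ^ suc p                         ≈⟨ Binomial.theorem (suc p) x y ⟩
    sum (Binomial.binomialTerm x y (suc p)) ≈⟨ +-cong (trans (×-homo-1 _) (*-identityˡ _)) (trans (sum-init-last {p} (λ i → t (toℕ i))) (+-cong init≈ last≈)) ⟩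
    y ^ suc p + (sum (middleTerm p x y) + x ^ suc p) ∎
    where
    t : ℕ → Carrier
    t i = (suc p C suc i) · (x ^ suc i * y ^ (p ∸ i))
    init≈ : sum {p} (λ j → t (toℕ (inject₁ j))) ≈ sum (middleTerm p x y)
    init≈ = sum-cong-≋ {p} {λ j → t (toℕ (inject₁ j))} {middleTerm p x y} (λ j → reflexive (≡.cong t (Finₚ.toℕ-inject₁ j)))
    last≈ : t (toℕ (fromℕ p)) ≈ x ^ suc p
    last≈ = begin
      t (toℕ (fromℕ p)) ≡⟨ ≡.cong t (Finₚ.toℕ-fromℕ p) ⟩
      t p               ≡⟨ ≡.cong₂ (λ a b → a · (x ^ suc p * y ^ b)) (nCn≡1 (suc p)) (ℕₚ.n∸n≡0 p) ⟩
      1 · (x ^ suc p * 1#) ≈⟨ trans (×-homo-1 _) (*-identityʳ _) ⟩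
      x ^ suc p         ∎

  -- Every middle term contains `x`, so `p · x ≈ 0#` suffices in place of characteristic p. This
  -- permits the use modulo p² with `x` a multiple of p, and modulo p h with `x = h`.
  frobenius : ∀ {p} → Prime p → ∀ x y → p · x ≈ 0# → (x + y) ^ p ≈ x ^ p + y ^ p
  frobenius {zero}  pp x y px≈0 = contradiction pp ¬prime[0]
  frobenius {suc p} pp x y px≈0 = begin
    (x + y) ^ suc p                                  ≈⟨ binomial-ends p x y ⟩
    y ^ suc p + (sum (middleTerm p x y) + x ^ suc p) ≈⟨ +-congˡ (+-congʳ (trans (sum-cong-≋ {p} {middleTerm p x y} {λ _ → 0#} vanish) (sum-replicate-zero p))) ⟩
    y ^ suc p + (0# + x ^ suc p)                     ≈⟨ +-congˡ (+-identityˡ _) ⟩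
    y ^ suc p + x ^ suc p                            ≈⟨ +-comm _ _ ⟩
    x ^ suc p + y ^ suc p                            ∎
    where
    vanish : ∀ j → middleTerm p x y j ≈ 0#
    vanish j with prime∣C pp (suc (toℕ j)) (s≤s z≤n) (s≤s (Finₚ.toℕ<n j))
    ... | ℕᵈ.divides q eq = begin
      (suc p C suc (toℕ j)) · (x ^ suc (toℕ j) * z) ≡⟨ ≡.cong (_· (x ^ suc (toℕ j) * z)) (≡.trans eq (ℕₚ.*-comm q (suc p))) ⟩
      (suc p ℕ.* q) · (x * x ^ toℕ j * z)           ≈⟨ ×-assocˡ _ (suc p) q ⟨
      suc p · (q · (x * x ^ toℕ j * z))             ≈⟨ ×-congʳ (suc p) (×-congʳ q (*-assoc _ _ _)) ⟩
      suc p · (q · (x * (x ^ toℕ j * z)))           ≈⟨ ×-congʳ (suc p) (×-comm-* q x _) ⟨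
      suc p · (x * (q · (x ^ toℕ j * z)))           ≈⟨ ×-assoc-* (suc p) x _ ⟨
      suc p · x * (q · (x ^ toℕ j * z))             ≈⟨ *-congʳ px≈0 ⟩
      0# * (q · (x ^ toℕ j * z))                    ≈⟨ zeroˡ _ ⟩
      0#                                            ∎
      where z = y ^ (p ∸ toℕ j)

  frobenius-iterate : ∀ {p} → Prime p → ∀ x y → p · x ≈ 0# → ∀ s → (x + y) ^ (p ℕ.^ s) ≈ x ^ (p ℕ.^ s) + y ^ (p ℕ.^ s)
  frobenius-iterate {p} pp x y px≈0 zero    = trans (*-identityʳ _) (sym (+-cong (*-identityʳ x) (*-identityʳ y)))
  frobenius-iterate {p} pp x y px≈0 (suc s) = begin
    (x + y) ^ (p ℕ.* q)         ≈⟨ power (x + y) ⟩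
    ((x + y) ^ q) ^ p           ≈⟨ ^-congˡ p (frobenius-iterate pp x y px≈0 s) ⟩
    (x ^ q + y ^ q) ^ p         ≈⟨ frobenius pp (x ^ q) (y ^ q) (px^≈0 q (ℕₚ.m^n>0 p s)) ⟩
    (x ^ q) ^ p + (y ^ q) ^ p   ≈⟨ +-cong (power x) (power y) ⟨
    x ^ (p ℕ.* q) + y ^ (p ℕ.* q) ∎
    where
    instance _ = prime⇒nonZero pp
    q = p ℕ.^ s
    power : ∀ z → z ^ (p ℕ.* q) ≈ (z ^ q) ^ p
    power z = trans (^-congʳ z (ℕₚ.*-comm p q)) (sym (^-assocʳ z q p))
    px^≈0 : ∀ k → 0 < k → p · x ^ k ≈ 0#
    px^≈0 (suc k) _ = trans (sym (×-assoc-* p x (x ^ k))) (trans (*-congʳ px≈0) (zeroˡ _))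

-- Images of integers and quotient rings

module IntegerImage {c ℓ} (R : CommutativeRing c ℓ) (ψ : ℤ → CommutativeRing.Carrier R)
  (ψ-hom : IsRingHomomorphism ℤ.+-*-rawRing (CommutativeRing.rawRing R) ψ) where
  open CommutativeRing R
  open IsRingHomomorphism ψ-hom
  open import Algebra.Properties.Semiring.Mult semiring using () renaming (_×_ to _·_)

  ·≈* : ∀ n x → n · x ≈ ψ (+ n) * x
  ·≈* zero    x = sym (trans (*-congʳ 0#-homo) (zeroˡ x))
  ·≈* (suc n) x = sym (trans (*-congʳ (trans (+-homo (+ 1) (+ n)) (+-congʳ 1#-homo)))
    (trans (distribʳ x _ _) (+-cong (*-identityˡ x) (sym (·≈* n x)))))

module Quotient {c ℓ} (R : CommutativeRing c ℓ) (a b : CommutativeRing.Carrier R) where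
  open CommutativeRing R
  open IntegerSolver R
  open import Relation.Binary.Reasoning.Setoid setoid

  infix 4 _≈ᴵ_
  -- Congruence modulo the ideal (a , b), stored with its cofactors because later arguments extract
  -- them. Principal ideals are the case `b = 0#`.
  record _≈ᴵ_ (x y : Carrier) : Set (c Level.⊔ ℓ) where
    constructor combination
    field
      s t      : Carrier
      equality : x ≈ y + (a * s + b * t)

  ≈⇒≈ᴵ : ∀ {x y} → x ≈ y → x ≈ᴵ y
  ≈⇒≈ᴵ {x} {y} e = combination 0# 0# (trans e (solve 3 (λ y a b → y := y :+ (a :* con (+ 0) :+ b :* con (+ 0))) refl y a b))

  quotient : CommutativeRing _ _
  quotient = record
    { Carrier = Carrier ; _≈_ = _≈ᴵ_ ; _+_ = _+_ ; _*_ = _*_ ; -_ = -_ ; 0# = 0# ; 1# = 1#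
    ; isCommutativeRing = record
      { isRing = record
        { +-isAbelianGroup = record
          { isGroup = record
            { isMonoid = record
              { isSemigroup = record
                { isMagma = record
                  { isEquivalence = record { refl = ≈⇒≈ᴵ refl ; sym = symᴵ ; trans = transᴵ }
                  ; ∙-cong = +-congᴵ }
                ; assoc = λ x y z → ≈⇒≈ᴵ (+-assoc x y z) }
              ; identity = (λ x → ≈⇒≈ᴵ (+-identityˡ x)) , (λ x → ≈⇒≈ᴵ (+-identityʳ x)) }
            ; inverse = (λ x → ≈⇒≈ᴵ (-‿inverseˡ x)) , (λ x → ≈⇒≈ᴵ (-‿inverseʳ x))
            ; ⁻¹-cong = negᴵ }
          ; comm = λ x y → ≈⇒≈ᴵ (+-comm x y) }
        ; *-cong = *-congᴵ
        ; *-assoc = λ x y z → ≈⇒≈ᴵ (*-assoc x y z)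
        ; *-identity = (λ x → ≈⇒≈ᴵ (*-identityˡ x)) , (λ x → ≈⇒≈ᴵ (*-identityʳ x))
        ; distrib = (λ x y z → ≈⇒≈ᴵ (distribˡ x y z)) , (λ x y z → ≈⇒≈ᴵ (distribʳ x y z)) }
      ; *-comm = λ x y → ≈⇒≈ᴵ (*-comm x y) } }
    where
    symᴵ : ∀ {x y} → x ≈ᴵ y → y ≈ᴵ x
    symᴵ {x} {y} (combination s t e) = combination (- s) (- t) $ sym (trans (+-congʳ e)
      (solve 5 (λ y a s b t → (y :+ (a :* s :+ b :* t)) :+ (a :* (:- s) :+ b :* (:- t)) := y) refl y a s b t))
    transᴵ : ∀ {x y z} → x ≈ᴵ y → y ≈ᴵ z → x ≈ᴵ z
    transᴵ {z = z} (combination s t e) (combination u v f) = combination (s + u) (t + v) $ trans e (trans (+-congʳ f)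
      (solve 7 (λ z a s b t u v → (z :+ (a :* u :+ b :* v)) :+ (a :* s :+ b :* t) := z :+ (a :* (s :+ u) :+ b :* (t :+ v))) refl z a s b t u v))
    +-congᴵ : ∀ {x y u v} → x ≈ᴵ y → u ≈ᴵ v → (x + u) ≈ᴵ (y + v)
    +-congᴵ {y = y} {v = z} (combination s t e) (combination u v f) = combination (s + u) (t + v) $ trans (+-cong e f)
      (solve 8 (λ y z a s b t u v → (y :+ (a :* s :+ b :* t)) :+ (z :+ (a :* u :+ b :* v)) := (y :+ z) :+ (a :* (s :+ u) :+ b :* (t :+ v))) refl y z a s b t u v)
    *-congᴵ : ∀ {x y u v} → x ≈ᴵ y → u ≈ᴵ v → (x * u) ≈ᴵ (y * v)
    *-congᴵ {x} {y} {w} {z} (combination s t e) (combination u v f) = combination (s * z + x * u) (t * z + x * v) (begin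
      x * w                                  ≈⟨ *-congˡ f ⟩
      x * (z + (a * u + b * v))              ≈⟨ distribˡ x z _ ⟩
      x * z + x * (a * u + b * v)            ≈⟨ +-congʳ (*-congʳ e) ⟩
      (y + (a * s + b * t)) * z + x * (a * u + b * v) ≈⟨ solve 9 (λ x y z a s b t u v → (y :+ (a :* s :+ b :* t)) :* z :+ x :* (a :* u :+ b :* v) := y :* z :+ (a :* (s :* z :+ x :* u) :+ b :* (t :* z :+ x :* v))) refl x y z a s b t u v ⟩
      y * z + (a * (s * z + x * u) + b * (t * z + x * v)) ∎)
    negᴵ : ∀ {x y} → x ≈ᴵ y → (- x) ≈ᴵ (- y)
    negᴵ {x} {y} (combination s t e) = combination (- s) (- t) $ trans (-‿cong e)
      (solve 5 (λ y a s b t → :- (y :+ (a :* s :+ b :* t)) := :- y :+ (a :* (:- s) :+ b :* (:- t))) refl y a s b t)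

  a*≈ᴵ0 : ∀ x → a * x ≈ᴵ 0#
  a*≈ᴵ0 x = combination x 0# (solve 3 (λ a b x → a :* x := con (+ 0) :+ (a :* x :+ b :* con (+ 0))) refl a b x)

  b*≈ᴵ0 : ∀ x → b * x ≈ᴵ 0#
  b*≈ᴵ0 x = combination 0# x (solve 3 (λ a b x → b :* x := con (+ 0) :+ (a :* con (+ 0) :+ b :* x)) refl a b x)

  private
    module Q where
      open Frobenius quotient public
      open import Algebra.Properties.Semiring.Mult (CommutativeRing.semiring quotient) public renaming (_×_ to _·_)
      open import Algebra.Properties.Semiring.Exp (CommutativeRing.semiring quotient) public
    open import Algebra.Properties.Semiring.Mult semiring using () renaming (_×_ to _·_)
    open import Algebra.Properties.Semiring.Exp semiring using (_^_)

    -- The operations of the quotient are those of the ring, but its multiples and powers are formed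
    -- from another ring record, so they are identified by induction.
    ·-quotient : ∀ n x → n Q.· x ≡ n · x
    ·-quotient zero    x = ≡.refl
    ·-quotient (suc n) x = ≡.cong (λ z → x + z) (·-quotient n x)

    ^-quotient : ∀ x n → x Q.^ n ≡ x ^ n
    ^-quotient x zero    = ≡.refl
    ^-quotient x (suc n) = ≡.cong (x *_) (^-quotient x n)

  ^-congᴵ : ∀ n {x y} → x ≈ᴵ y → x ^ n ≈ᴵ y ^ n
  ^-congᴵ n {x} {y} e = ≡.subst₂ _≈ᴵ_ (^-quotient x n) (^-quotient y n) (Q.^-congˡ n e)

  frobeniusᴵ : ∀ {p} → Prime p → ∀ x y → p · x ≈ᴵ 0# → (x + y) ^ p ≈ᴵ x ^ p + y ^ p
  frobeniusᴵ {p} pp x y e = ≡.subst₂ _≈ᴵ_ (^-quotient (x + y) p) (≡.cong₂ _+_ (^-quotient x p) (^-quotient y p))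
    (Q.frobenius pp x y (≡.subst (_≈ᴵ 0#) (≡.sym (·-quotient p x)) e))

  frobenius-iterateᴵ : ∀ {p} → Prime p → ∀ x y → p · x ≈ᴵ 0# → ∀ s → (x + y) ^ (p ℕ.^ s) ≈ᴵ x ^ (p ℕ.^ s) + y ^ (p ℕ.^ s)
  frobenius-iterateᴵ {p} pp x y e s = ≡.subst₂ _≈ᴵ_ (^-quotient (x + y) (p ℕ.^ s)) (≡.cong₂ _+_ (^-quotient x (p ℕ.^ s)) (^-quotient y (p ℕ.^ s)))
    (Q.frobenius-iterate pp x y (≡.subst (_≈ᴵ 0#) (≡.sym (·-quotient p x)) e) s)

-- Integers modulo p and p²

ℤ-ring : CommutativeRing _ _
ℤ-ring = ℤₚ.+-*-commutativeRing

open import Algebra.Properties.CommutativeSemiring.Exp (CommutativeRing.commutativeSemiring ℤ-ring)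
  using () renaming (_^_ to _^ᶻ_; ^-assocʳ to ^ᶻ-assocʳ) public

-- The Frobenius lemmas speak of the generic power of a semiring; this is the bridge to the power in
-- the theorem.
^≡^ᶻ : ∀ a k → a ℤ.^ k ≡ a ^ᶻ k
^≡^ᶻ a zero    = ≡.refl
^≡^ᶻ a (suc k) = cong (a ℤ.*_) (^≡^ᶻ a k)

pos-^ : ∀ a k → + (a ℕ.^ k) ≡ (+ a) ^ᶻ k
pos-^ a zero    = ≡.refl
pos-^ a (suc k) = ≡.trans (ℤₚ.pos-* a (a ℕ.^ k)) (cong ((+ a) ℤ.*_) (pos-^ a k))

infix 4 _∣ᶻ_
-- This is `_∣ʳ_` over ℤ unfolded, so `monic-cancel` applies to it directly.
_∣ᶻ_ : ℤ → ℤ → Set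
q ∣ᶻ x = ∃[ t ] x ≡ q ℤ.* t

∣ᶻ⇒∣ : ∀ {q x} → q ∣ᶻ x → ∣ q ∣ ℕᵈ.∣ ∣ x ∣
∣ᶻ⇒∣ {q} (t , e) = ℤˢ.∣⇒∣ᵤ (ℤˢ.divides t (≡.trans e (ℤₚ.*-comm q t)))

∣⇒∣ᶻ : ∀ {q x} → ∣ q ∣ ℕᵈ.∣ ∣ x ∣ → q ∣ᶻ x
∣⇒∣ᶻ {q} d with ℤˢ.∣ᵤ⇒∣ d
... | ℤˢ.divides t e = t , ≡.trans e (ℤₚ.*-comm t q)

module _ {p} (pp : Prime p) where
  private
    instance
      p≢0 : ℕ.NonZero p
      p≢0 = prime⇒nonZero pp
      p>1′ : ℕ.NonTrivial p
      p>1′ = prime⇒nonTrivial pp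

  prime>1 : 1 < p
  prime>1 = ℕ.nonTrivial⇒n>1 p

  prime∣*ᶻ : ∀ a b → p ℕᵈ.∣ ∣ a ℤ.* b ∣ → p ℕᵈ.∣ ∣ a ∣ ⊎ p ℕᵈ.∣ ∣ b ∣
  prime∣*ᶻ a b d = euclidsLemma ∣ a ∣ ∣ b ∣ pp (≡.subst (p ℕᵈ.∣_) (ℤₚ.abs-* a b) d)

  prime∣^ᶻ : ∀ a k → p ℕᵈ.∣ ∣ a ^ᶻ k ∣ → p ℕᵈ.∣ ∣ a ∣
  prime∣^ᶻ a zero    d = contradiction (≡.subst Prime (ℕᵈ.∣1⇒≡1 d) pp) ¬prime[1]
  prime∣^ᶻ a (suc k) d = [ (λ x → x) , prime∣^ᶻ a k ]′ (prime∣*ᶻ a (a ^ᶻ k) d)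

  ∤⇒coprime : ∀ {a} → ¬ p ℕᵈ.∣ a → Coprime p a
  ∤⇒coprime p∤a (d∣p , d∣a) with prime⇒irreducible pp d∣p
  ... | inj₁ d≡1 = d≡1
  ... | inj₂ ≡.refl = contradiction d∣a p∤a

  inverse-mod-ℕ : ∀ a → ¬ p ℕᵈ.∣ a → ∃₂ λ v t → + a ℤ.* v ≡ + 1 ℤ.+ + p ℤ.* t
  inverse-mod-ℕ a p∤a with coprime-Bézout (∤⇒coprime p∤a)
  ... | Bézout.+- x y e = ℤ.- (+ y) , ℤ.- (+ x) , (begin
    + a ℤ.* ℤ.- (+ y)                   ≡⟨ solve 2 (λ a y → a :* (:- y) := con (+ 1) :- (con (+ 1) :+ y :* a)) ≡.refl (+ a) (+ y) ⟩
    + 1 ℤ.- (+ 1 ℤ.+ + y ℤ.* + a)       ≡⟨ cong (λ z → + 1 ℤ.- (+ 1 ℤ.+ z)) (ℤₚ.pos-* y a) ⟨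
    + 1 ℤ.- (+ (1 ℕ.+ y ℕ.* a))         ≡⟨ cong (λ z → + 1 ℤ.- + z) e ⟩
    + 1 ℤ.- (+ (x ℕ.* p))               ≡⟨ cong (λ z → + 1 ℤ.- z) (ℤₚ.pos-* x p) ⟩
    + 1 ℤ.- (+ x ℤ.* + p)               ≡⟨ solve 2 (λ x p → con (+ 1) :- x :* p := con (+ 1) :+ p :* (:- x)) ≡.refl (+ x) (+ p) ⟩
    + 1 ℤ.+ + p ℤ.* ℤ.- (+ x)           ∎)
    where
    open ≡-Reasoning
    open IntegerSolver ℤ-ring
  ... | Bézout.-+ x y e = + y , + x , (begin
    + a ℤ.* + y             ≡⟨ ℤₚ.*-comm (+ a) (+ y) ⟩
    + y ℤ.* + a             ≡⟨ ℤₚ.pos-* y a ⟨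
    + (y ℕ.* a)             ≡⟨ cong +_ e ⟨
    + 1 ℤ.+ + (x ℕ.* p)     ≡⟨ cong (λ z → + 1 ℤ.+ z) (≡.trans (ℤₚ.pos-* x p) (ℤₚ.*-comm (+ x) (+ p))) ⟩
    + 1 ℤ.+ + p ℤ.* + x     ∎)
    where open ≡-Reasoning

  inverse-mod : ∀ a → ¬ p ℕᵈ.∣ ∣ a ∣ → ∃₂ λ v t → a ℤ.* v ≡ + 1 ℤ.+ + p ℤ.* t
  inverse-mod (+ a)     p∤a = inverse-mod-ℕ a p∤a
  inverse-mod (-[1+ a ]) p∤a =
    let v , t , e = inverse-mod-ℕ (suc a) p∤a
    in ℤ.- v , t , ≡.trans (≡.trans (≡.sym (ℤₚ.neg-distribʳ-* -[1+ a ] v)) (ℤₚ.neg-distribˡ-* -[1+ a ] v)) e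

  private
    module P = Quotient ℤ-ring (+ p) (+ 0)
    module P² = Quotient ℤ-ring (+ p ℤ.* + p) (+ 0)
    module ℤ/p = CommutativeRing P.quotient
    module ℤ/p² = CommutativeRing P².quotient
    open IntegerImage ℤ-ring (λ x → x) (isRingHomomorphism (CommutativeRing.rawRing ℤ-ring) ≡.refl) using (·≈*)
    open import Algebra.Properties.Semiring.Mult (CommutativeRing.semiring ℤ-ring) using () renaming (_×_ to _·_)

    p·x≈0 : ∀ x → (p · x) P.≈ᴵ (+ 0)
    p·x≈0 x = P.combination x (+ 0) (begin
      p · x                               ≡⟨ ·≈* p x ⟩
      + p ℤ.* x                           ≡⟨ ≡.sym (ℤₚ.+-identityʳ _) ⟩
      + p ℤ.* x ℤ.+ + 0                   ≡⟨ ≡.sym (ℤₚ.+-identityˡ _) ⟩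
      + 0 ℤ.+ (+ p ℤ.* x ℤ.+ + 0 ℤ.* + 0) ∎)
      where open ≡-Reasoning

    p^-zero : ∀ k → .{{ℕ.NonZero k}} → (+ 0) ^ᶻ k ≡ + 0
    p^-zero (suc k) = ≡.refl

    1^ : ∀ k → (+ 1) ^ᶻ k ≡ + 1
    1^ zero    = ≡.refl
    1^ (suc k) = ≡.trans (ℤₚ.*-identityˡ _) (1^ k)

    -- Induction on n: Frobenius splits `(1 + n) ^ p`, its hypothesis being read at the summand 1.
    fermat-ℕ : ∀ n → (+ n) ^ᶻ p P.≈ᴵ + n
    fermat-ℕ zero    = P.≈⇒≈ᴵ (p^-zero p)
    fermat-ℕ (suc n) = ℤ/p.trans (P.frobeniusᴵ pp (+ 1) (+ n) (p·x≈0 (+ 1)))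
      (ℤ/p.+-cong (P.≈⇒≈ᴵ (1^ p)) (fermat-ℕ n))

    fermatᴵ : ∀ a → a ^ᶻ p P.≈ᴵ a
    fermatᴵ (+ n)      = fermat-ℕ n
    -- Adding `(+ suc n) ^ᶻ p` turns the claim into `0 ^ p = 0`, with no distinction between p = 2
    -- and odd p.
    fermatᴵ a@(-[1+ n ]) = +-cancelʳ (+ suc n) (a ^ᶻ p) a (begin
      a ^ᶻ p ℤ.+ + suc n             ≈⟨ ℤ/p.+-congˡ {a ^ᶻ p} (fermat-ℕ (suc n)) ⟨
      a ^ᶻ p ℤ.+ (+ suc n) ^ᶻ p      ≈⟨ P.frobeniusᴵ pp a (+ suc n) (p·x≈0 a) ⟨
      (a ℤ.+ + suc n) ^ᶻ p           ≈⟨ P.≈⇒≈ᴵ (cong (_^ᶻ p) (ℤₚ.+-inverseˡ (+ suc n))) ⟩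
      (+ 0) ^ᶻ p                     ≈⟨ P.≈⇒≈ᴵ (p^-zero p) ⟩
      + 0                            ≈⟨ P.≈⇒≈ᴵ (ℤₚ.+-inverseˡ (+ suc n)) ⟨
      a ℤ.+ + suc n                  ∎)
      where
      open import Relation.Binary.Reasoning.Setoid ℤ/p.setoid
      open import Algebra.Properties.Ring ℤ/p.ring using (+-cancelʳ)

    drop-0 : ∀ {q y x s t} → x ≡ y ℤ.+ (q ℤ.* s ℤ.+ + 0 ℤ.* t) → x ≡ y ℤ.+ q ℤ.* s
    drop-0 {y = y} e = ≡.trans e (cong (λ z → y ℤ.+ z) (ℤₚ.+-identityʳ _))

  fermat : ∀ a → ∃[ t ] a ^ᶻ p ≡ a ℤ.+ + p ℤ.* t
  fermat a = let P.combination s t e = fermatᴵ a in s , drop-0 {q = + p} {y = a} {t = t} e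

  -- Apply Frobenius modulo p² to the summand z = p t: p z vanishes there, and so does z ^ p because
  -- p ≥ 2.
  lift-congruence : ∀ x y t → x ≡ y ℤ.+ + p ℤ.* t → ∃[ u ] x ^ᶻ p ≡ y ^ᶻ p ℤ.+ (+ p ℤ.* + p) ℤ.* u
  lift-congruence x y t ≡.refl = let P².combination s u e = proof in s , drop-0 {q = + p ℤ.* + p} {y = y ^ᶻ p} {t = u} e
    where
    open import Relation.Binary.Reasoning.Setoid ℤ/p².setoid
    open IntegerSolver ℤ-ring
    z = + p ℤ.* t
    pz≈0 : (p · z) P².≈ᴵ (+ 0)
    pz≈0 = P².combination t (+ 0) (≡.trans (·≈* p z) $
      solve 2 (λ p t → p :* (p :* t) := con (+ 0) :+ (p :* p :* t :+ con (+ 0) :* con (+ 0))) ≡.refl (+ p) t)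
    z^≈0 : ∀ k → 1 < k → z ^ᶻ k P².≈ᴵ (+ 0)
    z^≈0 (suc (suc k)) _ = P².combination (t ℤ.* t ℤ.* z ^ᶻ k) (+ 0) $
      solve 3 (λ p t w → p :* t :* (p :* t :* w) := con (+ 0) :+ (p :* p :* (t :* t :* w) :+ con (+ 0) :* con (+ 0))) ≡.refl (+ p) t (z ^ᶻ k)
    z^≈0 (suc zero) (s≤s ())
    proof : (y ℤ.+ z) ^ᶻ p P².≈ᴵ y ^ᶻ p
    proof = begin
      (y ℤ.+ z) ^ᶻ p       ≈⟨ P².≈⇒≈ᴵ (cong (_^ᶻ p) (ℤₚ.+-comm y z)) ⟩
      (z ℤ.+ y) ^ᶻ p       ≈⟨ P².frobeniusᴵ pp z y pz≈0 ⟩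
      z ^ᶻ p ℤ.+ y ^ᶻ p    ≈⟨ ℤ/p².+-congʳ (z^≈0 p prime>1) ⟩
      + 0 ℤ.+ y ^ᶻ p       ≈⟨ ℤ/p².+-identityˡ _ ⟩
      y ^ᶻ p               ∎

  fermat-iterate : ∀ b m → (∃[ t ] b ≡ m ℤ.+ + p ℤ.* t) → ∀ s → ∃[ t ] b ^ᶻ (p ℕ.^ s) ≡ m ℤ.+ + p ℤ.* t
  fermat-iterate b m (t , e) zero    = t , ≡.trans (ℤₚ.*-identityʳ b) e
  fermat-iterate b m c (suc s) =
    let t , e = fermat-iterate b m c s
        u , f = fermat (b ^ᶻ (p ℕ.^ s)) in t ℤ.+ u , (begin
    b ^ᶻ (p ℕ.* p ℕ.^ s)                 ≡⟨ cong (b ^ᶻ_) (ℕₚ.*-comm p (p ℕ.^ s)) ⟩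
    b ^ᶻ (p ℕ.^ s ℕ.* p)                 ≡⟨ ^ᶻ-assocʳ b (p ℕ.^ s) p ⟨
    (b ^ᶻ (p ℕ.^ s)) ^ᶻ p                ≡⟨ f ⟩
    b ^ᶻ (p ℕ.^ s) ℤ.+ + p ℤ.* u         ≡⟨ cong (ℤ._+ + p ℤ.* u) e ⟩
    (m ℤ.+ + p ℤ.* t) ℤ.+ + p ℤ.* u      ≡⟨ solve 4 (λ m p t u → (m :+ p :* t) :+ p :* u := m :+ p :* (t :+ u)) ≡.refl m (+ p) t u ⟩
    m ℤ.+ + p ℤ.* (t ℤ.+ u)              ∎)
    where
    open ≡-Reasoning
    open IntegerSolver ℤ-ring

  -- The power p ^ s keeps b congruent to m modulo p; one further p-th power lifts the congruence to
  -- p².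
  power-congruence : ∀ b m → (∃[ t ] b ≡ m ℤ.+ + p ℤ.* t) → ∀ s →
                     ∃[ u ] b ^ᶻ (p ℕ.^ suc s) ≡ m ^ᶻ p ℤ.+ (+ p ℤ.* + p) ℤ.* u
  power-congruence b m c s =
    let t , e = fermat-iterate b m c s
        u , f = lift-congruence _ m t e
    in u , ≡.trans (≡.trans (cong (b ^ᶻ_) (ℕₚ.*-comm p (p ℕ.^ s))) (≡.sym (^ᶻ-assocʳ b (p ℕ.^ s) p))) f

  -- b = m - p gives a unit also for s = 0, where b = m would give m - b ^ 1 = 0.
  unit-quotient : ∀ m s → (s ≢ 0 → ¬ p ℕ.* p ℕᵈ.∣ ∣ m ^ᶻ p ℤ.- m ∣) →
                  ∃[ c ] m ℤ.- (m ℤ.- + p) ^ᶻ (p ℕ.^ s) ≡ + p ℤ.* c × ¬ p ℕᵈ.∣ ∣ c ∣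
  unit-quotient m zero    _ = + 1 , (begin
    m ℤ.- (m ℤ.- + p) ^ᶻ 1  ≡⟨ cong (λ z → m ℤ.- z) (ℤₚ.*-identityʳ (m ℤ.- + p)) ⟩
    m ℤ.- (m ℤ.- + p)       ≡⟨ solve 2 (λ m p → m :- (m :- p) := p :* con (+ 1)) ≡.refl m (+ p) ⟩
    + p ℤ.* + 1             ∎) , λ p∣1 → contradiction (≡.subst Prime (ℕᵈ.∣1⇒≡1 p∣1) pp) ¬prime[1]
    where
    open ≡-Reasoning
    open IntegerSolver ℤ-ring
  unit-quotient m (suc s) p²∤ =
    let u , e = power-congruence (m ℤ.- + p) m (ℤ.- (+ 1) , solve 2 (λ m p → m :- p := m :+ p :* (:- con (+ 1))) ≡.refl m (+ p)) s
        t , f = fermat m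
        c = ℤ.- t ℤ.- + p ℤ.* u
    in c , (begin
      m ℤ.- (m ℤ.- + p) ^ᶻ (p ℕ.^ suc s)             ≡⟨ cong (λ z → m ℤ.- z) (≡.trans e (cong (λ z → z ℤ.+ + p ℤ.* + p ℤ.* u) f)) ⟩
      m ℤ.- (m ℤ.+ + p ℤ.* t ℤ.+ + p ℤ.* + p ℤ.* u)  ≡⟨ solve 4 (λ m p t u → m :- (m :+ p :* t :+ p :* p :* u) := p :* (:- t :- p :* u)) ≡.refl m (+ p) t u ⟩
      + p ℤ.* c                                      ∎) ,
      λ p∣c → p²∤ (λ ()) (p²∣ t u f (∣⇒∣ᶻ {+ p} {c} p∣c))
    where
    open ≡-Reasoning
    open IntegerSolver ℤ-ring
    p²∣ : ∀ t u → m ^ᶻ p ≡ m ℤ.+ + p ℤ.* t → + p ∣ᶻ ℤ.- t ℤ.- + p ℤ.* u → p ℕ.* p ℕᵈ.∣ ∣ m ^ᶻ p ℤ.- m ∣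
    p²∣ t u f (w , g) = ≡.subst (ℕᵈ._∣ ∣ m ^ᶻ p ℤ.- m ∣) (ℤₚ.abs-* (+ p) (+ p)) (∣ᶻ⇒∣ {+ p ℤ.* + p} (ℤ.- (w ℤ.+ u) , (begin
      m ^ᶻ p ℤ.- m                          ≡⟨ cong (λ z → z ℤ.- m) f ⟩
      m ℤ.+ + p ℤ.* t ℤ.- m                 ≡⟨ solve 4 (λ m p t u → m :+ p :* t :- m := p :* (:- (:- t :- p :* u) :- p :* u)) ≡.refl m (+ p) t u ⟩
      + p ℤ.* (ℤ.- (ℤ.- t ℤ.- + p ℤ.* u) ℤ.- + p ℤ.* u) ≡⟨ cong (λ z → + p ℤ.* (ℤ.- z ℤ.- + p ℤ.* u)) g ⟩
      + p ℤ.* (ℤ.- (+ p ℤ.* w) ℤ.- + p ℤ.* u) ≡⟨ solve 3 (λ p w u → p :* (:- (p :* w) :- p :* u) := p :* p :* (:- (w :+ u))) ≡.refl (+ p) w u ⟩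
      + p ℤ.* + p ℤ.* ℤ.- (w ℤ.+ u)         ∎)))

  extract-power : ∀ D → D ≢ 0 → ∃₂ λ e D′ → D ≡ p ℕ.^ e ℕ.* D′ × ¬ p ℕᵈ.∣ D′
  extract-power = <-rec _ step
    where
    step : ∀ D → (∀ {D′} → D′ < D → D′ ≢ 0 → ∃₂ λ e D″ → D′ ≡ p ℕ.^ e ℕ.* D″ × ¬ p ℕᵈ.∣ D″) →
           D ≢ 0 → ∃₂ λ e D′ → D ≡ p ℕ.^ e ℕ.* D′ × ¬ p ℕᵈ.∣ D′
    step D rec D≢0 with p ℕᵈ.∣? D
    ... | no p∤D = 0 , D , ≡.sym (ℕₚ.*-identityˡ D) , p∤D
    ... | yes (ℕᵈ.divides q ≡.refl) =
      let e , D″ , eq , p∤ = rec q<D q≢0 in suc e , D″ , (begin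
        q ℕ.* p                   ≡⟨ ℕₚ.*-comm q p ⟩
        p ℕ.* q                   ≡⟨ cong (p ℕ.*_) eq ⟩
        p ℕ.* (p ℕ.^ e ℕ.* D″)    ≡⟨ ℕₚ.*-assoc p _ D″ ⟨
        p ℕ.* p ℕ.^ e ℕ.* D″      ∎) , p∤
      where
      open ≡-Reasoning
      q≢0 : q ≢ 0
      q≢0 ≡.refl = D≢0 ≡.refl
      q<D : q < q ℕ.* p
      q<D = ℕₚ.m<m*n q p {{ℕ.≢-nonZero q≢0}} prime>1

  n<p^n : ∀ n → n < p ℕ.^ n
  n<p^n zero    = s≤s z≤n
  n<p^n (suc n) = ℕₚ.≤-<-trans (n<p^n n) (≡.subst (p ℕ.^ n <_) (ℕₚ.*-comm (p ℕ.^ n) p) (ℕₚ.m<m*n (p ℕ.^ n) p {{ℕₚ.m^n≢0 p n}} prime>1))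

  -- Pigeonhole on the residues of 1, p, p², … modulo k.
  order : ∀ k → ¬ p ℕᵈ.∣ k → .{{_ : ℕ.NonZero k}} → ∃₂ λ s t → p ℕ.^ suc s ≡ 1 ℕ.+ k ℕ.* t
  order k p∤k with Finₚ.pigeonhole (ℕₚ.n<1+n k) (λ (i : Fin (suc k)) → fromℕ< (ℕᵐ.m%n<n (p ℕ.^ toℕ i) k))
  ... | i , j , i<j , eq = s , ℕᵈ.quotient k∣ , (begin
      p ℕ.^ suc s                          ≡⟨ ℕₚ.m+[n∸m]≡n (ℕₚ.m^n>0 p (suc s)) ⟨
      1 ℕ.+ (p ℕ.^ suc s ∸ 1)              ≡⟨ cong (1 ℕ.+_) (≡.trans (ℕᵈ._∣_.equality k∣) (ℕₚ.*-comm (ℕᵈ.quotient k∣) k)) ⟩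
      1 ℕ.+ k ℕ.* ℕᵈ.quotient k∣           ∎)
    where
    open ≡-Reasoning
    I = toℕ i
    J = toℕ j
    s = J ∸ suc I
    I+s≡J : I ℕ.+ suc s ≡ J
    I+s≡J = ≡.trans (ℕₚ.+-suc I s) (ℕₚ.m+[n∸m]≡n i<j)
    %≡ : p ℕ.^ I ℕᵐ.% k ≡ p ℕ.^ J ℕᵐ.% k
    %≡ = ≡.trans (≡.sym (Finₚ.toℕ-fromℕ< (ℕᵐ.m%n<n (p ℕ.^ I) k))) (≡.trans (cong toℕ eq) (Finₚ.toℕ-fromℕ< (ℕᵐ.m%n<n (p ℕ.^ J) k)))
    pow : p ℕ.^ J ≡ p ℕ.^ I ℕ.* p ℕ.^ suc s
    pow = ≡.trans (cong (p ℕ.^_) (≡.sym I+s≡J)) (ℕₚ.^-distribˡ-+-* p I (suc s))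
    k∣diff : k ℕᵈ.∣ p ℕ.^ I ℕ.* (p ℕ.^ suc s ∸ 1)
    k∣diff = ≡.subst (k ℕᵈ.∣_) (begin
      p ℕ.^ J ∸ p ℕ.^ I                           ≡⟨ cong₂ _∸_ pow (≡.sym (ℕₚ.*-identityʳ (p ℕ.^ I))) ⟩
      p ℕ.^ I ℕ.* p ℕ.^ suc s ∸ p ℕ.^ I ℕ.* 1     ≡⟨ ℕₚ.*-distribˡ-∸ (p ℕ.^ I) _ 1 ⟨
      p ℕ.^ I ℕ.* (p ℕ.^ suc s ∸ 1)               ∎) k∣∸
      where
      k∣∸ : k ℕᵈ.∣ p ℕ.^ J ∸ p ℕ.^ I
      k∣∸ = ℕᵈ.divides (p ℕ.^ J ℕᵐ./ k ∸ p ℕ.^ I ℕᵐ./ k) (begin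
        p ℕ.^ J ∸ p ℕ.^ I ≡⟨ cong₂ _∸_ (ℕᵐ.m≡m%n+[m/n]*n (p ℕ.^ J) k) (ℕᵐ.m≡m%n+[m/n]*n (p ℕ.^ I) k) ⟩
        (p ℕ.^ J ℕᵐ.% k ℕ.+ p ℕ.^ J ℕᵐ./ k ℕ.* k) ∸ (p ℕ.^ I ℕᵐ.% k ℕ.+ p ℕ.^ I ℕᵐ./ k ℕ.* k)
          ≡⟨ cong (λ z → (z ℕ.+ p ℕ.^ J ℕᵐ./ k ℕ.* k) ∸ (p ℕ.^ I ℕᵐ.% k ℕ.+ p ℕ.^ I ℕᵐ./ k ℕ.* k)) %≡ ⟨
        (p ℕ.^ I ℕᵐ.% k ℕ.+ p ℕ.^ J ℕᵐ./ k ℕ.* k) ∸ (p ℕ.^ I ℕᵐ.% k ℕ.+ p ℕ.^ I ℕᵐ./ k ℕ.* k)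
          ≡⟨ ℕₚ.[m+n]∸[m+o]≡n∸o (p ℕ.^ I ℕᵐ.% k) _ _ ⟩
        p ℕ.^ J ℕᵐ./ k ℕ.* k ∸ p ℕ.^ I ℕᵐ./ k ℕ.* k ≡⟨ ℕₚ.*-distribʳ-∸ k (p ℕ.^ J ℕᵐ./ k) (p ℕ.^ I ℕᵐ./ k) ⟨
        (p ℕ.^ J ℕᵐ./ k ∸ p ℕ.^ I ℕᵐ./ k) ℕ.* k ∎)
    coprime^ : ∀ i x → k ℕᵈ.∣ p ℕ.^ i ℕ.* x → k ℕᵈ.∣ x
    coprime^ zero    x d = ≡.subst (k ℕᵈ.∣_) (ℕₚ.*-identityˡ x) d
    coprime^ (suc i) x d = coprime^ i x (Coprimality.coprime-divisor (Coprimality.sym (∤⇒coprime p∤k))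
      (≡.subst (k ℕᵈ.∣_) (ℕₚ.*-assoc p (p ℕ.^ i) x) d))
    k∣ : k ℕᵈ.∣ p ℕ.^ suc s ∸ 1
    k∣ = coprime^ I _ k∣diff

  -- The lower bound is there because the exponent of nilpotency to be beaten is arbitrary. Raising
  -- `p ^ suc s = 1 + k t` to the power j keeps the residue 1 modulo k and makes the left side at
  -- least j.
  order≥ : ∀ k → ¬ p ℕᵈ.∣ k → .{{_ : ℕ.NonZero k}} → ∀ j → ∃₂ λ s t → p ℕ.^ s ≡ 1 ℕ.+ k ℕ.* t × j ≤ p ℕ.^ s
  order≥ k p∤k j =
    let s , t , e = order k p∤k
        u , f = powers t j
    in suc s ℕ.* j , u ,
       ≡.trans (≡.sym (ℕₚ.^-*-assoc p (suc s) j)) (≡.trans (cong (ℕ._^ j) e) f) ,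
       ℕₚ.≤-trans (ℕₚ.m≤m+n j (s ℕ.* j)) (ℕₚ.<⇒≤ (n<p^n (suc s ℕ.* j)))
    where
    open ≡-Reasoning
    powers : ∀ t j → ∃[ u ] (1 ℕ.+ k ℕ.* t) ℕ.^ j ≡ 1 ℕ.+ k ℕ.* u
    powers t zero    = 0 , cong suc (≡.sym (ℕₚ.*-zeroʳ k))
    powers t (suc j) = let u , e = powers t j in u ℕ.+ t ℕ.* (1 ℕ.+ k ℕ.* u) , (begin
      (1 ℕ.+ k ℕ.* t) ℕ.* (1 ℕ.+ k ℕ.* t) ℕ.^ j          ≡⟨ cong ((1 ℕ.+ k ℕ.* t) ℕ.*_) e ⟩
      (1 ℕ.+ k ℕ.* u) ℕ.+ k ℕ.* t ℕ.* (1 ℕ.+ k ℕ.* u)    ≡⟨ cong ((1 ℕ.+ k ℕ.* u) ℕ.+_) (ℕₚ.*-assoc k t _) ⟩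
      (1 ℕ.+ k ℕ.* u) ℕ.+ k ℕ.* (t ℕ.* (1 ℕ.+ k ℕ.* u))  ≡⟨ cong suc (≡.sym (ℕₚ.*-distribˡ-+ k u _)) ⟩
      1 ℕ.+ k ℕ.* (u ℕ.+ t ℕ.* (1 ℕ.+ k ℕ.* u))          ∎)

  -- The p-adic valuation of an integer

  greatestExponent-∣ : ∀ k b → p ℕ.^ greatestExponent p k b ℕᵈ.∣ k
  greatestExponent-∣ k zero = ℕᵈ.1∣ k
  greatestExponent-∣ k (suc b) with (p ℕ.^ suc b) ℕᵈ.∣? k
  ... | yes d = d
  ... | no _  = greatestExponent-∣ k b

  greatestExponent-max : ∀ k b e → e ≤ b → p ℕ.^ e ℕᵈ.∣ k → e ≤ greatestExponent p k b
  greatestExponent-max k zero    e z≤n d = z≤n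
  greatestExponent-max k (suc b) e e≤ d with (p ℕ.^ suc b) ℕᵈ.∣? k
  ... | yes _ = e≤
  ... | no ¬d with ℕₚ.m≤n⇒m<n∨m≡n e≤
  ...   | inj₁ e<  = greatestExponent-max k b e (ℕ.s≤s⁻¹ e<) d
  ...   | inj₂ ≡.refl = contradiction d ¬d

  ∣⇒≤multiplicity : ∀ k → k ≢ 0 → ∀ e → p ℕ.^ e ℕᵈ.∣ k → e ≤ multiplicity p k
  ∣⇒≤multiplicity k k≢0 e d = greatestExponent-max k k e
    (ℕₚ.≤-trans (ℕₚ.<⇒≤ (n<p^n e)) (ℕᵈ.∣⇒≤ {{ℕ.≢-nonZero k≢0}} d)) d

  multiplicity-1 : multiplicity p 1 ≡ 0
  multiplicity-1 with ℕₚ.m^n≡1⇒n≡0∨m≡1 p (multiplicity p 1) (ℕᵈ.∣1⇒≡1 (greatestExponent-∣ 1 1))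
  ... | inj₁ e = e
  ... | inj₂ ≡.refl = contradiction pp ¬prime[1]

  ν-fromℤ : ∀ a → a ≢ + 0 → ν p (fromℤ a) ≡ [ + multiplicity p ∣ a ∣ ]
  ν-fromℤ a a≢0 with a ℤₚ.≟ + 0
  ... | yes e = contradiction e a≢0
  ... | no _  = cong [_] (≡.trans (cong (λ e → + multiplicity p ∣ a ∣ ℤ.- + e) multiplicity-1) (ℤₚ.+-identityʳ _))

  ν-zero : ∀ {i} → ν p (fromℤ (+ 0)) ≢ [ i ]
  ν-zero ()

  p^2≡ : p ℕ.^ 2 ≡ p ℕ.* p
  p^2≡ = cong (p ℕ.*_) (ℕₚ.*-identityʳ p)

  ν≡1⇒ : ∀ a → ν p (fromℤ a) ≡ [ + 1 ] → p ℕᵈ.∣ ∣ a ∣ × ¬ p ℕ.* p ℕᵈ.∣ ∣ a ∣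
  ν≡1⇒ a e = ≡.subst (ℕᵈ._∣ ∣ a ∣) (≡.trans (cong (p ℕ.^_) mult≡1) (ℕₚ.*-identityʳ p)) (greatestExponent-∣ ∣ a ∣ ∣ a ∣) ,
    λ d → contradiction (∣⇒≤multiplicity ∣ a ∣ (λ z → a≢0 (ℤₚ.∣i∣≡0⇒i≡0 z)) 2 (≡.subst (ℕᵈ._∣ ∣ a ∣) (≡.sym p^2≡) d))
            (ℕₚ.<⇒≱ (s≤s (ℕₚ.≤-reflexive mult≡1)))
    where
    a≢0 : a ≢ + 0
    a≢0 a≡0 = ν-zero (≡.subst (λ b → ν p (fromℤ b) ≡ [ + 1 ]) a≡0 e)
    mult≡1 : multiplicity p ∣ a ∣ ≡ 1
    mult≡1 = ℤₚ.+-injective ([]-injective (≡.trans (≡.sym (ν-fromℤ a a≢0)) e))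

  ⇒ν≡1 : ∀ a → p ℕᵈ.∣ ∣ a ∣ → ¬ p ℕ.* p ℕᵈ.∣ ∣ a ∣ → ν p (fromℤ a) ≡ [ + 1 ]
  ⇒ν≡1 a p∣a p²∤a = ≡.trans (ν-fromℤ a a≢0) (cong (λ e → [ + e ]) (ℕₚ.≤-antisym mult≤1
      (∣⇒≤multiplicity ∣ a ∣ (λ z → a≢0 (ℤₚ.∣i∣≡0⇒i≡0 z)) 1 (≡.subst (ℕᵈ._∣ ∣ a ∣) (≡.sym (ℕₚ.*-identityʳ p)) p∣a))))
    where
    a≢0 : a ≢ + 0
    a≢0 ≡.refl = p²∤a (_ ℕᵈ.∣0)
    mult≤1 : multiplicity p ∣ a ∣ ≤ 1
    mult≤1 = ℕₚ.≮⇒≥ λ 2≤ → p²∤a (ℕᵈ.∣-trans (≡.subst (ℕᵈ._∣ p ℕ.^ multiplicity p ∣ a ∣) p^2≡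
      (≡.subst (p ℕ.^ 2 ℕᵈ.∣_) (≡.trans (≡.sym (ℕₚ.^-distribˡ-+-* p 2 (multiplicity p ∣ a ∣ ∸ 2))) (cong (p ℕ.^_) (ℕₚ.m+[n∸m]≡n 2≤))) (ℕᵈ.m∣m*n _)))
      (greatestExponent-∣ ∣ a ∣ ∣ a ∣))

-- Maximality at p of an order in which p is, up to a unit, a power of h

module Dedekind {c ℓ} (A : CommutativeRing c ℓ) where
  open CommutativeRing A
  open CommutativeExp commutativeSemiring
  open IntegerSolver A
  open import Relation.Binary.Reasoning.Setoid setoid

  -- The relevant power of `h` is `suc P`, so `h ^ P` is the last one before p appears. Both `u` and
  -- the part `D′` of the denominator prime to p need inverses only modulo (h , p).
  module AtPrime (p : Carrier) (p-cancel : ∀ {x y} → p * x ≈ p * y → x ≈ y)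
    (D D′ : Carrier) (e : ℕ) (D≈ : D ≈ p ^ e * D′)
    (h u v d : Carrier) (P : ℕ) (h^P≈pu : h ^ suc P ≈ p * u)
    (uv≈1 : Quotient._≈ᴵ_ A h p (u * v) 1#) (D′d≈1 : Quotient._≈ᴵ_ A h p (D′ * d) 1#)
    (reduced : ∀ z k → Quotient._≈ᴵ_ A h p (z ^ k) 0# → Quotient._≈ᴵ_ A h p z 0#) where
    open Quotient A h p
    private module B = CommutativeRing quotient

    -- D is a common denominator of the powers of w / p.
    Divided : Carrier → Set _
    Divided w = ∀ k → ∃[ a ] D * w ^ k ≈ p ^ k * a

    Divided-resp : ∀ {w w′} → w ≈ w′ → Divided w → Divided w′
    Divided-resp w≈ Dw k = let a , eq = Dw k in a , trans (*-congˡ (^-congˡ k (sym w≈))) eq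

    Divided-* : ∀ x w → Divided w → Divided (x * w)
    Divided-* x w Dw k = let a , eq = Dw k in x ^ k * a , (begin
      D * (x * w) ^ k     ≈⟨ *-congˡ (^-distrib-* x w k) ⟩
      D * (x ^ k * w ^ k) ≈⟨ solve 3 (λ D x w → D :* (x :* w) := x :* (D :* w)) refl D _ _ ⟩
      x ^ k * (D * w ^ k) ≈⟨ *-congˡ eq ⟩
      x ^ k * (p ^ k * a) ≈⟨ solve 3 (λ x p a → x :* (p :* a) := p :* (x :* a)) refl _ _ a ⟩
      p ^ k * (x ^ k * a) ∎)

    -- Dividing by p, this is translation by an element of A. The mixed powers
    -- `w ^ j * (w + p * b) ^ k` are treated by expanding one factor at a time, so no binomial
    -- coefficients occur.
    Divided-+ : ∀ b w → Divided w → Divided (w + p * b)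
    Divided-+ b w Dw k = let a , eq = mixed k 0 in a , (begin
      D * (w + p * b) ^ k        ≈⟨ *-congˡ (*-identityˡ _) ⟨
      D * (1# * (w + p * b) ^ k) ≈⟨ eq ⟩
      p ^ (k ℕ.+ 0) * a          ≈⟨ *-congʳ (^-congʳ p (ℕₚ.+-identityʳ k)) ⟩
      p ^ k * a                  ∎)
      where
      mixed : ∀ k j → ∃[ a ] D * (w ^ j * (w + p * b) ^ k) ≈ p ^ (k ℕ.+ j) * a
      mixed zero    j = let a , eq = Dw j in a , trans (*-congˡ (*-identityʳ _)) eq
      mixed (suc k) j =
        let a₁ , eq₁ = mixed k (suc j)
            a₂ , eq₂ = mixed k j in a₁ + b * a₂ , (begin
        D * (w ^ j * ((w + p * b) * y ^ k))
          ≈⟨ solve 6 (λ D wj w p b y → D :* (wj :* ((w :+ p :* b) :* y)) := D :* ((w :* wj) :* y) :+ p :* b :* (D :* (wj :* y))) refl D _ w p b _ ⟩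
        D * (w ^ suc j * y ^ k) + p * b * (D * (w ^ j * y ^ k))
          ≈⟨ +-cong (trans eq₁ (*-congʳ (^-congʳ p (ℕₚ.+-suc k j)))) (*-congˡ eq₂) ⟩
        p * p ^ (k ℕ.+ j) * a₁ + p * b * (p ^ (k ℕ.+ j) * a₂)
          ≈⟨ solve 5 (λ p q a b c → p :* q :* a :+ p :* b :* (q :* c) := p :* q :* (a :+ b :* c)) refl p _ a₁ b a₂ ⟩
        p * p ^ (k ℕ.+ j) * (a₁ + b * a₂) ∎)
        where y = w + p * b

    p^-cancel : ∀ k {x y} → p ^ k * x ≈ p ^ k * y → x ≈ y
    p^-cancel zero    eq = trans (sym (*-identityˡ _)) (trans eq (*-identityˡ _))
    p^-cancel (suc k) eq = p^-cancel k (p-cancel (trans (sym (*-assoc p _ _)) (trans eq (*-assoc p _ _))))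

    -- h ^ P * z / p is almost integral and h ^ suc P is p up to a unit, so z / h
    -- is almost integral, and z is nilpotent modulo (h , p).
    divided⇒≈ᴵ0 : ∀ z → Divided (h ^ P * z) → z ≈ᴵ 0#
    divided⇒≈ᴵ0 z Dz = reduced z k z^k≈0
      where
      -- Of `h ^ k`, the part `h ^ (suc P * e)` becomes `(p * u) ^ e` and cancels the `p ^ e` in D;
      -- the one extra `h` places the result in the ideal.
      k = suc (suc P ℕ.* e)
      a = proj₁ (Dz k)
      pu^ : ∀ j → (h ^ suc P) ^ j ≈ p ^ j * u ^ j
      pu^ j = trans (^-congˡ j h^P≈pu) (^-distrib-* p u j)
      step₁ : h ^ k * a ≈ D * (u ^ k * z ^ k)
      step₁ = p^-cancel k (begin
        p ^ k * (h ^ k * a)             ≈⟨ solve 3 (λ p h a → p :* (h :* a) := h :* (p :* a)) refl _ _ a ⟩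
        h ^ k * (p ^ k * a)             ≈⟨ *-congˡ (proj₂ (Dz k)) ⟨
        h ^ k * (D * (h ^ P * z) ^ k)   ≈⟨ *-congˡ (*-congˡ (^-distrib-* (h ^ P) z k)) ⟩
        h ^ k * (D * ((h ^ P) ^ k * z ^ k)) ≈⟨ solve 4 (λ h D g z → h :* (D :* (g :* z)) := D :* ((h :* g) :* z)) refl _ D _ _ ⟩
        D * ((h ^ k * (h ^ P) ^ k) * z ^ k) ≈⟨ *-congˡ (*-congʳ (^-distrib-* h (h ^ P) k)) ⟨
        D * ((h ^ suc P) ^ k * z ^ k)   ≈⟨ *-congˡ (*-congʳ (pu^ k)) ⟩
        D * (p ^ k * u ^ k * z ^ k)     ≈⟨ solve 4 (λ D p u z → D :* (p :* u :* z) := p :* (D :* (u :* z))) refl D _ _ _ ⟩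
        p ^ k * (D * (u ^ k * z ^ k))   ∎)
      step₂ : D′ * (u ^ k * z ^ k) ≈ h * (u ^ e * a)
      step₂ = p^-cancel e (begin
        p ^ e * (D′ * (u ^ k * z ^ k)) ≈⟨ *-assoc _ D′ _ ⟨
        p ^ e * D′ * (u ^ k * z ^ k)   ≈⟨ *-congʳ D≈ ⟨
        D * (u ^ k * z ^ k)            ≈⟨ step₁ ⟨
        h * h ^ (suc P ℕ.* e) * a      ≈⟨ *-congʳ (*-congˡ (trans (sym (^-assocʳ h (suc P) e)) (pu^ e))) ⟩
        h * (p ^ e * u ^ e) * a        ≈⟨ solve 4 (λ h p u a → h :* (p :* u) :* a := p :* (h :* (u :* a))) refl h _ _ a ⟩
        p ^ e * (h * (u ^ e * a))      ∎)
      1^≈1 : ∀ k → 1# ^ k ≈ 1#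
      1^≈1 zero    = refl
      1^≈1 (suc k) = trans (*-identityˡ _) (1^≈1 k)
      z^k≈0 : z ^ k ≈ᴵ 0#
      z^k≈0 = B.trans (B.sym (B.trans (B.*-congʳ one) (B.*-identityˡ _))) (≈ᴵ-begin)
        where
        one : D′ * d * (u * v) ^ k ≈ᴵ 1#
        one = B.trans (B.*-cong D′d≈1 (B.trans (^-congᴵ k uv≈1) (≈⇒≈ᴵ (1^≈1 k)))) (B.*-identityˡ 1#)
        ≈ᴵ-begin : D′ * d * (u * v) ^ k * z ^ k ≈ᴵ 0#
        ≈ᴵ-begin = combination (u ^ e * a * (d * v ^ k)) 0# (begin
          D′ * d * (u * v) ^ k * z ^ k               ≈⟨ *-congʳ (*-congˡ (^-distrib-* u v k)) ⟩
          D′ * d * (u ^ k * v ^ k) * z ^ k           ≈⟨ solve 5 (λ D d u v z → D :* d :* (u :* v) :* z := D :* (u :* z) :* (d :* v)) refl D′ d _ _ _ ⟩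
          D′ * (u ^ k * z ^ k) * (d * v ^ k)         ≈⟨ *-congʳ step₂ ⟩
          h * (u ^ e * a) * (d * v ^ k)              ≈⟨ solve 4 (λ h w x p → h :* w :* x := con (+ 0) :+ (h :* (w :* x) :+ p :* con (+ 0))) refl h _ _ p ⟩
          0# + (h * (u ^ e * a * (d * v ^ k)) + p * 0#) ∎)

    -- If `h ^ j z / p` is almost integral, then so is `h ^ P z / p`, whence z = h z₁ + p z₂.
    -- Subtracting the multiple of p leaves `h ^ (j + 1) z₁ / p` almost integral, so a factor h
    -- moves from z to the multiplier at each round.
    descend : ∀ i j → i ℕ.+ j ≡ suc P → ∀ z → Divided (h ^ j * z) → ∃₂ λ s t → z ≈ h ^ i * s + p * t
    descend zero    j eq z Dz = z , 0# , sym (trans (+-cong (*-identityˡ z) (zeroʳ p)) (+-identityʳ z))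
    descend (suc i) j eq z Dz =
      let combination z₁ z₂ z≈ = divided⇒≈ᴵ0 z (Divided-resp ^≈ (Divided-* (h ^ i) _ Dz))
          s , t , z₁≈ = descend i (suc j) (≡.trans (ℕₚ.+-suc i j) eq) z₁
            (Divided-resp (begin
              h ^ j * z + p * - (h ^ j * z₂)                         ≈⟨ +-congʳ (*-congˡ z≈) ⟩
              h ^ j * (0# + (h * z₁ + p * z₂)) + p * - (h ^ j * z₂)  ≈⟨ solve 5 (λ g h p x y → g :* (con (+ 0) :+ (h :* x :+ p :* y)) :+ p :* (:- (g :* y)) := h :* g :* x) refl (h ^ j) h p z₁ z₂ ⟩
              h ^ suc j * z₁                                         ∎)
              (Divided-+ (- (h ^ j * z₂)) _ Dz))
      in s , h * t + z₂ , (begin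
        z                                  ≈⟨ z≈ ⟩
        0# + (h * z₁ + p * z₂)             ≈⟨ +-congˡ (+-congʳ (*-congˡ z₁≈)) ⟩
        0# + (h * (h ^ i * s + p * t) + p * z₂) ≈⟨ solve 6 (λ h g s p t z → con (+ 0) :+ (h :* (g :* s :+ p :* t) :+ p :* z) := h :* g :* s :+ p :* (h :* t :+ z)) refl h _ s p t z₂ ⟩
        h ^ suc i * s + p * (h * t + z₂)   ∎)
      where
      ^≈ : h ^ i * (h ^ j * z) ≈ h ^ P * z
      ^≈ = trans (sym (*-assoc _ _ z)) (*-congʳ (trans (sym (^-homo-* h i j)) (^-congʳ h (ℕₚ.suc-injective eq))))

    divided⇒divisible : ∀ z → Divided z → ∃[ a ] z ≈ p * a
    divided⇒divisible z Dz =
      let s , t , z≈ = descend (suc P) 0 (ℕₚ.+-identityʳ _) z (Divided-resp (sym (*-identityˡ z)) Dz)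
      in u * s + t , (begin
        z                     ≈⟨ z≈ ⟩
        h ^ suc P * s + p * t ≈⟨ +-congʳ (*-congʳ h^P≈pu) ⟩
        p * u * s + p * t     ≈⟨ solve 4 (λ p u s t → p :* u :* s :+ p :* t := p :* (u :* s :+ t)) refl p u s t ⟩
        p * (u * s + t)       ∎)

-- The field ℚ(α)

ℚ-ring : CommutativeRing _ _
ℚ-ring = ℚₚ.+-*-commutativeRing

fromℤ-hom : IsRingHomomorphism ℤ.+-*-rawRing ℚ.+-*-rawRing fromℤ
fromℤ-hom = record
  { isSemiringHomomorphism = record
    { isNearSemiringHomomorphism = record
      { +-isMonoidHomomorphism = record
        { isMagmaHomomorphism = record { isRelHomomorphism = record { cong = cong fromℤ } ; homo = hom-+ }
        ; ε-homo = ≡.refl }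
      ; *-homo = hom-* }
    ; 1#-homo = ≡.refl }
  ; -‿homo = hom-neg }
  where
  open IntegerSolver ℤ-ring
  hom-+ : ∀ a b → fromℤ (a ℤ.+ b) ≡ fromℤ a ℚ.+ fromℤ b
  hom-+ a b = ℚₚ.toℚᵘ-injective (ℚᵘₚ.≃-trans (ℚᵘ.*≡*
    (solve 2 (λ a b → (a :+ b) :* con (+ 1) := (a :* con (+ 1) :+ b :* con (+ 1)) :* con (+ 1)) ≡.refl a b))
    (ℚᵘₚ.≃-sym (ℚₚ.toℚᵘ-homo-+ (fromℤ a) (fromℤ b))))
  hom-* : ∀ a b → fromℤ (a ℤ.* b) ≡ fromℤ a ℚ.* fromℤ b
  hom-* a b = ℚₚ.toℚᵘ-injective (ℚᵘₚ.≃-trans (ℚᵘ.*≡* ≡.refl)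
    (ℚᵘₚ.≃-sym (ℚₚ.toℚᵘ-homo-* (fromℤ a) (fromℤ b))))
  hom-neg : ∀ a → fromℤ (ℤ.- a) ≡ ℚ.- fromℤ a
  hom-neg a = ℚₚ.toℚᵘ-injective (ℚᵘₚ.≃-trans (ℚᵘ.*≡* ≡.refl)
    (ℚᵘₚ.≃-sym (ℚₚ.toℚᵘ-homo‿- (fromℤ a))))

fromℤ-injective : ∀ {a b} → fromℤ a ≡ fromℤ b → a ≡ b
fromℤ-injective = cong ↥_

denominator-cancel : ∀ q → fromℤ (↧ q) ℚ.* q ≡ fromℤ (↥ q)
denominator-cancel q@(ℚ.mkℚ _ _ _) = ℚₚ.toℚᵘ-injective (ℚᵘₚ.≃-trans (ℚₚ.toℚᵘ-homo-* (fromℤ (↧ q)) q) (ℚᵘ.*≡* (begin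
  ↧ q ℤ.* ↥ q ℤ.* + 1                   ≡⟨ solve 2 (λ a b → a :* b :* con (+ 1) := b :* (con (+ 1) :* a)) ≡.refl (↧ q) (↥ q) ⟩
  ↥ q ℤ.* (+ 1 ℤ.* ↧ q)                 ∎)))
  where
  open ≡-Reasoning
  open IntegerSolver ℤ-ring

module ℤᵖ = PolynomialProperties ℤ-ring
module ℚᵖ = PolynomialProperties ℚ-ring

coeff-map : ∀ g i → ℚᵖ.coeff (map fromℤ g) i ≡ fromℤ (ℤᵖ.coeff g i)
coeff-map []      i       = ≡.refl
coeff-map (a ∷ g) zero    = ≡.refl
coeff-map (a ∷ g) (suc i) = coeff-map g i

map-fromℤ-Monic : ∀ {d} g → ℤᵖ.MonicOfDegree d g → ℚᵖ.MonicOfDegree d (map fromℤ g)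
map-fromℤ-Monic {d} g (p , q) = ≡.trans (coeff-map g d) (cong fromℤ p) ,
  λ i d<i → ≡.trans (coeff-map g i) (cong fromℤ (q i d<i))

map-fromℤ-DegreeBelow : ∀ {d} g → ℤᵖ.DegreeBelow d g → ℚᵖ.DegreeBelow d (map fromℤ g)
map-fromℤ-DegreeBelow g q i d≤i = ≡.trans (coeff-map g i) (cong fromℤ (q i d≤i))

Xⁿ-m-Monic : ∀ n m → 0 < n → ℤᵖ.MonicOfDegree n (X^ n - m)
Xⁿ-m-Monic n m 0<n = ℤᵖ.⊕-Monic (ℤᵖ.X ℤᵖ.^ᵖ n) (ℤ.- m ∷ []) (ℤᵖ.X^-Monic n)
  (ℤᵖ.DegreeBelow-mono (ℤ.- m ∷ []) 0<n (ℤᵖ.constant-DegreeBelow (ℤ.- m)))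

-- Degrees come from decidable equality of the coefficients in ℚ; in L nothing is ever tested for
-- zero.
leading : ∀ d r → ℚᵖ.DegreeBelow d r → (∀ i → ℚᵖ.coeff r i ≡ 0ℚ) ⊎
          (∃₂ λ e t → e < d × ℚᵖ.MonicOfDegree e (map (t ℚ.*_) r))
leading zero    r r< = inj₁ (λ i → r< i z≤n)
leading (suc d) r r< with ℚᵖ.coeff r d ℚₚ.≟ 0ℚ
... | no c≢0 = inj₂ (d , ℚ.1/ ℚᵖ.coeff r d , ℕₚ.n<1+n d ,
      ≡.trans (ℚᵖ.coeff-scale (ℚ.1/ ℚᵖ.coeff r d) r d) (ℚₚ.*-inverseˡ (ℚᵖ.coeff r d)) , ℚᵖ.scale-DegreeBelow (ℚ.1/ ℚᵖ.coeff r d) r r<)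
  where instance _ = ℚ.≢-nonZero c≢0
... | yes c≡0 with leading d r (λ i d≤i → [ r< i , (λ { ≡.refl → c≡0 }) ]′ (ℕₚ.m≤n⇒m<n∨m≡n d≤i))
...   | inj₁ z = inj₁ z
...   | inj₂ (e , t , e<d , mon) = inj₂ (e , t , ℕₚ.m<n⇒m<1+n e<d , mon)

module Field {c ℓ₁ ℓ₂} (L : FieldExtensionOfℚ c ℓ₁ ℓ₂) where
  private module F = FieldExtensionOfℚ L
  open F public using (ι; ι-isRingHomomorphism)

  L-ring : CommutativeRing c ℓ₁
  L-ring = HeytingCommutativeRing.commutativeRing F.heytingCommutativeRing

  open CommutativeRing L-ring public
  open import Relation.Binary.Reasoning.Setoid setoid
  open IntegerSolver L-ring
  open import Algebra.Properties.CommutativeSemiring.Exp commutativeSemiring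

  φ : ℤ → Carrier
  φ = ι ∘ fromℤ

  φ-hom : IsRingHomomorphism ℤ.+-*-rawRing rawRing φ
  φ-hom = Composition.isRingHomomorphism trans fromℤ-hom ι-isRingHomomorphism

  module Evℤ = Evaluation ℤ-ring L-ring φ φ-hom
  module Evℚ = Evaluation ℚ-ring L-ring ι ι-isRingHomomorphism

  1≉0 : ¬ 1# ≈ 0#
  1≉0 e = F.#-irrefl e (F.invertible⇒# (1# , trans (*-identityˡ _) 1-0≈1 , trans (*-identityʳ _) 1-0≈1))
    where
    1-0≈1 : 1# - 0# ≈ 1#
    1-0≈1 = solve 0 (con (+ 1) :- con (+ 0) := con (+ 1)) refl

  ι-inverse : ∀ q → q ≢ 0ℚ → ∃[ y ] ι q * y ≈ 1#
  ι-inverse q q≢0 = ι (ℚ.1/ q) , trans (sym (Evℚ.φ-* q (ℚ.1/ q))) (trans (Evℚ.φ-cong (ℚₚ.*-inverseʳ q)) Evℚ.φ-1)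
    where instance _ = ℚ.≢-nonZero q≢0

  φ-inverse : ∀ a → a ≢ + 0 → ∃[ y ] φ a * y ≈ 1#
  φ-inverse a a≢0 = ι-inverse (fromℤ a) (λ e → a≢0 (fromℤ-injective e))

  unit-cancel : ∀ {a y} → a * y ≈ 1# → ∀ {u v} → a * u ≈ a * v → u ≈ v
  unit-cancel {a} {y} ay≈1 {u} {v} e = begin
    u            ≈⟨ *-identityˡ u ⟨
    1# * u       ≈⟨ *-congʳ (trans (*-comm y a) ay≈1) ⟨
    y * a * u    ≈⟨ *-assoc y a u ⟩
    y * (a * u)  ≈⟨ *-congˡ e ⟩
    y * (a * v)  ≈⟨ *-assoc y a v ⟨
    y * a * v    ≈⟨ *-congʳ (trans (*-comm y a) ay≈1) ⟩
    1# * v       ≈⟨ *-identityˡ v ⟩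
    v            ∎

  φ-cancel : ∀ a → a ≢ + 0 → ∀ {u v} → φ a * u ≈ φ a * v → u ≈ v
  φ-cancel a a≢0 = unit-cancel (proj₂ (φ-inverse a a≢0))

  evℚ-map : ∀ g x → Evℚ.ev (map fromℤ g) x ≈ Evℤ.ev g x
  evℚ-map g x = reflexive (cong (λ l → Polynomial.eval rawRing l x) (≡.sym (Listₚ.map-∘ g)))

  clear-denominators : ∀ g x → ∃₂ λ N z → N ≢ 0 × φ (+ N) * Evℚ.ev g x ≈ Evℤ.ev z x
  clear-denominators []      x = 1 , [] , (λ ()) , zeroʳ _
  clear-denominators (a ∷ g) x =
    let N , z , N≢0 , e = clear-denominators g x
    in ↧ₙ a ℕ.* N , + N ℤ.* ↥ a ∷ map (↧ a ℤ.*_) z ,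
       (λ eq → [ (λ ()) , N≢0 ]′ (ℕₚ.m*n≡0⇒m≡0∨n≡0 (↧ₙ a) eq)) , (begin
      φ (+ (↧ₙ a ℕ.* N)) * (ι a + x * Evℚ.ev g x)             ≈⟨ *-congʳ (trans (Evℤ.φ-cong (ℤₚ.pos-* (↧ₙ a) N)) (Evℤ.φ-* (↧ a) (+ N))) ⟩
      φ (↧ a) * φ (+ N) * (ι a + x * Evℚ.ev g x)              ≈⟨ solve 5 (λ d N a x g → d :* N :* (a :+ x :* g) := N :* (d :* a) :+ x :* (d :* (N :* g))) refl _ _ _ x _ ⟩
      φ (+ N) * (φ (↧ a) * ι a) + x * (φ (↧ a) * (φ (+ N) * Evℚ.ev g x)) ≈⟨ +-cong (*-congˡ (trans (sym (Evℚ.φ-* (fromℤ (↧ a)) a)) (Evℚ.φ-cong (denominator-cancel a)))) (*-congˡ (*-congˡ e)) ⟩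
      φ (+ N) * φ (↥ a) + x * (φ (↧ a) * Evℤ.ev z x)          ≈⟨ +-cong (Evℤ.φ-* (+ N) (↥ a)) (*-congˡ (Evℤ.ev-scale (↧ a) z x)) ⟨
      φ (+ N ℤ.* ↥ a) + x * Evℤ.ev (map (↧ a ℤ.*_) z) x       ∎)

  module Root (n : ℕ) (0<n : 0 < n) (m : ℤ) (irreducible : IrreducibleOverℚ (X^ n - m))
              (α : Carrier) (isRoot : IsRoot L (X^ n - m) α) where
    private
      f = X^ n - m
      fℚ = map fromℤ f
      fℚ-Monic : ℚᵖ.MonicOfDegree n fℚ
      fℚ-Monic = map-fromℤ-Monic f (Xⁿ-m-Monic n m 0<n)
      fℚ≈0 : Evℚ.ev fℚ α ≈ 0#
      fℚ≈0 = trans (evℚ-map f α) isRoot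

    α^n≈m : α ^ n ≈ φ m
    α^n≈m = begin
      α ^ n                       ≈⟨ solve 2 (λ x y → x := (x :+ (:- y)) :+ y) refl _ (φ m) ⟩
      (α ^ n + - φ m) + φ m       ≈⟨ +-congʳ (+-cong (trans (Evℤ.ev-^ ℤᵖ.X n α) (^-congˡ n (Evℤ.ev-X α)))
                                      (trans (Evℤ.ev-neg (ℤᵖ.constant m) α) (-‿cong (Evℤ.ev-constant m α)))) ⟨
      (Evℤ.ev (ℤᵖ.X ℤᵖ.^ᵖ n) α + Evℤ.ev (map ℤ.-_ (ℤᵖ.constant m)) α) + φ m
                                  ≈⟨ +-congʳ (Evℤ.ev-⊕ (ℤᵖ.X ℤᵖ.^ᵖ n) _ α) ⟨
      Evℤ.ev f α + φ m            ≈⟨ +-congʳ isRoot ⟩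
      0# + φ m                    ≈⟨ +-identityˡ _ ⟩
      φ m                         ∎

    -- Divide f by g: irreducibility makes the remainder nonzero, and its value at
    -- α is invertible by induction.
    monic-invertible : ∀ d → d < n → ∀ g → ℚᵖ.MonicOfDegree d g → ∃[ u ] Evℚ.ev u α * Evℚ.ev g α ≈ 1#
    monic-invertible = <-rec _ step
      where
      step : ∀ d → (∀ {e} → e < d → e < n → ∀ g → ℚᵖ.MonicOfDegree e g → ∃[ u ] Evℚ.ev u α * Evℚ.ev g α ≈ 1#) →
             d < n → ∀ g → ℚᵖ.MonicOfDegree d g → ∃[ u ] Evℚ.ev u α * Evℚ.ev g α ≈ 1#
      step zero    rec d<n g (p₁ , p₂) = ℚᵖ.constant 1ℚ , (begin
        Evℚ.ev (ℚᵖ.constant 1ℚ) α * Evℚ.ev g α   ≈⟨ *-cong 1≈ (trans (Evℚ.ev-cong g (ℚᵖ.constant 1ℚ) α (λ { zero → p₁ ; (suc i) → p₂ (suc i) (s≤s z≤n) })) 1≈) ⟩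
        1# * 1#                                  ≈⟨ *-identityˡ 1# ⟩
        1#                                       ∎)
        where
        1≈ : Evℚ.ev (ℚᵖ.constant 1ℚ) α ≈ 1#
        1≈ = trans (Evℚ.ev-constant 1ℚ α) Evℚ.φ-1
      step d@(suc d′) rec d<n g mon with ℚᵖ.divide d g mon fℚ
      ... | q , r , r< , f≋ with leading d r r<
      ...   | inj₂ (e , t , e<d , mon′) =
        let u , eq = rec e<d (ℕₚ.<-trans e<d d<n) (map (t ℚ.*_) r) mon′
        -- At α, `q g + r = 0` and `u (t r) = 1`, so `- t u q` inverts `g`.
        in map ℚ.-_ (map (t ℚ.*_) u ℚᵖ.⊛ q) , (begin
          Evℚ.ev (map ℚ.-_ (map (t ℚ.*_) u ℚᵖ.⊛ q)) α * G
            ≈⟨ *-congʳ (trans (Evℚ.ev-neg (map (t ℚ.*_) u ℚᵖ.⊛ q) α) (-‿cong (trans (Evℚ.ev-⊛ (map (t ℚ.*_) u) q α) (*-congʳ (Evℚ.ev-scale t u α))))) ⟩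
          - (ι t * Evℚ.ev u α * Q) * G
            ≈⟨ solve 5 (λ t u q g r → :- (t :* u :* q) :* g := u :* (t :* r) :- u :* t :* (q :* g :+ r)) refl (ι t) (Evℚ.ev u α) Q G R ⟩
          Evℚ.ev u α * (ι t * R) - Evℚ.ev u α * ι t * (Q * G + R)
            ≈⟨ +-cong (trans (*-congˡ (sym (Evℚ.ev-scale t r α))) eq) (-‿cong (trans (*-congˡ QG+R≈0) (zeroʳ _))) ⟩
          1# - 0#
            ≈⟨ solve 0 (con (+ 1) :- con (+ 0) := con (+ 1)) refl ⟩
          1# ∎)
        where
        Q = Evℚ.ev q α
        G = Evℚ.ev g α
        R = Evℚ.ev r α
        QG+R≈0 : Q * G + R ≈ 0#
        QG+R≈0 = begin
          Q * G + R                     ≈⟨ +-congʳ (Evℚ.ev-⊛ q g α) ⟨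
          Evℚ.ev (q ℚᵖ.⊛ g) α + R       ≈⟨ Evℚ.ev-⊕ (q ℚᵖ.⊛ g) r α ⟨
          Evℚ.ev (q ℚᵖ.⊛ g ℚᵖ.⊕ r) α    ≈⟨ Evℚ.ev-cong fℚ (q ℚᵖ.⊛ g ℚᵖ.⊕ r) α f≋ ⟨
          Evℚ.ev fℚ α                   ≈⟨ fℚ≈0 ⟩
          0#                            ∎
      ...   | inj₁ r≈0 = contradiction 0≡1 (λ ())
        where
        f≋qg : ∀ i → ℚᵖ.coeff fℚ i ≡ ℚᵖ.coeff (q ℚᵖ.⊛ g) i
        f≋qg i = ≡.trans (f≋ i) (≡.trans (ℚᵖ.coeff-⊕ (q ℚᵖ.⊛ g) r i)
                   (≡.trans (cong (λ z → ℚᵖ.coeff (q ℚᵖ.⊛ g) i ℚ.+ z) (r≈0 i)) (ℚₚ.+-identityʳ _)))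
        -- The degree of `q` is displayed as a successor: both factors must have positive degree in
        -- order not to be units.
        n≡ : suc (n ∸ suc d) ℕ.+ d ≡ n
        n≡ = ≡.trans (≡.sym (ℕₚ.+-suc (n ∸ suc d) d)) (ℕₚ.m∸n+n≡m d<n)
        q-Monic : ℚᵖ.MonicOfDegree (suc (n ∸ suc d)) q
        q-Monic = ℚᵖ.quotient-Monic _ d q g mon
          (≡.trans (≡.sym (f≋qg _)) (≡.subst (λ k → ℚᵖ.coeff fℚ k ≡ 1ℚ) (≡.sym n≡) (proj₁ fℚ-Monic)))
          (λ i r → ≡.trans (≡.sym (f≋qg i)) (proj₂ fℚ-Monic i (≡.subst (_< i) n≡ r)))
        0≡1 : 0ℚ ≡ 1ℚ
        0≡1 with ℚ[X].Irreducible.split-∣1 irreducible {q} {g} f≋qg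
        ... | inj₁ (w RawMagmaDefs., e) = ℚᵖ.monic-unit⇒0≈1 _ w q q-Monic e
        ... | inj₂ (w RawMagmaDefs., e) = ℚᵖ.monic-unit⇒0≈1 d′ w g mon e

    zero-or-invertible : ∀ g → ℚᵖ.DegreeBelow n g →
      (∀ i → ℚᵖ.coeff g i ≡ 0ℚ) ⊎ (∃[ u ] Evℚ.ev u α * Evℚ.ev g α ≈ 1#)
    zero-or-invertible g g< with leading n g g<
    ... | inj₁ z = inj₁ z
    ... | inj₂ (e , t , e<n , mon) =
      let u , eq = monic-invertible e e<n (map (t ℚ.*_) g) mon in inj₂ (map (t ℚ.*_) u , (begin
        Evℚ.ev (map (t ℚ.*_) u) α * Evℚ.ev g α   ≈⟨ *-congʳ (Evℚ.ev-scale t u α) ⟩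
        ι t * Evℚ.ev u α * Evℚ.ev g α            ≈⟨ solve 3 (λ t u g → t :* u :* g := u :* (t :* g)) refl _ _ _ ⟩
        Evℚ.ev u α * (ι t * Evℚ.ev g α)          ≈⟨ *-congˡ (Evℚ.ev-scale t g α) ⟨
        Evℚ.ev u α * Evℚ.ev (map (t ℚ.*_) g) α   ≈⟨ eq ⟩
        1#                                       ∎))

    -- A combination of 1 , α , ... , α ^ (n - 1) with a nonzero coefficient is invertible in L, so
    -- it cannot vanish.
    independent : ∀ g → ℚᵖ.DegreeBelow n g → Evℚ.ev g α ≈ 0# → ∀ i → ℚᵖ.coeff g i ≡ 0ℚ
    independent g g< g≈0 with zero-or-invertible g g<
    ... | inj₁ z = z
    ... | inj₂ (u , e) = contradiction (trans (sym e) (trans (*-congˡ g≈0) (zeroʳ _))) 1≉0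

    reduceℤ : ∀ g → ∃[ r ] ℤᵖ.DegreeBelow n r × Evℤ.ev g α ≈ Evℤ.ev r α
    reduceℤ g = let q , r , r< , e = ℤᵖ.divide n f (Xⁿ-m-Monic n m 0<n) g in r , r< , (begin
      Evℤ.ev g α                          ≈⟨ Evℤ.ev-cong g (q ℤᵖ.⊛ f ℤᵖ.⊕ r) α e ⟩
      Evℤ.ev (q ℤᵖ.⊛ f ℤᵖ.⊕ r) α          ≈⟨ Evℤ.ev-⊕ (q ℤᵖ.⊛ f) r α ⟩
      Evℤ.ev (q ℤᵖ.⊛ f) α + Evℤ.ev r α    ≈⟨ +-congʳ (trans (Evℤ.ev-⊛ q f α) (trans (*-congˡ isRoot) (zeroʳ _))) ⟩
      0# + Evℤ.ev r α                     ≈⟨ +-identityˡ _ ⟩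
      Evℤ.ev r α                          ∎)

    reduceℚ : ∀ g → ∃[ r ] ℚᵖ.DegreeBelow n r × Evℚ.ev g α ≈ Evℚ.ev r α
    reduceℚ g = let q , r , r< , e = ℚᵖ.divide n fℚ fℚ-Monic g in r , r< , (begin
      Evℚ.ev g α                            ≈⟨ Evℚ.ev-cong g (q ℚᵖ.⊛ fℚ ℚᵖ.⊕ r) α e ⟩
      Evℚ.ev (q ℚᵖ.⊛ fℚ ℚᵖ.⊕ r) α           ≈⟨ Evℚ.ev-⊕ (q ℚᵖ.⊛ fℚ) r α ⟩
      Evℚ.ev (q ℚᵖ.⊛ fℚ) α + Evℚ.ev r α     ≈⟨ +-congʳ (trans (Evℚ.ev-⊛ q fℚ α) (trans (*-congˡ fℚ≈0) (zeroʳ _))) ⟩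
      0# + Evℚ.ev r α                       ≈⟨ +-identityˡ _ ⟩
      Evℚ.ev r α                            ∎)

    -- Reduce `g` below degree n and subtract `a` times the result from `w`: the difference vanishes
    -- at α, hence is zero by independence.
    coefficients-divisible : ∀ a w g → ℤᵖ.DegreeBelow n w → Evℤ.ev w α ≈ φ a * Evℤ.ev g α →
                             ∀ i → a ∣ᶻ ℤᵖ.coeff w i
    coefficients-divisible a w g w< e i =
      let r , r< , g≈r = reduceℤ g
          s = w ℤᵖ.⊕ map ℤ.-_ (map (a ℤ.*_) r)
          s≈0 : Evℚ.ev (map fromℤ s) α ≈ 0#
          s≈0 = begin
            Evℚ.ev (map fromℤ s) α                                      ≈⟨ evℚ-map s α ⟩
            Evℤ.ev s α                                                  ≈⟨ Evℤ.ev-⊕ w _ α ⟩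
            Evℤ.ev w α + Evℤ.ev (map ℤ.-_ (map (a ℤ.*_) r)) α           ≈⟨ +-cong (trans e (*-congˡ g≈r)) (trans (Evℤ.ev-neg (map (a ℤ.*_) r) α) (-‿cong (Evℤ.ev-scale a r α))) ⟩
            φ a * Evℤ.ev r α - φ a * Evℤ.ev r α                         ≈⟨ -‿inverseʳ _ ⟩
            0#                                                          ∎
          s< = ℤᵖ.⊕-DegreeBelow w _ w< (ℤᵖ.neg-DegreeBelow (map (a ℤ.*_) r) (ℤᵖ.scale-DegreeBelow a r r<))
          s≡0 : ℤᵖ.coeff s i ≡ + 0
          s≡0 = fromℤ-injective (≡.trans (≡.sym (coeff-map s i))
                  (independent (map fromℤ s) (map-fromℤ-DegreeBelow s s<) s≈0 i))
      in ℤᵖ.coeff r i , ℤₚ.i-j≡0⇒i≡j (ℤᵖ.coeff w i) _ (≡.trans (≡.sym (≡.trans (ℤᵖ.coeff-⊕ w _ i)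
           (cong (λ z → ℤᵖ.coeff w i ℤ.+ z) (≡.trans (ℤᵖ.coeff-neg (map (a ℤ.*_) r) i) (cong ℤ.-_ (ℤᵖ.coeff-scale a r i)))))) s≡0)

    adjoin⇒polynomial : ∀ {x} → x ∈ ℚ⟮_⟯ L α → ∃[ g ] x ≈ Evℚ.ev g α
    adjoin⇒polynomial (rational q)  = ℚᵖ.constant q , sym (Evℚ.ev-constant q α)
    adjoin⇒polynomial generator     = ℚᵖ.X , sym (Evℚ.ev-X α)
    adjoin⇒polynomial (plus a b)    = let g , e = adjoin⇒polynomial a
                                          h , f = adjoin⇒polynomial b
                                      in g ℚᵖ.⊕ h , trans (+-cong e f) (sym (Evℚ.ev-⊕ g h α))
    adjoin⇒polynomial (negate a)    = let g , e = adjoin⇒polynomial a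
                                      in map ℚ.-_ g , trans (-‿cong e) (sym (Evℚ.ev-neg g α))
    adjoin⇒polynomial (times a b)   = let g , e = adjoin⇒polynomial a
                                          h , f = adjoin⇒polynomial b
                                      in g ℚᵖ.⊛ h , trans (*-cong e f) (sym (Evℚ.ev-⊛ g h α))
    adjoin⇒polynomial (respects x≈y a) = let g , e = adjoin⇒polynomial a in g , trans (sym x≈y) e
    -- Only inversion needs irreducibility: reduced below degree n, the polynomial for `x` is zero,
    -- impossible as `x * y ≈ 1#`, or invertible by a polynomial in α.
    adjoin⇒polynomial (inverse {x} {y} xy≈1 a) = solution (adjoin⇒polynomial a)
      where
      solution : ∃[ g ] x ≈ Evℚ.ev g α → ∃[ g ] y ≈ Evℚ.ev g α
      solution (g , x≈g) with reduceℚ g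
      ... | r , r< , g≈r with zero-or-invertible r r<
      ...   | inj₁ r≈0 = contradiction (trans (sym xy≈1) (trans (*-congʳ (trans x≈g (trans g≈r (Evℚ.ev-zero r α r≈0)))) (zeroˡ y))) 1≉0
      ...   | inj₂ (u , ur≈1) = u , (begin
          y                                     ≈⟨ *-identityˡ y ⟨
          1# * y                                ≈⟨ *-congʳ ur≈1 ⟨
          Evℚ.ev u α * Evℚ.ev r α * y           ≈⟨ *-assoc _ _ y ⟩
          Evℚ.ev u α * (Evℚ.ev r α * y)         ≈⟨ *-congˡ (trans (*-congʳ (sym (trans x≈g g≈r))) xy≈1) ⟩
          Evℚ.ev u α * 1#                       ≈⟨ *-identityʳ _ ⟩
          Evℚ.ev u α                            ∎)

-- Integral elements

module Integrality {c ℓ₁ ℓ₂} (L : FieldExtensionOfℚ c ℓ₁ ℓ₂) where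
  open Field L
  open Evℤ
  open IntegerSolver L-ring
  open import Relation.Binary.Reasoning.Setoid setoid
  open import Algebra.Properties.Ring ring using (+-inverseˡ-unique)
  open import Algebra.Properties.CommutativeSemiring.Exp commutativeSemiring
  open import Algebra.Properties.Semiring.Sum semiring using (sum; sum-cong-≋; sum-replicate-zero; *-distribˡ-sum; ∑-distrib-+)

  ev∈ℚ⟮⟯ : ∀ g x → ev g x ∈ ℚ⟮_⟯ L x
  ev∈ℚ⟮⟯ []      x = respects φ-0 (rational _)
  ev∈ℚ⟮⟯ (a ∷ g) x = plus (rational _) (times generator (ev∈ℚ⟮⟯ g x))

  module _ (x : Carrier) where

    -- Together with `MonicValue`, this lets the elimination compute with elements of L while
    -- remembering their degrees as integer polynomials in `x`.
    ValueBelow : ℕ → Carrier → Set ℓ₁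
    ValueBelow d y = ∃[ g ] ℤᵖ.DegreeBelow d g × y ≈ ev g x

    MonicValue : ℕ → Carrier → Set ℓ₁
    MonicValue d y = ∃[ g ] ℤᵖ.MonicOfDegree d g × y ≈ ev g x

    ValueBelow-+ : ∀ {d y z} → ValueBelow d y → ValueBelow d z → ValueBelow d (y + z)
    ValueBelow-+ (g , g< , y≈) (h , h< , z≈) = g ℤᵖ.⊕ h , ℤᵖ.⊕-DegreeBelow g h g< h< ,
      trans (+-cong y≈ z≈) (sym (ev-⊕ g h x))

    ValueBelow-* : ∀ {d e y z} → ValueBelow d y → ValueBelow e z → ValueBelow (d ℕ.+ e) (y * z)
    ValueBelow-* {d} {e} (g , g< , y≈) (h , h< , z≈) = g ℤᵖ.⊛ h ,
      ℤᵖ.⊛-DegreeBelow d e g h g< (ℤᵖ.DegreeBelow-mono h (ℕₚ.n≤1+n e) h<) ,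
      trans (*-cong y≈ z≈) (sym (ev-⊛ g h x))

    MonicValue-*-ValueBelow : ∀ {d e y z} → MonicValue d y → ValueBelow e z → ValueBelow (e ℕ.+ d) (y * z)
    MonicValue-*-ValueBelow {d} {e} (g , g-Monic , y≈) (h , h< , z≈) = h ℤᵖ.⊛ g ,
      ℤᵖ.⊛-DegreeBelow e d h g h< (proj₂ g-Monic) ,
      trans (*-comm _ _) (trans (*-cong z≈ y≈) (sym (ev-⊛ h g x)))

    MonicValue-* : ∀ {d e y z} → MonicValue d y → MonicValue e z → MonicValue (d ℕ.+ e) (y * z)
    MonicValue-* {d} {e} (g , g-Monic , y≈) (h , h-Monic , z≈) = g ℤᵖ.⊛ h ,
      ℤᵖ.⊛-Monic d e g h g-Monic h-Monic , trans (*-cong y≈ z≈) (sym (ev-⊛ g h x))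

    MonicValue-minus : ∀ {d y z} → MonicValue d y → ValueBelow d z → MonicValue d (y - z)
    MonicValue-minus (g , g-Monic , y≈) (h , h< , z≈) = g ℤᵖ.⊕ map ℤ.-_ h ,
      ℤᵖ.⊕-Monic g (map ℤ.-_ h) g-Monic (ℤᵖ.neg-DegreeBelow h h<) ,
      trans (+-cong y≈ (-‿cong z≈)) (sym (trans (ev-⊕ g (map ℤ.-_ h) x) (+-congˡ (ev-neg h x))))

    MonicValue-1 : MonicValue 0 1#
    MonicValue-1 = ℤᵖ.constant (+ 1) , ℤᵖ.1-Monic , sym (trans (ev-constant (+ 1) x) φ-1)

    MonicValue-x : MonicValue 1 x
    MonicValue-x = ℤᵖ.X , ℤᵖ.X-Monic , sym (ev-X x)

    MonicValue-0⇒Integral : ∀ {d y} → MonicValue d y → y ≈ 0# → Integral L x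
    MonicValue-0⇒Integral {d} (g , g-Monic , y≈) y≈0 = g , (d , g-Monic) , trans (sym y≈) y≈0

    power-ValueBelow⇒Integral : ∀ d → ValueBelow d (x ^ d) → Integral L x
    power-ValueBelow⇒Integral d v = MonicValue-0⇒Integral
      (MonicValue-minus (ℤᵖ.X ℤᵖ.^ᵖ d , ℤᵖ.X^-Monic d , sym (trans (ev-^ ℤᵖ.X d x) (^-congˡ d (ev-X x)))) v) (-‿inverseʳ _)

    -- Fraction-free elimination: multiplying the other equations by
    -- q = π - P₀₀ removes v₀ and keeps the leading coefficients equal to 1.
    eliminate : ∀ N d π → MonicValue d π → (P : Fin N → Fin N → Carrier) → (∀ i j → ValueBelow d (P i j)) →
                (v : Fin N → Carrier) → (∀ i → π * v i ≈ sum (λ j → P i j * v j)) →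
                ∃₂ λ d′ μ → MonicValue d′ μ × (∀ i → μ * v i ≈ 0#)
    eliminate zero    d π π-Monic P P< v eqs = 0 , 1# , MonicValue-1 , λ ()
    eliminate (suc N) d π π-Monic P P< v eqs =
      let e , μ , μ-Monic , zeros = eliminate N (d ℕ.+ d) (q * π) (MonicValue-* q-Monic π-Monic) P′
            (λ i j → ValueBelow-+ (MonicValue-*-ValueBelow q-Monic (P< (Fin.suc i) (Fin.suc j)))
                                  (ValueBelow-* (P< (Fin.suc i) Fin.zero) (P< Fin.zero (Fin.suc j))))
            (v ∘ Fin.suc) eqs′
      in e ℕ.+ d , μ * q , MonicValue-* μ-Monic q-Monic , λ
        { Fin.zero → begin
            μ * q * v₀                                ≈⟨ *-assoc μ q v₀ ⟩
            μ * (q * v₀)                              ≈⟨ *-congˡ qv₀ ⟩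
            μ * sum (row Fin.zero)                    ≈⟨ *-distribˡ-sum μ (row Fin.zero) ⟩
            sum (λ j → μ * row Fin.zero j)            ≈⟨ sum-cong-≋ {N} {λ j → μ * row Fin.zero j} {λ _ → 0#} (λ j →
                trans (solve 3 (λ m p v → m :* (p :* v) := p :* (m :* v)) refl μ (P Fin.zero (Fin.suc j)) (v (Fin.suc j)))
                      (trans (*-congˡ (zeros j)) (zeroʳ _))) ⟩
            sum {N} (λ _ → 0#)                        ≈⟨ sum-replicate-zero N ⟩
            0#                                        ∎
        ; (Fin.suc i) → begin
            μ * q * v (Fin.suc i)                     ≈⟨ solve 3 (λ m q v → m :* q :* v := q :* (m :* v)) refl μ q (v (Fin.suc i)) ⟩
            q * (μ * v (Fin.suc i))                   ≈⟨ *-congˡ (zeros i) ⟩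
            q * 0#                                    ≈⟨ zeroʳ q ⟩
            0#                                        ∎ }
      where
      v₀ = v Fin.zero
      q = π - P Fin.zero Fin.zero
      q-Monic : MonicValue d q
      q-Monic = MonicValue-minus π-Monic (P< Fin.zero Fin.zero)
      row : Fin (suc N) → Fin N → Carrier
      row i j = P i (Fin.suc j) * v (Fin.suc j)
      P′ : Fin N → Fin N → Carrier
      -- Multiply equation i + 1 by `q` and replace `q * v₀` by its row. The new entries stay below
      -- degree d + d, in which `q * π` is monic.
      P′ i j = q * P (Fin.suc i) (Fin.suc j) + P (Fin.suc i) Fin.zero * P Fin.zero (Fin.suc j)
      qv₀ : q * v₀ ≈ sum (row Fin.zero)
      qv₀ = begin
        q * v₀                                                          ≈⟨ solve 3 (λ π p v → (π :- p) :* v := π :* v :- p :* v) refl π p v₀ ⟩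
        π * v₀ - p * v₀                                                 ≈⟨ +-congʳ (eqs Fin.zero) ⟩
        (p * v₀ + sum (row Fin.zero)) - p * v₀                          ≈⟨ solve 2 (λ a b → (a :+ b) :- a := b) refl (p * v₀) (sum (row Fin.zero)) ⟩
        sum (row Fin.zero)                                              ∎
        where p = P Fin.zero Fin.zero
      eqs′ : ∀ i → q * π * v (Fin.suc i) ≈ sum (λ j → P′ i j * v (Fin.suc j))
      eqs′ i = begin
        q * π * v (Fin.suc i)                                 ≈⟨ *-assoc q π _ ⟩
        q * (π * v (Fin.suc i))                               ≈⟨ *-congˡ (eqs (Fin.suc i)) ⟩
        q * (p * v₀ + sum (row (Fin.suc i)))                  ≈⟨ solve 4 (λ q p v s → q :* (p :* v :+ s) := q :* s :+ p :* (q :* v)) refl q p v₀ (sum (row (Fin.suc i))) ⟩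
        q * sum (row (Fin.suc i)) + p * (q * v₀)              ≈⟨ +-congˡ (*-congˡ qv₀) ⟩
        q * sum (row (Fin.suc i)) + p * sum (row Fin.zero)    ≈⟨ +-cong (*-distribˡ-sum q (row (Fin.suc i))) (*-distribˡ-sum p (row Fin.zero)) ⟩
        sum (λ j → q * row (Fin.suc i) j) + sum (λ j → p * row Fin.zero j) ≈⟨ ∑-distrib-+ (λ j → q * row (Fin.suc i) j) (λ j → p * row Fin.zero j) ⟨
        sum (λ j → q * row (Fin.suc i) j + p * row Fin.zero j) ≈⟨ sum-cong-≋ {N} {λ j → q * row (Fin.suc i) j + p * row Fin.zero j} {λ j → P′ i j * v (Fin.suc j)} (λ j →
            solve 5 (λ q a p b v → q :* (a :* v) :+ p :* (b :* v) := (q :* a :+ p :* b) :* v) refl q (P (Fin.suc i) (Fin.suc j)) p (P Fin.zero (Fin.suc j)) (v (Fin.suc j))) ⟩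
        sum (λ j → P′ i j * v (Fin.suc j))                    ∎
        where p = P (Fin.suc i) Fin.zero

  ev-sum : ∀ n g x → ℤᵖ.DegreeBelow n g → ev g x ≈ sum {n} (λ j → φ (ℤᵖ.coeff g (toℕ j)) * x ^ toℕ j)
  ev-sum zero    g       x g< = ev-zero g x (λ i → g< i z≤n)
  ev-sum (suc n) []      x g< = sym (trans (sum-cong-≋ {suc n} {λ j → φ (+ 0) * x ^ toℕ j} {λ _ → 0#} (λ j → trans (*-congʳ φ-0) (zeroˡ _)))
                                  (sum-replicate-zero (suc n)))
  ev-sum (suc n) (a ∷ g) x g< = begin
    φ a + x * ev g x                           ≈⟨ +-cong (sym (*-identityʳ _)) (*-congˡ (ev-sum n g x (λ i n≤i → g< (suc i) (s≤s n≤i)))) ⟩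
    φ a * 1# + x * sum (λ j → t j)             ≈⟨ +-congˡ (*-distribˡ-sum x t) ⟩
    φ a * 1# + sum (λ j → x * t j)             ≈⟨ +-congˡ (sum-cong-≋ {n} {λ j → x * t j} {λ j → φ (ℤᵖ.coeff g (toℕ j)) * x ^ suc (toℕ j)} (λ j →
        solve 3 (λ x a y → x :* (a :* y) := a :* (x :* y)) refl x _ _)) ⟩
    φ a * 1# + sum {n} (λ j → φ (ℤᵖ.coeff g (toℕ j)) * x ^ suc (toℕ j)) ∎
    where
    t : Fin n → Carrier
    t j = φ (ℤᵖ.coeff g (toℕ j)) * x ^ toℕ j

  module _ (α : Carrier) where

    module _ (n : ℕ) (0<n : 0 < n)
             (reduceℤ : ∀ g → ∃[ r ] ℤᵖ.DegreeBelow n r × ev g α ≈ ev r α) where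

      ℤ[]⇒Integral : ∀ g → Integral L (ev g α)
      ℤ[]⇒Integral g = finish (eliminate y n 1 y (MonicValue-x y) (λ i j → φ (entry i j))
          (λ i j → ℤᵖ.constant (entry i j) , ℤᵖ.constant-DegreeBelow (entry i j) , sym (ev-constant (entry i j) y))
          (λ i → α ^ toℕ i) eqs)
        where
        y = ev g α
        shifted : ℕ → ℤᵖ.Poly
        shifted i = g ℤᵖ.⊛ (ℤᵖ.X ℤᵖ.^ᵖ i)
        entry : Fin n → Fin n → ℤ
        entry i j = ℤᵖ.coeff (proj₁ (reduceℤ (shifted (toℕ i)))) (toℕ j)
        eqs : ∀ i → y * α ^ toℕ i ≈ sum (λ j → φ (entry i j) * α ^ toℕ j)
        eqs i = let r , r< , e = reduceℤ (shifted (toℕ i)) in begin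
          y * α ^ toℕ i                            ≈⟨ *-congˡ (trans (ev-^ ℤᵖ.X (toℕ i) α) (^-congˡ (toℕ i) (ev-X α))) ⟨
          y * ev (ℤᵖ.X ℤᵖ.^ᵖ toℕ i) α              ≈⟨ ev-⊛ g (ℤᵖ.X ℤᵖ.^ᵖ toℕ i) α ⟨
          ev (shifted (toℕ i)) α                   ≈⟨ e ⟩
          ev r α                                   ≈⟨ ev-sum n r α r< ⟩
          sum (λ j → φ (entry i j) * α ^ toℕ j)    ∎
        first : Fin n
        first = Fin.fromℕ< 0<n
        finish : (∃₂ λ d′ μ → MonicValue y d′ μ × (∀ i → μ * α ^ toℕ i ≈ 0#)) → Integral L y
        -- The vector contains α ^ 0 = 1, so an element that annihilates it is itself zero.
        finish (d , μ , μ-Monic , zeros) = MonicValue-0⇒Integral y μ-Monic (begin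
          μ                     ≈⟨ *-identityʳ μ ⟨
          μ * 1#                ≡⟨ cong (λ i → μ * α ^ i) (Finₚ.toℕ-fromℕ< 0<n) ⟨
          μ * α ^ toℕ first     ≈⟨ zeros first ⟩
          0#                    ∎)
          where import Data.Fin.Properties as Finₚ

    -- `N ^ d` clears the powers of `x` up to exponent d factor by factor; the monic equation of
    -- degree d carries this denominator on to all higher powers.
    module CommonDenominator (N : ℕ) (z : ℤᵖ.Poly) (x : Carrier) (Nx≈z : φ (+ N) * x ≈ ev z α)
             (d : ℕ) (g : ℤᵖ.Poly) (g-Monic : ℤᵖ.MonicOfDegree d g) (gx≈0 : ev g x ≈ 0#) where

      D : ℕ
      D = N ℕ.^ d

      Cleared : Carrier → Set ℓ₁
      Cleared y = ∃[ w ] φ (+ D) * y ≈ ev w α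

      Cleared-resp : ∀ {y y′} → y ≈ y′ → Cleared y → Cleared y′
      Cleared-resp y≈ (w , e) = w , trans (*-congˡ (sym y≈)) e

      Cleared-+ : ∀ {y y′} → Cleared y → Cleared y′ → Cleared (y + y′)
      Cleared-+ (w , e) (w′ , e′) = w ℤᵖ.⊕ w′ , trans (distribˡ _ _ _) (trans (+-cong e e′) (sym (ev-⊕ w w′ α)))

      Cleared-scale : ∀ a {y} → Cleared y → Cleared (φ a * y)
      Cleared-scale a (w , e) = map (a ℤ.*_) w ,
        trans (solve 3 (λ D a y → D :* (a :* y) := a :* (D :* y)) refl _ _ _) (trans (*-congˡ e) (sym (ev-scale a w α)))

      Cleared-neg : ∀ {y} → Cleared y → Cleared (- y)
      Cleared-neg (w , e) = map ℤ.-_ w ,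
        trans (solve 2 (λ D y → D :* (:- y) := :- (D :* y)) refl _ _) (trans (-‿cong e) (sym (ev-neg w α)))

      initial : ∀ d k → k ≤ d → ∃[ w ] φ (+ (N ℕ.^ d)) * x ^ k ≈ ev w α
      initial zero    zero    z≤n = ℤᵖ.constant (+ 1) , trans (*-identityʳ _) (sym (ev-constant (+ 1) α))
      initial (suc d) zero    z≤n = ℤᵖ.constant (+ (N ℕ.^ suc d)) , trans (*-identityʳ _) (sym (ev-constant (+ (N ℕ.^ suc d)) α))
      initial (suc d) (suc k) (s≤s k≤d) = let w , e = initial d k k≤d in z ℤᵖ.⊛ w , (begin
        φ (+ (N ℕ.* N ℕ.^ d)) * (x * x ^ k)        ≈⟨ *-congʳ (trans (φ-cong (ℤₚ.pos-* N (N ℕ.^ d))) (φ-* (+ N) (+ (N ℕ.^ d)))) ⟩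
        φ (+ N) * φ (+ (N ℕ.^ d)) * (x * x ^ k)    ≈⟨ solve 4 (λ N D x y → N :* D :* (x :* y) := N :* x :* (D :* y)) refl _ _ _ _ ⟩
        φ (+ N) * x * (φ (+ (N ℕ.^ d)) * x ^ k)    ≈⟨ *-cong Nx≈z e ⟩
        ev z α * ev w α                            ≈⟨ ev-⊛ z w α ⟨
        ev (z ℤᵖ.⊛ w) α                            ∎)

      -- The multiplier `y` collects a factor `x` whenever a constant term is stripped from `g`, so
      -- each lower term appears as an integer times a cleared element.
      split-leading : ∀ d g y → ℤᵖ.MonicOfDegree d g → (∀ j → j < d → Cleared (y * x ^ j)) →
                      ∃[ b ] Cleared b × y * ev g x ≈ y * x ^ d + b
      split-leading d       []      y (() , _) _
      split-leading zero    (a ∷ g) y (p₁ , p₂) _ = 0# , (ℤᵖ.constant (+ 0) , trans (zeroʳ _) (sym (trans (ev-constant (+ 0) α) φ-0))) , (begin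
        y * (φ a + x * ev g x)  ≈⟨ *-congˡ (+-cong (trans (φ-cong p₁) φ-1) (*-congˡ (ev-zero g x (λ i → p₂ (suc i) (s≤s z≤n))))) ⟩
        y * (1# + x * 0#)       ≈⟨ solve 2 (λ y x → y :* (con (+ 1) :+ x :* con (+ 0)) := y :* con (+ 1) :+ con (+ 0)) refl y x ⟩
        y * 1# + 0#             ∎)
      split-leading (suc d) (a ∷ g) y (p₁ , p₂) y< =
        let b , Cb , e = split-leading d g (y * x) (p₁ , λ i d<i → p₂ (suc i) (s≤s d<i))
              (λ j j<d → Cleared-resp (sym (*-assoc y x (x ^ j))) (y< (suc j) (s≤s j<d)))
        in φ a * y + b , Cleared-+ (Cleared-scale a (Cleared-resp (*-identityʳ y) (y< 0 (s≤s z≤n)))) Cb , (begin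
        y * (φ a + x * ev g x)              ≈⟨ solve 4 (λ y a x g → y :* (a :+ x :* g) := a :* y :+ y :* x :* g) refl y _ x _ ⟩
        φ a * y + y * x * ev g x            ≈⟨ +-congˡ e ⟩
        φ a * y + (y * x * x ^ d + b)       ≈⟨ solve 5 (λ a y x w b → a :* y :+ (y :* x :* w :+ b) := y :* (x :* w) :+ (a :* y :+ b)) refl _ y x _ b ⟩
        y * (x * x ^ d) + (φ a * y + b)     ∎)

      top-cleared : ∀ k → (∀ j → j < d → Cleared (x ^ k * x ^ j)) → Cleared (x ^ k * x ^ d)
      top-cleared k below =
        let b , Cb , e = split-leading d g (x ^ k) g-Monic below
        in Cleared-resp (sym (+-inverseˡ-unique _ b (trans (sym e) (trans (*-congˡ gx≈0) (zeroʳ _))))) (Cleared-neg Cb)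

      -- A window of d consecutive powers moves up by one: all but its last entry lie in the
      -- previous window, and the last comes from the monic equation.
      below-cleared : ∀ k j → j < d → Cleared (x ^ k * x ^ j)
      below-cleared zero    j j<d = Cleared-resp (sym (*-identityˡ _)) (initial d j (ℕₚ.<⇒≤ j<d))
      below-cleared (suc k) j j<d = Cleared-resp (solve 3 (λ x a b → a :* (x :* b) := x :* a :* b) refl x (x ^ k) (x ^ j)) (next (ℕₚ.m≤n⇒m<n∨m≡n j<d))
        where
        next : suc j < d ⊎ suc j ≡ d → Cleared (x ^ k * x ^ suc j)
        next (inj₁ 1+j<d) = below-cleared k (suc j) 1+j<d
        next (inj₂ 1+j≡d) = ≡.subst (λ i → Cleared (x ^ k * x ^ i)) (≡.sym 1+j≡d) (top-cleared k (below-cleared k))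

      powers-cleared : ∀ k → Cleared (x ^ k)
      powers-cleared k = Cleared-resp (*-identityʳ _) (first (ℕₚ.m≤n⇒m<n∨m≡n {0} {d} z≤n))
        where
        first : 0 < d ⊎ 0 ≡ d → Cleared (x ^ k * x ^ 0)
        first (inj₁ 0<d) = below-cleared k 0 0<d
        -- For d = 0 the window is empty and the equation is applied directly.
        first (inj₂ 0≡d) = ≡.subst (λ i → Cleared (x ^ k * x ^ i)) (≡.sym 0≡d) (top-cleared k (below-cleared k))

-- The order ℤ[x] with x ^ n = m

divisible-coefficients : ∀ a g → (∀ i → a ∣ᶻ ℤᵖ.coeff g i) → ∃[ h ] ∀ i → ℤᵖ.coeff g i ≡ ℤᵖ.coeff (map (a ℤ.*_) h) i
divisible-coefficients a []      _ = [] , λ _ → ≡.refl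
divisible-coefficients a (b ∷ g) p =
  let t , e = p 0
      h , f = divisible-coefficients a g (λ i → p (suc i))
  in t ∷ h , λ { zero → e ; (suc i) → f i }

-- The substitution of μ X for X.
dilate : ℤ → ℤᵖ.Poly → ℤᵖ.Poly
dilate μ []      = []
dilate μ (a ∷ g) = a ∷ map (μ ℤ.*_) (dilate μ g)

coeff-dilate : ∀ μ g i → ℤᵖ.coeff (dilate μ g) i ≡ μ ^ᶻ i ℤ.* ℤᵖ.coeff g i
coeff-dilate μ []      i       = ≡.sym (ℤₚ.*-zeroʳ (μ ^ᶻ i))
coeff-dilate μ (a ∷ g) zero    = ≡.sym (ℤₚ.*-identityˡ a)
coeff-dilate μ (a ∷ g) (suc i) = ≡.trans (ℤᵖ.coeff-scale μ (dilate μ g) i)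
  (≡.trans (cong (μ ℤ.*_) (coeff-dilate μ g i)) (≡.sym (ℤₚ.*-assoc μ (μ ^ᶻ i) (ℤᵖ.coeff g i))))

module MonogenicOrder {ℓ₁ ℓ₂} (A : CommutativeRing ℓ₁ ℓ₂) (κ : ℤ → CommutativeRing.Carrier A)
  (κ-hom : IsRingHomomorphism ℤ.+-*-rawRing (CommutativeRing.rawRing A) κ) where
  open CommutativeRing A
  open CommutativeExp commutativeSemiring
  open Evaluation ℤ-ring A κ κ-hom
  open IntegerImage A κ κ-hom using (·≈*)
  open IntegerSolver A
  open import Algebra.Properties.Semiring.Mult semiring using () renaming (_×_ to _·_)
  open import Relation.Binary.Reasoning.Setoid setoid

  -- A = ℤ[x] with integral basis 1 , x , … , x ^ (n - 1), where x ^ n = m.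
  module Generated (κ-cancel : ∀ a → a ≢ + 0 → ∀ {y z} → κ a * y ≈ κ a * z → y ≈ z)
    (x : Carrier) (generates : ∀ z → ∃[ g ] z ≈ ev g x)
    (n : ℕ) (coefficients-divisible : ∀ a w y → ℤᵖ.DegreeBelow n w → ev w x ≈ κ a * y → ∀ i → a ∣ᶻ ℤᵖ.coeff w i)
    (m : ℤ) (x^n≈m : x ^ n ≈ κ m) where

    module _ {p} (pp : Prime p) where
      private
        instance
          p-nonZero : ℕ.NonZero p
          p-nonZero = prime⇒nonZero pp

      p̂ : Carrier
      p̂ = κ (+ p)

      p̂-cancel : ∀ {y z} → p̂ * y ≈ p̂ * z → y ≈ z
      p̂-cancel = κ-cancel (+ p) (λ e → ℕ.≢-nonZero⁻¹ p (ℤₚ.+-injective e))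

      Congruent : Carrier → Carrier → Carrier → Set _
      Congruent h = Quotient._≈ᴵ_ A h p̂

      κ-unit : ∀ h a b t → a ℤ.* b ≡ + 1 ℤ.+ + p ℤ.* t → Congruent h (κ a * κ b) 1#
      κ-unit h a b t eq = Quotient.combination 0# (κ t) (begin
        κ a * κ b                  ≈⟨ φ-* a b ⟨
        κ (a ℤ.* b)                ≈⟨ φ-cong eq ⟩
        κ (+ 1 ℤ.+ + p ℤ.* t)      ≈⟨ trans (φ-+ (+ 1) (+ p ℤ.* t)) (+-cong φ-1 (φ-* (+ p) t)) ⟩
        1# + p̂ * κ t               ≈⟨ solve 3 (λ h p t → con (+ 1) :+ p :* t := con (+ 1) :+ (h :* con (+ 0) :+ p :* t)) refl h p̂ (κ t) ⟩
        1# + (h * 0# + p̂ * κ t)    ∎)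

      -- Up to a unit, p is a power of h = H(x), and A / (h , p) is reduced
      -- because some power of the Frobenius map sends x to a unit multiple of x.
      module Maximal (H : ℤᵖ.Poly) (k P : ℕ) (n≡ : suc P ℕ.* k ≡ n) (H-Monic : ℤᵖ.MonicOfDegree k H)
                     (u v : Carrier) (h^P≈pu : ev H x ^ suc P ≈ p̂ * u)
                     (uv≈1 : Congruent (ev H x) (u * v) 1#)
                     (frobenius-power : ∀ j → ∃₂ λ s μ → j ≤ p ℕ.^ s × ¬ p ℕᵈ.∣ ∣ μ ∣ × Congruent (ev H x) (x ^ (p ℕ.^ s)) (κ μ * x)) where
        open Quotient A (ev H x) p̂
        private
          module B = CommutativeRing quotient
          h = ev H x

        -- Thus 1 , x , ... , x ^ (k - 1) are independent modulo (h , p) over the field with p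
        -- elements. Multiplying by `h ^ P` moves the ideal into p A, while `w H ^ P` still has
        -- degree below n, so p divides its coefficients; the monic factor `H ^ P` then cancels.
        ≈ᴵ0⇒coefficients : ∀ w → ℤᵖ.DegreeBelow k w → ev w x ≈ᴵ 0# → ∀ i → + p ∣ᶻ ℤᵖ.coeff w i
        ≈ᴵ0⇒coefficients w w< (combination s t w≈) = ℤᵖ.monic-cancel (P ℕ.* k) (+ p) w (H ℤᵖ.^ᵖ P) H^P-Monic
          (λ i _ → coefficients-divisible (+ p) (w ℤᵖ.⊛ (H ℤᵖ.^ᵖ P)) (u * s + t * h ^ P) W< W≈ i)
          where
          H^P-Monic : ℤᵖ.MonicOfDegree (P ℕ.* k) (H ℤᵖ.^ᵖ P)
          H^P-Monic = ℤᵖ.^-Monic k H P H-Monic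
          W< : ℤᵖ.DegreeBelow n (w ℤᵖ.⊛ (H ℤᵖ.^ᵖ P))
          W< = ≡.subst (λ d → ℤᵖ.DegreeBelow d (w ℤᵖ.⊛ (H ℤᵖ.^ᵖ P))) n≡ (ℤᵖ.⊛-DegreeBelow k (P ℕ.* k) w (H ℤᵖ.^ᵖ P) w< (proj₂ H^P-Monic))
          W≈ : ev (w ℤᵖ.⊛ (H ℤᵖ.^ᵖ P)) x ≈ p̂ * (u * s + t * h ^ P)
          W≈ = begin
            ev (w ℤᵖ.⊛ (H ℤᵖ.^ᵖ P)) x                ≈⟨ trans (ev-⊛ w (H ℤᵖ.^ᵖ P) x) (*-congˡ (ev-^ H P x)) ⟩
            ev w x * h ^ P                           ≈⟨ *-congʳ w≈ ⟩
            (0# + (h * s + p̂ * t)) * h ^ P           ≈⟨ solve 5 (λ h s p t q → (con (+ 0) :+ (h :* s :+ p :* t)) :* q := h :* q :* s :+ p :* (t :* q)) refl h s p̂ t (h ^ P) ⟩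
            h * h ^ P * s + p̂ * (t * h ^ P)          ≈⟨ +-congʳ (*-congʳ h^P≈pu) ⟩
            p̂ * u * s + p̂ * (t * h ^ P)              ≈⟨ solve 4 (λ p u s t → p :* u :* s :+ p :* t := p :* (u :* s :+ t)) refl p̂ u s (t * h ^ P) ⟩
            p̂ * (u * s + t * h ^ P)                  ∎

        κ-fermat : ∀ a s → κ a ^ (p ℕ.^ s) ≈ᴵ κ a
        κ-fermat a s = let t , e = fermat-iterate pp a a (+ 0 , ≡.sym (≡.trans (cong (λ z → a ℤ.+ z) (ℤₚ.*-zeroʳ (+ p))) (ℤₚ.+-identityʳ a))) s
          in combination 0# (κ t) (begin
            κ a ^ (p ℕ.^ s)              ≈⟨ φ-^ a (p ℕ.^ s) ⟨
            κ (a ^ᶻ (p ℕ.^ s))           ≈⟨ φ-cong e ⟩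
            κ (a ℤ.+ + p ℤ.* t)          ≈⟨ trans (φ-+ a (+ p ℤ.* t)) (+-congˡ (φ-* (+ p) t)) ⟩
            κ a + p̂ * κ t                ≈⟨ solve 4 (λ a h p t → a :+ p :* t := a :+ (h :* con (+ 0) :+ p :* t)) refl (κ a) h p̂ (κ t) ⟩
            κ a + (h * 0# + p̂ * κ t)     ∎)

        0^≈ᴵ0 : ∀ q → 0 < q → 0# ^ q ≈ᴵ 0#
        0^≈ᴵ0 (suc q) _ = ≈⇒≈ᴵ (zeroˡ (0# ^ q))

        -- Iterated Frobenius is additive and multiplicative, fixes integers by Fermat and scales
        -- `x` by μ, so on polynomials in `x` it is a dilation.
        power-dilate : ∀ s μ → x ^ (p ℕ.^ s) ≈ᴵ κ μ * x → ∀ g → ev g x ^ (p ℕ.^ s) ≈ᴵ ev (dilate μ g) x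
        power-dilate s μ e []      = 0^≈ᴵ0 (p ℕ.^ s) (ℕₚ.m^n>0 p s)
        power-dilate s μ e (a ∷ g) =
          B.trans (frobenius-iterateᴵ pp (κ a) (x * ev g x) (B.trans (≈⇒≈ᴵ (·≈* p (κ a))) (b*≈ᴵ0 (κ a))) s)
          (B.trans (B.+-cong (κ-fermat a s) (B.trans (≈⇒≈ᴵ (^-distrib-* x (ev g x) q)) (B.*-cong e (power-dilate s μ e g))))
          (≈⇒≈ᴵ (+-congˡ (begin
            κ μ * x * ev (dilate μ g) x           ≈⟨ solve 3 (λ m x g → m :* x :* g := x :* (m :* g)) refl (κ μ) x (ev (dilate μ g) x) ⟩
            x * (κ μ * ev (dilate μ g) x)         ≈⟨ *-congˡ (ev-scale μ (dilate μ g) x) ⟨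
            x * ev (map (μ ℤ.*_) (dilate μ g)) x  ∎))))
          where q = p ℕ.^ s

        reduced : ∀ z j → z ^ j ≈ᴵ 0# → z ≈ᴵ 0#
        reduced z j z^j≈0 =
          let g , z≈g = generates z
              q , r , r< , g≋ = ℤᵖ.divide k H H-Monic g
              s , μ , j≤ , p∤μ , xμ = frobenius-power j
              z≈r : z ≈ᴵ ev r x
              z≈r = B.trans (≈⇒≈ᴵ (begin
                      z                                     ≈⟨ trans z≈g (ev-cong g (q ℤᵖ.⊛ H ℤᵖ.⊕ r) x g≋) ⟩
                      ev (q ℤᵖ.⊛ H ℤᵖ.⊕ r) x                ≈⟨ ev-⊕ (q ℤᵖ.⊛ H) r x ⟩
                      ev (q ℤᵖ.⊛ H) x + ev r x              ≈⟨ +-congʳ (trans (ev-⊛ q H x) (*-comm _ h)) ⟩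
                      h * ev q x + ev r x                   ∎))
                      (B.trans (B.+-congʳ (a*≈ᴵ0 (ev q x))) (B.+-identityˡ _))
              z^q≈0 : z ^ (p ℕ.^ s) ≈ᴵ 0#
              z^q≈0 = B.trans (≈⇒≈ᴵ (trans (^-congʳ z (≡.sym (ℕₚ.m+[n∸m]≡n j≤))) (^-homo-* z j (p ℕ.^ s ∸ j))))
                        (B.trans (B.*-congʳ z^j≈0) (B.zeroˡ _))
              d≈0 : ev (dilate μ r) x ≈ᴵ 0#
              d≈0 = B.trans (B.sym (power-dilate s μ xμ r)) (B.trans (^-congᴵ (p ℕ.^ s) (B.sym z≈r)) z^q≈0)
              d< : ℤᵖ.DegreeBelow k (dilate μ r)
              d< i k≤i = ≡.trans (coeff-dilate μ r i) (≡.trans (cong (μ ^ᶻ i ℤ.*_) (r< i k≤i)) (ℤₚ.*-zeroʳ (μ ^ᶻ i)))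
              -- The coefficients of the dilated remainder are `μ ^ i` times those of `r`, and p
              -- does not divide μ.
              p∣r : ∀ i → + p ∣ᶻ ℤᵖ.coeff r i
              p∣r i = ∣⇒∣ᶻ {+ p} ([ (λ d → contradiction (prime∣^ᶻ pp μ i d) p∤μ) , (λ d → d) ]′
                        (prime∣*ᶻ pp (μ ^ᶻ i) (ℤᵖ.coeff r i)
                          (≡.subst (λ c → p ℕᵈ.∣ ∣ c ∣) (coeff-dilate μ r i) (∣ᶻ⇒∣ {+ p} (≈ᴵ0⇒coefficients (dilate μ r) d< d≈0 i)))))
              t , r≋pt = divisible-coefficients (+ p) r p∣r
          in B.trans z≈r (B.trans (≈⇒≈ᴵ (trans (ev-cong r (map (+ p ℤ.*_) t) x r≋pt) (ev-scale (+ p) t x))) (b*≈ᴵ0 (ev t x)))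

        maximal : ∀ D z → D ≢ 0 → (∀ k → ∃[ w ] κ (+ D) * z ^ k ≈ p̂ ^ k * w) → ∃[ a ] z ≈ p̂ * a
        maximal D z D≢0 divided = D.divided⇒divisible z divided
          where
          D-power = extract-power pp D D≢0
          e = proj₁ D-power
          D′ = proj₁ (proj₂ D-power)
          D′-inverse = inverse-mod pp (+ D′) (proj₂ (proj₂ (proj₂ D-power)))
          d = proj₁ D′-inverse
          D≈ : κ (+ D) ≈ p̂ ^ e * κ (+ D′)
          D≈ = trans (φ-cong (≡.trans (cong +_ (proj₁ (proj₂ (proj₂ D-power)))) (≡.trans (ℤₚ.pos-* (p ℕ.^ e) D′) (cong (ℤ._* + D′) (pos-^ p e)))))
                 (trans (φ-* ((+ p) ^ᶻ e) (+ D′)) (*-congʳ (φ-^ (+ p) e)))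
          D′d≈1 : κ (+ D′) * κ d ≈ᴵ 1#
          D′d≈1 = let t , eq = proj₂ D′-inverse in κ-unit h (+ D′) d t eq
          module D = Dedekind.AtPrime A p̂ p̂-cancel (κ (+ D)) (κ (+ D′)) e D≈ h u v (κ d) P h^P≈pu uv≈1 D′d≈1 reduced

      MaximalAtPrime : Set _
      MaximalAtPrime = ∀ D z → D ≢ 0 → (∀ k → ∃[ w ] κ (+ D) * z ^ k ≈ p̂ ^ k * w) → ∃[ a ] z ≈ p̂ * a

      -- The Eisenstein case: h = x and P = n.
      exactly-divides⇒maximal : 0 < n → ∀ m′ → m ≡ + p ℤ.* m′ → ¬ p ℕᵈ.∣ ∣ m′ ∣ → MaximalAtPrime
      exactly-divides⇒maximal 0<n m′ m≡ p∤m′ =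
        let v , t , eq = inverse-mod pp m′ p∤m′
        in Maximal.maximal ℤᵖ.X 1 (ℕ.pred n) (≡.trans (ℕₚ.*-identityʳ _) n≡) ℤᵖ.X-Monic (κ m′) (κ v) h^n≈
             (κ-unit h m′ v t eq)
             -- Modulo h = x both sides vanish, so μ = 1 will do, and j < p ^ j bounds the exponent.
             (λ j → j , + 1 , ℕₚ.<⇒≤ (n<p^n pp j) , p∤1 , B.trans (x^≈ᴵ0 (p ℕ.^ j) (ℕₚ.m^n>0 p j)) (B.sym (B.trans (B.*-congˡ x≈ᴵ0) (B.zeroʳ (κ (+ 1))))))
        where
        instance _ = ℕ.>-nonZero 0<n
        h = ev ℤᵖ.X x
        open Quotient A h p̂
        module B = CommutativeRing quotient
        n≡ : suc (ℕ.pred n) ≡ n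
        n≡ = ℕₚ.suc-pred n
        h^n≈ : h ^ suc (ℕ.pred n) ≈ p̂ * κ m′
        h^n≈ = begin
          h ^ suc (ℕ.pred n)   ≈⟨ ^-cong (ev-X x) n≡ ⟩
          x ^ n                ≈⟨ x^n≈m ⟩
          κ m                  ≈⟨ trans (φ-cong m≡) (φ-* (+ p) m′) ⟩
          p̂ * κ m′             ∎
        p∤1 : ¬ p ℕᵈ.∣ 1
        p∤1 d = ℕₚ.<⇒≱ (prime>1 pp) (ℕᵈ.∣⇒≤ d)
        x≈ᴵ0 : x ≈ᴵ 0#
        x≈ᴵ0 = B.trans (≈⇒≈ᴵ (trans (sym (ev-X x)) (sym (*-identityʳ h)))) (a*≈ᴵ0 1#)
        x^≈ᴵ0 : ∀ q → 0 < q → x ^ q ≈ᴵ 0#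
        x^≈ᴵ0 (suc q) _ = B.trans (B.*-congʳ x≈ᴵ0) (B.zeroˡ (x ^ q))

      -- Writing n = p ^ s * k with p ∤ k, take h = x ^ k - m + p and P = p ^ s;
      -- the summand p makes the case s = 0, where h = p, uniform with the others.
      coprime⇒maximal : ∀ s k → n ≡ p ℕ.^ s ℕ.* k → ¬ p ℕᵈ.∣ k → 0 < k → ¬ p ℕᵈ.∣ ∣ m ∣ →
                        (s ≢ 0 → ¬ p ℕ.* p ℕᵈ.∣ ∣ m ^ᶻ p ℤ.- m ∣) → MaximalAtPrime
      coprime⇒maximal s k n≡ p∤k 0<k p∤m p²∤ = Maximal.maximal H k (ℕ.pred q) q*k≡n H-Monic u (κ v)
          (trans (^-congʳ h q≡) h^q≈) uv≈1 frobenius-power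
        where
        instance
          _ = ℕ.>-nonZero 0<k
          q-nonZero : ℕ.NonZero (p ℕ.^ s)
          q-nonZero = ℕₚ.m^n≢0 p s
        q = p ℕ.^ s
        b = m ℤ.- + p
        H = (ℤᵖ.X ℤᵖ.^ᵖ k) ℤᵖ.⊕ ℤᵖ.constant (ℤ.- b)
        h = ev H x
        open Quotient A h p̂
        module B = CommutativeRing quotient
        q≡ : suc (ℕ.pred q) ≡ q
        q≡ = ℕₚ.suc-pred q
        q*k≡n : suc (ℕ.pred q) ℕ.* k ≡ n
        q*k≡n = ≡.trans (cong (ℕ._* k) q≡) (≡.sym n≡)
        H-Monic : ℤᵖ.MonicOfDegree k H
        H-Monic = ℤᵖ.⊕-Monic (ℤᵖ.X ℤᵖ.^ᵖ k) (ℤᵖ.constant (ℤ.- b)) (ℤᵖ.X^-Monic k)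
          (ℤᵖ.DegreeBelow-mono (ℤᵖ.constant (ℤ.- b)) 0<k (ℤᵖ.constant-DegreeBelow (ℤ.- b)))
        x^k≈ : x ^ k ≈ h + κ b
        x^k≈ = begin
          x ^ k                                                        ≈⟨ solve 2 (λ y b → y := (y :+ (:- b)) :+ b) refl (x ^ k) (κ b) ⟩
          (x ^ k + - κ b) + κ b                                        ≈⟨ +-congʳ (+-cong (trans (ev-^ ℤᵖ.X k x) (^-congˡ k (ev-X x))) (trans (ev-constant (ℤ.- b) x) (φ-neg b))) ⟨
          (ev (ℤᵖ.X ℤᵖ.^ᵖ k) x + ev (ℤᵖ.constant (ℤ.- b)) x) + κ b     ≈⟨ +-congʳ (ev-⊕ (ℤᵖ.X ℤᵖ.^ᵖ k) (ℤᵖ.constant (ℤ.- b)) x) ⟨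
          h + κ b                                                      ∎
        c = proj₁ (unit-quotient pp m s p²∤)
        c≡ = proj₁ (proj₂ (unit-quotient pp m s p²∤))
        c-inverse = inverse-mod pp c (proj₂ (proj₂ (unit-quotient pp m s p²∤)))
        v = proj₁ c-inverse
        -- Expanding modulo p h instead of p keeps the factor h in the error: `h ^ q` equals m - b ^
        -- q up to `p h w`.
        module Q = Quotient A (p̂ * h) 0#
        module Q-ring = CommutativeRing Q.quotient
        ph≈0 : (p · h) Q.≈ᴵ 0#
        ph≈0 = Q.combination 1# 0# (trans (·≈* p h) (solve 1 (λ y → y := con (+ 0) :+ (y :* con (+ 1) :+ con (+ 0) :* con (+ 0))) refl (p̂ * h)))
        expansion : (h + κ b) ^ q Q.≈ᴵ h ^ q + κ b ^ q
        expansion = Q.frobenius-iterateᴵ pp h (κ b) ph≈0 s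
        w = Q._≈ᴵ_.s expansion
        -- Modulo h this is `c`, which is prime to p by `unit-quotient`.
        u = κ c + - (h * w)
        h^q≈ : h ^ q ≈ p̂ * u
        h^q≈ = begin
          h ^ q                                                     ≈⟨ solve 5 (λ g b p h w → g := (g :+ b :+ (p :* h :* w :+ con (+ 0) :* con (+ 0))) :- b :- p :* h :* w) refl (h ^ q) (κ b ^ q) p̂ h w ⟩
          (h ^ q + κ b ^ q + (p̂ * h * w + 0# * 0#)) - κ b ^ q - p̂ * h * w ≈⟨ +-congʳ (+-congʳ (trans (+-congˡ (+-congˡ (trans (zeroˡ 0#) (sym (zeroˡ _))))) (sym (Q._≈ᴵ_.equality expansion)))) ⟩
          (h + κ b) ^ q - κ b ^ q - p̂ * h * w                       ≈⟨ +-congʳ (+-cong x^n (-‿cong (sym (φ-^ b q)))) ⟩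
          κ m - κ (b ^ᶻ q) - p̂ * h * w                              ≈⟨ +-congʳ (trans (+-congˡ (sym (φ-neg (b ^ᶻ q)))) (sym (φ-+ m (ℤ.- (b ^ᶻ q))))) ⟩
          κ (m ℤ.- b ^ᶻ q) - p̂ * h * w                              ≈⟨ +-congʳ (trans (φ-cong c≡) (φ-* (+ p) c)) ⟩
          p̂ * κ c - p̂ * h * w                                       ≈⟨ solve 4 (λ p c h w → p :* c :- p :* h :* w := p :* (c :+ (:- (h :* w)))) refl p̂ (κ c) h w ⟩
          p̂ * u                                                     ∎
          where
          x^n : (h + κ b) ^ q ≈ κ m
          x^n = begin
            (h + κ b) ^ q   ≈⟨ ^-congˡ q x^k≈ ⟨
            (x ^ k) ^ q     ≈⟨ ^-assocʳ x k q ⟩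
            x ^ (k ℕ.* q)   ≈⟨ ^-congʳ x (≡.trans (ℕₚ.*-comm k q) (≡.sym n≡)) ⟩
            x ^ n           ≈⟨ x^n≈m ⟩
            κ m             ∎
        uv≈1 : u * κ v ≈ᴵ 1#
        uv≈1 = let t , eq = proj₂ c-inverse in B.trans
          (combination (- (w * κ v)) 0# (solve 5 (λ c h w v p → (c :+ (:- (h :* w))) :* v := c :* v :+ (h :* (:- (w :* v)) :+ p :* con (+ 0))) refl (κ c) h w (κ v) p̂))
          (κ-unit h c v t eq)
        frobenius-power : ∀ j → ∃₂ λ s μ → j ≤ p ℕ.^ s × ¬ p ℕᵈ.∣ ∣ μ ∣ × x ^ (p ℕ.^ s) ≈ᴵ κ μ * x
        frobenius-power j =
          -- From p ^ r = 1 + k t and `x ^ k` congruent to m, the power `x ^ (p ^ r)` is congruent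
          -- to `m ^ t` times `x`.
          let r , t , p^r≡ , j≤ = order≥ pp k p∤k j
          in r , m ^ᶻ t , j≤ , (λ d → p∤m (prime∣^ᶻ pp m t d)) , B.trans (≈⇒≈ᴵ (begin
               x ^ (p ℕ.^ r)        ≈⟨ ^-congʳ x p^r≡ ⟩
               x * x ^ (k ℕ.* t)    ≈⟨ *-congˡ (^-assocʳ x k t) ⟨
               x * (x ^ k) ^ t      ≈⟨ *-comm x _ ⟩
               (x ^ k) ^ t * x      ∎))
             (B.*-congʳ (B.trans (^-congᴵ t x^k≈ᴵm) (≈⇒≈ᴵ (sym (φ-^ m t)))))
          where
          x^k≈ᴵm : x ^ k ≈ᴵ κ m
          x^k≈ᴵm = combination 1# (- 1#) (begin
            x ^ k                          ≈⟨ x^k≈ ⟩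
            h + κ b                        ≈⟨ +-congˡ (trans (φ-+ m (ℤ.- + p)) (+-congˡ (φ-neg (+ p)))) ⟩
            h + (κ m + - p̂)                ≈⟨ solve 3 (λ h m p → h :+ (m :+ (:- p)) := m :+ (h :* con (+ 1) :+ p :* (:- con (+ 1)))) refl h (κ m) p̂ ⟩
            κ m + (h * 1# + p̂ * - 1#)      ∎)

p²∣m⇒p²∣m^p-m : ∀ {p} → Prime p → ∀ m m′ → m ≡ + p ℤ.* m′ → p ℕᵈ.∣ ∣ m′ ∣ → p ℕ.* p ℕᵈ.∣ ∣ m ^ᶻ p ℤ.- m ∣
p²∣m⇒p²∣m^p-m {suc p} pp m m′ m≡ p∣m′ =
  let w , m′≡ = ∣⇒∣ᶻ {+ suc p} p∣m′ in
  ≡.subst (ℕᵈ._∣ ∣ m ^ᶻ suc p ℤ.- m ∣) (ℤₚ.abs-* (+ suc p) (+ suc p)) (∣ᶻ⇒∣ {+ suc p ℤ.* + suc p} (w ℤ.* (m ^ᶻ p ℤ.- + 1) , (begin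
    m ℤ.* m ^ᶻ p ℤ.- m                              ≡⟨ solve 2 (λ m q → m :* q :- m := m :* (q :- con (+ 1))) ≡.refl m (m ^ᶻ p) ⟩
    m ℤ.* (m ^ᶻ p ℤ.- + 1)                          ≡⟨ cong (ℤ._* (m ^ᶻ p ℤ.- + 1)) (≡.trans m≡ (cong (+ suc p ℤ.*_) m′≡)) ⟩
    + suc p ℤ.* (+ suc p ℤ.* w) ℤ.* (m ^ᶻ p ℤ.- + 1)  ≡⟨ solve 3 (λ p w q → p :* (p :* w) :* q := p :* p :* (w :* q)) ≡.refl (+ suc p) w (m ^ᶻ p ℤ.- + 1) ⟩
    + suc p ℤ.* + suc p ℤ.* (w ℤ.* (m ^ᶻ p ℤ.- + 1))  ∎)))
  where
  open ≡-Reasoning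
  open IntegerSolver ℤ-ring

-- As p ≥ 2, p² divides m ^ p, so m ^ p - m is congruent to - m; writing p as `suc (suc r)` exposes
-- the two factors m.
p²∣m^p-m⇒p²∣m : ∀ {p} → Prime p → ∀ m m′ → m ≡ + p ℤ.* m′ → p ℕ.* p ℕᵈ.∣ ∣ m ^ᶻ p ℤ.- m ∣ → p ℕᵈ.∣ ∣ m′ ∣
p²∣m^p-m⇒p²∣m {suc zero} pp m m′ m≡ d = contradiction (prime>1 pp) (λ { (s≤s ()) })
p²∣m^p-m⇒p²∣m {p@(suc (suc r))} pp m m′ m≡ d =
  let t , e = ∣⇒∣ᶻ {+ p ℤ.* + p} {m ^ᶻ p ℤ.- m} (≡.subst (ℕᵈ._∣ ∣ m ^ᶻ p ℤ.- m ∣) (≡.sym (ℤₚ.abs-* (+ p) (+ p))) d)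
  in ∣ᶻ⇒∣ {+ p} (m′ ℤ.* (m′ ℤ.* m ^ᶻ r) ℤ.- t , ℤₚ.*-cancelˡ-≡ (+ p) m′ _ (begin
    + p ℤ.* m′                                                     ≡⟨ m≡ ⟨
    m                                                              ≡⟨ solve 2 (λ m q → m := q :- (q :- m)) ≡.refl m (m ^ᶻ p) ⟩
    m ℤ.* (m ℤ.* m ^ᶻ r) ℤ.- (m ^ᶻ p ℤ.- m)                        ≡⟨ cong₂ ℤ._-_ (cong₂ (λ a b → a ℤ.* (b ℤ.* m ^ᶻ r)) m≡ m≡) e ⟩
    + p ℤ.* m′ ℤ.* (+ p ℤ.* m′ ℤ.* m ^ᶻ r) ℤ.- + p ℤ.* + p ℤ.* t   ≡⟨ solve 4 (λ p m w t → p :* m :* (p :* m :* w) :- p :* p :* t := p :* (p :* (m :* (m :* w) :- t))) ≡.refl (+ p) m′ (m ^ᶻ r) t ⟩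
    + p ℤ.* (+ p ℤ.* (m′ ℤ.* (m′ ℤ.* m ^ᶻ r) ℤ.- t))               ∎))
  where
  open ≡-Reasoning
  open IntegerSolver ℤ-ring

-- ℤ[α] as a ring of its own, and sufficiency of the condition

module Order {ℓ₀ ℓ₁ ℓ₂} (L : FieldExtensionOfℚ ℓ₀ ℓ₁ ℓ₂) (n : ℕ) (0<n : 0 < n) (m : ℤ)
             (irreducible : IrreducibleOverℚ (X^ n - m))
             (α : FieldExtensionOfℚ.Carrier L) (isRoot : IsRoot L (X^ n - m) α) where
  open Field L
  open Root n 0<n m irreducible α isRoot
  open Integrality L
  open Evℤ
  open CommutativeExp commutativeSemiring
  open IntegerSolver L-ring
  open import Relation.Binary.Reasoning.Setoid setoid

  private
    A-rawRing : RawRing _ _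
    A-rawRing = record
      { Carrier = ℤᵖ.Poly ; _≈_ = λ g h → ev g α ≈ ev h α
      ; _+_ = ℤᵖ._⊕_ ; _*_ = ℤᵖ._⊛_ ; -_ = λ g → map ℤ.-_ g ; 0# = [] ; 1# = ℤᵖ.constant (+ 1) }

    -- Equality in A is agreement at α, so evaluation is injective by definition and the ring laws
    -- pull back from L.
    ev-isMonomorphism : IsRingMonomorphism A-rawRing rawRing (λ g → ev g α)
    ev-isMonomorphism = record
      { isRingHomomorphism = record
        { isSemiringHomomorphism = record
          { isNearSemiringHomomorphism = record
            { +-isMonoidHomomorphism = record
              { isMagmaHomomorphism = record { isRelHomomorphism = record { cong = λ e → e } ; homo = λ g h → ev-⊕ g h α }
              ; ε-homo = refl }
            ; *-homo = λ g h → ev-⊛ g h α }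
          ; 1#-homo = trans (ev-constant (+ 1) α) φ-1 }
        ; -‿homo = λ g → ev-neg g α }
      ; injective = λ e → e }

    -- ℤ[α], with polynomials identified when they agree at α.
    A-ring : CommutativeRing _ _
    A-ring = record { isCommutativeRing = RingMonomorphism.isCommutativeRing ev-isMonomorphism isCommutativeRing }

    module A = CommutativeRing A-ring

    constant-hom : IsRingHomomorphism ℤ.+-*-rawRing A.rawRing ℤᵖ.constant
    constant-hom = record
      { isSemiringHomomorphism = record
        { isNearSemiringHomomorphism = record
          { +-isMonoidHomomorphism = record
            { isMagmaHomomorphism = record { isRelHomomorphism = record { cong = λ { ≡.refl → refl } } ; homo = λ a b → refl }
            ; ε-homo = trans (ev-constant (+ 0) α) φ-0 }
          ; *-homo = λ a b → trans (ev-constant (a ℤ.* b) α) (trans (φ-* a b) (sym (constant-⊛ a (ℤᵖ.constant b) (ev-constant b α)))) }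
        ; 1#-homo = refl }
      ; -‿homo = λ a → refl }
      where
      constant-⊛ : ∀ a g {y} → ev g α ≈ y → ev (ℤᵖ.constant a ℤᵖ.⊛ g) α ≈ φ a * y
      constant-⊛ a g e = trans (ev-⊛ (ℤᵖ.constant a) g α) (*-cong (ev-constant a α) e)

    module EvA = Evaluation ℤ-ring A-ring ℤᵖ.constant constant-hom
    module EA = CommutativeExp A.commutativeSemiring

    ev-constant-⊛ : ∀ a g → ev (ℤᵖ.constant a ℤᵖ.⊛ g) α ≈ φ a * ev g α
    ev-constant-⊛ a g = trans (ev-⊛ (ℤᵖ.constant a) g α) (*-congʳ (ev-constant a α))

    ev-EvA : ∀ g → ev (EvA.ev g ℤᵖ.X) α ≈ ev g α
    ev-EvA []      = refl
    ev-EvA (a ∷ g) = trans (ev-⊕ (ℤᵖ.constant a) (ℤᵖ.X ℤᵖ.⊛ EvA.ev g ℤᵖ.X) α) (+-cong (ev-constant a α)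
      (trans (ev-⊛ ℤᵖ.X (EvA.ev g ℤᵖ.X) α) (*-cong (ev-X α) (ev-EvA g))))

    ev-^A : ∀ g k → ev (g EA.^ k) α ≈ ev g α ^ k
    ev-^A g zero    = trans (ev-constant (+ 1) α) φ-1
    ev-^A g (suc k) = trans (ev-⊛ g (g EA.^ k) α) (*-congˡ (ev-^A g k))

    module M = MonogenicOrder.Generated A-ring ℤᵖ.constant constant-hom
      (λ a a≢0 {y} {z} e → φ-cancel a a≢0 (trans (sym (ev-constant-⊛ a y)) (trans e (ev-constant-⊛ a z))))
      ℤᵖ.X (λ z → z , sym (ev-EvA z)) n
      (λ a w y w< e → coefficients-divisible a w y w< (trans (sym (ev-EvA w)) (trans e (ev-constant-⊛ a y))))
      m (trans (ev-^A ℤᵖ.X n) (trans (^-congˡ n (ev-X α)) (trans α^n≈m (sym (ev-constant m α)))))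

  -- Membership in the complete integral closure of ℤ[α]. Multiplying `x` by an integer preserves it
  -- with the same `D`.
  AlmostIntegral : Carrier → Set ℓ₁
  AlmostIntegral x = ∃[ D ] D ≢ 0 × (∀ k → ∃[ w ] φ (+ D) * x ^ k ≈ ev w α)

  prime≢0 : ∀ {p} → Prime p → + p ≢ + 0
  prime≢0 {p} pp e = ℕ.≢-nonZero⁻¹ p {{prime⇒nonZero pp}} (ℤₚ.+-injective e)

  -- Multiplying the condition on `x ^ k` by `p ^ k` makes it a statement about z = p x inside A,
  -- where maximality at p applies; p is cancelled afterwards in L.
  divide-by-prime : ∀ {p} (pp : Prime p) → M.MaximalAtPrime pp →
                    ∀ x z → AlmostIntegral x → φ (+ p) * x ≈ ev z α → ∃[ a ] x ≈ ev a α
  divide-by-prime {p} pp maximal x z (D , D≢0 , cleared) px≈z =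
    let a , z≈pa = maximal D z D≢0 (λ k → let w , e = cleared k in w , divided k w e)
    in a , φ-cancel (+ p) (prime≢0 pp) (trans px≈z (trans z≈pa (ev-constant-⊛ (+ p) a)))
    where
    p̂ = ℤᵖ.constant (+ p)
    divided : ∀ k w → φ (+ D) * x ^ k ≈ ev w α → ev (ℤᵖ.constant (+ D) ℤᵖ.⊛ (z EA.^ k)) α ≈ ev ((p̂ EA.^ k) ℤᵖ.⊛ w) α
    divided k w e = begin
      ev (ℤᵖ.constant (+ D) ℤᵖ.⊛ (z EA.^ k)) α   ≈⟨ trans (ev-constant-⊛ (+ D) (z EA.^ k)) (*-congˡ (ev-^A z k)) ⟩
      φ (+ D) * ev z α ^ k                       ≈⟨ *-congˡ (trans (^-congˡ k (sym px≈z)) (^-distrib-* (φ (+ p)) x k)) ⟩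
      φ (+ D) * (φ (+ p) ^ k * x ^ k)            ≈⟨ solve 3 (λ D q y → D :* (q :* y) := q :* (D :* y)) refl (φ (+ D)) (φ (+ p) ^ k) (x ^ k) ⟩
      φ (+ p) ^ k * (φ (+ D) * x ^ k)            ≈⟨ *-cong (trans (^-congˡ k (sym (ev-constant (+ p) α))) (sym (ev-^A p̂ k))) e ⟩
      ev (p̂ EA.^ k) α * ev w α                   ≈⟨ ev-⊛ (p̂ EA.^ k) w α ⟨
      ev ((p̂ EA.^ k) ℤᵖ.⊛ w) α                   ∎

  AlmostIntegral-scale : ∀ a {x} → AlmostIntegral x → AlmostIntegral (φ a * x)
  AlmostIntegral-scale a {x} (D , D≢0 , cleared) = D , D≢0 , λ k → let w , e = cleared k in map (a ^ᶻ k ℤ.*_) w , (begin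
    φ (+ D) * (φ a * x) ^ k        ≈⟨ *-congˡ (^-distrib-* (φ a) x k) ⟩
    φ (+ D) * (φ a ^ k * x ^ k)    ≈⟨ solve 3 (λ D q y → D :* (q :* y) := q :* (D :* y)) refl (φ (+ D)) (φ a ^ k) (x ^ k) ⟩
    φ a ^ k * (φ (+ D) * x ^ k)    ≈⟨ *-cong (sym (φ-^ a k)) e ⟩
    φ (a ^ᶻ k) * ev w α            ≈⟨ ev-scale (a ^ᶻ k) w α ⟨
    ev (map (a ^ᶻ k ℤ.*_) w) α     ∎)

  -- The primes of the denominator are removed one at a time: the first is divided out of the
  -- product of the others with `x`, which is still almost integral.
  divide-by-primes : (∀ {p} (pp : Prime p) → M.MaximalAtPrime pp) → ∀ ps → All Prime ps →
                     ∀ x z → AlmostIntegral x → φ (+ product ps) * x ≈ ev z α → ∃[ a ] x ≈ ev a α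
  divide-by-primes maximal []       []         x z ai e = z , trans (sym (trans (*-congʳ φ-1) (*-identityˡ x))) e
  divide-by-primes maximal (p ∷ ps) (pp ∷ pps) x z ai e =
    let a , eq = divide-by-prime pp (maximal pp) (φ (+ product ps) * x) z (AlmostIntegral-scale (+ product ps) ai) (begin
          φ (+ p) * (φ (+ product ps) * x)   ≈⟨ *-assoc _ _ x ⟨
          φ (+ p) * φ (+ product ps) * x     ≈⟨ *-congʳ (trans (φ-cong (ℤₚ.pos-* p (product ps))) (φ-* (+ p) (+ product ps))) ⟨
          φ (+ product (p ∷ ps)) * x         ≈⟨ e ⟩
          ev z α                             ∎)
    in divide-by-primes maximal ps pps x a ai eq

  integrally-closed : (∀ {p} (pp : Prime p) → M.MaximalAtPrime pp) →
                      ∀ x → x ∈ ℚ⟮_⟯ L α → Integral L x → ∃[ a ] x ≈ ev a α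
  integrally-closed maximal x x∈K (g , (d , g-Monic) , gx≈0) =
    let r , x≈r = adjoin⇒polynomial x∈K
        N , z , N≢0 , Nr≈z = clear-denominators r α
        Nx≈z = trans (*-congˡ x≈r) Nr≈z
        instance _ = ℕ.≢-nonZero N≢0
        open PrimeFactorisation (factorise N)
    in divide-by-primes maximal factors factorsPrime x z
         (N ℕ.^ d , ℕ.≢-nonZero⁻¹ _ {{ℕₚ.m^n≢0 N d}} , CommonDenominator.powers-cleared α N z x Nx≈z d g g-Monic gx≈0)
         (trans (*-congʳ (φ-cong (cong +_ (≡.sym isFactorisation)))) Nx≈z)

  maximal-at-primes : (∀ p → Prime p → p ℕᵈ.∣ n ℕ.* ∣ m ∣ → ¬ p ℕ.* p ℕᵈ.∣ ∣ m ^ᶻ p ℤ.- m ∣) →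
                      ∀ {p} (pp : Prime p) → M.MaximalAtPrime pp
  maximal-at-primes p²∤ {p} pp with p ℕᵈ.∣? ∣ m ∣
  ... | yes p∣m = let m′ , m≡ = ∣⇒∣ᶻ {+ p} p∣m in
    M.exactly-divides⇒maximal pp 0<n m′ m≡
      (λ p∣m′ → p²∤ p pp (ℕᵈ.∣n⇒∣m*n n p∣m) (p²∣m⇒p²∣m^p-m pp m m′ m≡ p∣m′))
  ... | no p∤m =
    let s , k , n≡ , p∤k = extract-power pp n (ℕ.≢-nonZero⁻¹ n {{ℕ.>-nonZero 0<n}})
    in M.coprime⇒maximal pp s k n≡ p∤k (ℕₚ.n≢0⇒n>0 (λ k≡0 → p∤k (≡.subst (p ℕᵈ.∣_) (≡.sym k≡0) (p ℕᵈ.∣0)))) p∤m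
         -- Here s ≠ 0 means p ∣ n, so the condition on p² is invoked only at primes dividing n m.
         (λ s≢0 → p²∤ p pp (ℕᵈ.∣m⇒∣m*n ∣ m ∣ (≡.subst (p ℕᵈ.∣_) (≡.sym n≡) (ℕᵈ.∣m⇒∣m*n k (p∣p^ s s≢0)))))
    where
    p∣p^ : ∀ s → s ≢ 0 → p ℕᵈ.∣ p ℕ.^ s
    p∣p^ zero    s≢0 = contradiction ≡.refl s≢0
    p∣p^ (suc s) _   = ℕᵈ.m∣m*n (p ℕ.^ s)

  -- Necessity of the condition

  module Converse (closed : ∀ x → x ∈ ℚ⟮_⟯ L α → Integral L x → ∃[ a ] x ≈ ev a α) {p} (pp : Prime p) where
    private
      p⁻¹ : ∃[ y ] φ (+ p) * y ≈ 1#
      p⁻¹ = φ-inverse (+ p) (prime≢0 pp)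
      y = proj₁ p⁻¹
      py≈1 = proj₂ p⁻¹

      y∈K : y ∈ ℚ⟮_⟯ L α
      y∈K = inverse py≈1 (rational (fromℤ (+ p)))

    -- Below degree n the coefficients are coordinates in a basis of A, so p would divide the
    -- leading coefficient 1.
    monic-not-divisible : ∀ d G a → d < n → ℤᵖ.MonicOfDegree d G → ¬ ev G α ≈ φ (+ p) * ev a α
    monic-not-divisible d G a d<n G-Monic e = ℕₚ.<⇒≱ (prime>1 pp) (ℕᵈ.∣⇒≤ (≡.subst (λ z → p ℕᵈ.∣ ∣ z ∣) (proj₁ G-Monic)
      (∣ᶻ⇒∣ {+ p} (coefficients-divisible (+ p) G a (λ i n≤i → proj₂ G-Monic i (ℕₚ.<-≤-trans d<n n≤i)) e d))))

    -- Otherwise α ^ (n - 1) / p is integral.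
    p²∤m : ∀ m″ → 1 < n → ¬ m ≡ + p ℤ.* (+ p ℤ.* m″)
    p²∤m m″ (s≤s (s≤s {n = r} z≤n)) m≡ =
      let a , β≈a = closed β (times y∈K (α^∈K)) β-Integral
      in monic-not-divisible (suc r) (ℤᵖ.X ℤᵖ.^ᵖ suc r) a (ℕₚ.n<1+n (suc r)) (ℤᵖ.X^-Monic (suc r))
           (trans (trans (ev-^ ℤᵖ.X (suc r) α) (^-congˡ (suc r) (ev-X α))) (trans (sym pβ≈) (*-congˡ β≈a)))
      where
      β = y * α ^ suc r
      pβ≈ : φ (+ p) * β ≈ α ^ suc r
      pβ≈ = trans (sym (*-assoc _ y _)) (trans (*-congʳ py≈1) (*-identityˡ _))
      α^∈K : α ^ suc r ∈ ℚ⟮_⟯ L α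
      α^∈K = respects (trans (ev-^ ℤᵖ.X (suc r) α) (^-congˡ (suc r) (ev-X α))) (ev∈ℚ⟮⟯ (ℤᵖ.X ℤᵖ.^ᵖ suc r) α)
      -- With n = r + 2, β ^ n = m ^ (n - 1) / p ^ n, and m ^ (n - 1) supplies p to the power 2 (n -
      -- 1), leaving p ^ (n - 2) m″ ^ (n - 1).
      e = (+ p) ^ᶻ r ℤ.* m″ ^ᶻ suc r
      P = φ (+ p)
      q = P ^ n
      p^n-unit : ∀ k → ∃[ z ] P ^ k * z ≈ 1#
      p^n-unit k = y ^ k , trans (sym (^-distrib-* P y k)) (trans (^-congˡ k py≈1) (1^ k))
        where
        1^ : ∀ k → 1# ^ k ≈ 1#
        1^ zero    = refl
        1^ (suc k) = trans (*-identityˡ _) (1^ k)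
      β^n≈ : β ^ n ≈ φ e
      β^n≈ = unit-cancel (proj₂ (p^n-unit n)) (begin
        q * β ^ n                              ≈⟨ ^-distrib-* P β n ⟨
        (P * β) ^ n                            ≈⟨ ^-congˡ n pβ≈ ⟩
        (α ^ suc r) ^ n                        ≈⟨ ^-assocʳ α (suc r) n ⟩
        α ^ (suc r ℕ.* n)                      ≈⟨ ^-congʳ α (ℕₚ.*-comm (suc r) n) ⟩
        α ^ (n ℕ.* suc r)                      ≈⟨ ^-assocʳ α n (suc r) ⟨
        (α ^ n) ^ suc r                        ≈⟨ ^-congˡ (suc r) (trans α^n≈m (trans (φ-cong m≡) (trans (φ-* (+ p) (+ p ℤ.* m″)) (*-congˡ (φ-* (+ p) m″))))) ⟩
        (P * (P * φ m″)) ^ suc r               ≈⟨ trans (^-distrib-* P (P * φ m″) (suc r)) (*-congˡ (^-distrib-* P (φ m″) (suc r))) ⟩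
        P ^ suc r * (P ^ suc r * φ m″ ^ suc r) ≈⟨ solve 3 (λ P Q w → P :* Q :* (P :* Q :* w) := P :* (P :* Q) :* (Q :* w)) refl P (P ^ r) (φ m″ ^ suc r) ⟩
        q * (P ^ r * φ m″ ^ suc r)             ≈⟨ *-congˡ (trans (φ-* ((+ p) ^ᶻ r) (m″ ^ᶻ suc r)) (*-cong (φ-^ (+ p) r) (φ-^ m″ (suc r)))) ⟨
        q * φ e                                ∎)
      β-Integral : Integral L β
      β-Integral = power-ValueBelow⇒Integral β n (ℤᵖ.constant e ,
        ℤᵖ.DegreeBelow-mono (ℤᵖ.constant e) 0<n (ℤᵖ.constant-DegreeBelow e) , trans β^n≈ (sym (ev-constant e β)))

  -- Put γ = α ^ (n / p), δ = γ - m and m ^ p - m = p² d.  Expanding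
  -- (δ + m) ^ p = m gives δ (δ ^ (p - 1) + p T) = - p² d with T in ℤ[γ], so
  -- β = δ ^ (p - 1) / p + T satisfies β δ = - p d, and multiplying the
  -- definition of β by β ^ (p - 1) turns it into a monic equation for β.
  module Wild (closed : ∀ x → x ∈ ℚ⟮_⟯ L α → Integral L x → ∃[ a ] x ≈ ev a α) (r : ℕ) (pp : Prime (suc (suc r)))
              (k : ℕ) (n≡ : n ≡ k ℕ.* suc (suc r)) (d : ℤ)
              (m^p-m≡ : m ^ᶻ suc (suc r) ℤ.- m ≡ + suc (suc r) ℤ.* + suc (suc r) ℤ.* d) where
    open Converse closed pp
    open Frobenius L-ring using (middleTerm; binomial-ends)
    open IntegerImage L-ring φ φ-hom using (·≈*)
    open import Algebra.Properties.Semiring.Sum semiring using (sum; sum-cong-≋; *-distribˡ-sum; *-distribʳ-sum)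

    private
      p′ = suc r
      p = suc p′

      0<k : 0 < k
      0<k = ℕₚ.n≢0⇒n>0 (λ k≡0 → ℕₚ.n≮0 (≡.subst (0 <_) (≡.trans n≡ (cong (ℕ._* p) k≡0)) 0<n))

      H : ℤᵖ.Poly
      H = (ℤᵖ.X ℤᵖ.^ᵖ k) ℤᵖ.⊕ ℤᵖ.constant (ℤ.- m)

      H-Monic : ℤᵖ.MonicOfDegree k H
      H-Monic = ℤᵖ.⊕-Monic (ℤᵖ.X ℤᵖ.^ᵖ k) (ℤᵖ.constant (ℤ.- m)) (ℤᵖ.X^-Monic k)
        (ℤᵖ.DegreeBelow-mono (ℤᵖ.constant (ℤ.- m)) 0<k (ℤᵖ.constant-DegreeBelow (ℤ.- m)))

      δ P M y : Carrier
      δ = ev H α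
      P = φ (+ p)
      M = φ m
      y = proj₁ (φ-inverse (+ p) (prime≢0 pp))

      Py≈1 : P * y ≈ 1#
      Py≈1 = proj₂ (φ-inverse (+ p) (prime≢0 pp))

      α^k≈ : α ^ k ≈ δ + M
      α^k≈ = begin
        α ^ k                                                      ≈⟨ solve 2 (λ a m → a := (a :+ (:- m)) :+ m) refl (α ^ k) M ⟩
        (α ^ k + - M) + M                                          ≈⟨ +-congʳ (+-cong (trans (ev-^ ℤᵖ.X k α) (^-congˡ k (ev-X α))) (trans (ev-constant (ℤ.- m) α) (φ-neg m))) ⟨
        (ev (ℤᵖ.X ℤᵖ.^ᵖ k) α + ev (ℤᵖ.constant (ℤ.- m)) α) + M     ≈⟨ +-congʳ (ev-⊕ (ℤᵖ.X ℤᵖ.^ᵖ k) (ℤᵖ.constant (ℤ.- m)) α) ⟨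
        δ + M                                                      ∎

      p∣C : ∀ (j : Fin p′) → p ℕᵈ.∣ p C suc (toℕ j)
      p∣C j = prime∣C pp (suc (toℕ j)) (s≤s z≤n) (s≤s (Finₚ.toℕ<n j))

      -- The integers (p C (j + 1)) / p, the coefficients of `T`.
      c : Fin p′ → ℤ
      c j = + ℕᵈ.quotient (p∣C j)

      t : Fin p′ → Carrier
      t j = φ (c j) * (δ ^ toℕ j * M ^ (p′ ∸ toℕ j))

      T : Carrier
      T = sum t

      middle≈ : ∀ j → middleTerm p′ δ M j ≈ P * δ * t j
      middle≈ j = begin
        middleTerm p′ δ M j                        ≈⟨ ·≈* (p C suc (toℕ j)) _ ⟩
        φ (+ (p C suc (toℕ j))) * (δ * δ ^ toℕ j * z) ≈⟨ *-congʳ (trans (φ-cong (≡.trans (cong +_ (ℕᵈ._∣_.equality (p∣C j))) (ℤₚ.pos-* (ℕᵈ.quotient (p∣C j)) p))) (φ-* (c j) (+ p))) ⟩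
        φ (c j) * P * (δ * δ ^ toℕ j * z)          ≈⟨ solve 5 (λ c P d e z → c :* P :* (d :* e :* z) := P :* d :* (c :* (e :* z))) refl (φ (c j)) P δ (δ ^ toℕ j) z ⟩
        P * δ * t j                                ∎
        where z = M ^ (p′ ∸ toℕ j)

      expansion : M ≈ M ^ p + (P * δ * T + δ ^ p)
      expansion = begin
        M                                                ≈⟨ α^n≈m ⟨
        α ^ n                                            ≈⟨ trans (^-congʳ α n≡) (sym (^-assocʳ α k p)) ⟩
        (α ^ k) ^ p                                      ≈⟨ ^-congˡ p α^k≈ ⟩
        (δ + M) ^ p                                      ≈⟨ binomial-ends p′ δ M ⟩
        M ^ p + (sum (middleTerm p′ δ M) + δ ^ p)        ≈⟨ +-congˡ (+-congʳ (trans (sum-cong-≋ {p′} {middleTerm p′ δ M} {λ j → P * δ * t j} middle≈) (sym (*-distribˡ-sum (P * δ) t)))) ⟩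
        M ^ p + (P * δ * T + δ ^ p)                      ∎

      β : Carrier
      β = T + y * δ ^ p′

      Pβ≈ : P * β ≈ P * T + δ ^ p′
      Pβ≈ = trans (distribˡ P T _) (+-congˡ (trans (sym (*-assoc P y _)) (trans (*-congʳ Py≈1) (*-identityˡ _))))

      q : ℤ
      q = + p ℤ.* ℤ.- d

      βδ≈q : β * δ ≈ φ q
      βδ≈q = φ-cancel (+ p) (prime≢0 pp) (begin
        P * (β * δ)                               ≈⟨ *-assoc P β δ ⟨
        P * β * δ                                 ≈⟨ *-congʳ Pβ≈ ⟩
        (P * T + δ ^ p′) * δ                      ≈⟨ solve 5 (λ P T e d m → (P :* T :+ e) :* d := (m :+ (P :* d :* T :+ d :* e)) :- m) refl P T (δ ^ p′) δ (M ^ p) ⟩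
        (M ^ p + (P * δ * T + δ ^ p)) - M ^ p     ≈⟨ +-cong (sym expansion) (-‿cong (sym (φ-^ m p))) ⟩
        M - φ (m ^ᶻ p)                            ≈⟨ trans (+-congˡ (sym (φ-neg (m ^ᶻ p)))) (sym (φ-+ m (ℤ.- (m ^ᶻ p)))) ⟩
        φ (m ℤ.- m ^ᶻ p)                          ≈⟨ φ-cong (≡.trans (ℤS.solve 2 (λ m n → m ℤS.:- n ℤS.:= ℤS.:- (n ℤS.:- m)) ≡.refl m (m ^ᶻ p)) (≡.trans (cong ℤ.-_ m^p-m≡)
                                                     (ℤS.solve 2 (λ p d → ℤS.:- (p ℤS.:* p ℤS.:* d) ℤS.:= p ℤS.:* (p ℤS.:* (ℤS.:- d))) ≡.refl (+ p) d))) ⟩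
        φ (+ p ℤ.* q)                             ≈⟨ φ-* (+ p) q ⟩
        P * φ q                                   ∎)
        where module ℤS = IntegerSolver ℤ-ring

      sum-closed : ∀ {ℓ} (Q : Carrier → Set ℓ) → Q 0# → (∀ {a b} → Q a → Q b → Q (a + b)) →
                   ∀ l (f : Fin l → Carrier) → (∀ j → Q (f j)) → Q (sum f)
      sum-closed Q Q0 Q+ zero    f Qf = Q0
      sum-closed Q Q0 Q+ (suc l) f Qf = Q+ (Qf Fin.zero) (sum-closed Q Q0 Q+ l (f ∘ Fin.suc) (Qf ∘ Fin.suc))

      T∈ℤ[α] : ∃[ τ ] T ≈ ev τ α
      T∈ℤ[α] = sum-closed (λ z → ∃[ τ ] z ≈ ev τ α) ([] , refl)
        (λ (g , e) (h , f) → g ℤᵖ.⊕ h , trans (+-cong e f) (sym (ev-⊕ g h α))) p′ t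
        (λ j → map (c j ℤ.*_) ((H ℤᵖ.^ᵖ toℕ j) ℤᵖ.⊛ ℤᵖ.constant (m ^ᶻ (p′ ∸ toℕ j))) ,
          sym (trans (ev-scale (c j) ((H ℤᵖ.^ᵖ toℕ j) ℤᵖ.⊛ ℤᵖ.constant (m ^ᶻ (p′ ∸ toℕ j))) α) (*-congˡ (trans (ev-⊛ (H ℤᵖ.^ᵖ toℕ j) (ℤᵖ.constant (m ^ᶻ (p′ ∸ toℕ j))) α)
            (*-cong (ev-^ H (toℕ j) α) (trans (ev-constant (m ^ᶻ (p′ ∸ toℕ j)) α) (φ-^ m (p′ ∸ toℕ j))))))))

      q-power : ∀ j → δ ^ j * β ^ j ≈ φ (q ^ᶻ j)
      q-power j = trans (sym (^-distrib-* δ β j)) (trans (^-congˡ j (trans (*-comm δ β) βδ≈q)) (sym (φ-^ q j)))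

      -- Of the factor `β ^ p′`, the part `β ^ j` combines with `δ ^ j` into the integer `q ^ j`;
      -- what remains is a monomial in β of degree p - 1 - j.
      term-ValueBelow : ∀ j → ValueBelow β p (t j * β ^ p′)
      term-ValueBelow j = map (e ℤ.*_) (ℤᵖ.X ℤᵖ.^ᵖ i) ,
          ℤᵖ.scale-DegreeBelow e (ℤᵖ.X ℤᵖ.^ᵖ i)
            (ℤᵖ.DegreeBelow-mono (ℤᵖ.X ℤᵖ.^ᵖ i) (s≤s (ℕₚ.m∸n≤m p′ (toℕ j))) (proj₂ (ℤᵖ.X^-Monic i))) , (begin
        t j * β ^ p′                                                ≈⟨ *-congˡ (trans (^-congʳ β (≡.sym (ℕₚ.m+[n∸m]≡n (ℕₚ.<⇒≤ (Finₚ.toℕ<n j))))) (^-homo-* β (toℕ j) i)) ⟩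
        φ (c j) * (δ ^ toℕ j * M ^ i) * (β ^ toℕ j * β ^ i)         ≈⟨ solve 5 (λ c d m b z → c :* (d :* m) :* (b :* z) := c :* m :* (d :* b) :* z) refl (φ (c j)) (δ ^ toℕ j) (M ^ i) (β ^ toℕ j) (β ^ i) ⟩
        φ (c j) * M ^ i * (δ ^ toℕ j * β ^ toℕ j) * β ^ i           ≈⟨ *-congʳ (*-cong (trans (*-congˡ (sym (φ-^ m i))) (sym (φ-* (c j) (m ^ᶻ i)))) (q-power (toℕ j))) ⟩
        φ (c j ℤ.* m ^ᶻ i) * φ (q ^ᶻ toℕ j) * β ^ i                 ≈⟨ *-cong (φ-* (c j ℤ.* m ^ᶻ i) (q ^ᶻ toℕ j)) (trans (ev-^ ℤᵖ.X i β) (^-congˡ i (ev-X β))) ⟨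
        φ e * ev (ℤᵖ.X ℤᵖ.^ᵖ i) β                                   ≈⟨ ev-scale e (ℤᵖ.X ℤᵖ.^ᵖ i) β ⟨
        ev (map (e ℤ.*_) (ℤᵖ.X ℤᵖ.^ᵖ i)) β                          ∎)
        where
        i = p′ ∸ toℕ j
        e = c j ℤ.* m ^ᶻ i ℤ.* q ^ᶻ toℕ j

      ValueBelow-resp : ∀ {d x z z′} → z ≈ z′ → ValueBelow x d z → ValueBelow x d z′
      ValueBelow-resp e (g , g< , z≈) = g , g< , trans (sym e) z≈

      constant-ValueBelow : ∀ {x} a → ValueBelow x p (φ a)
      constant-ValueBelow {x} a = ℤᵖ.constant a , ℤᵖ.DegreeBelow-mono (ℤᵖ.constant a) (s≤s z≤n) (ℤᵖ.constant-DegreeBelow a) , sym (ev-constant a x)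

      β-Integral : Integral L β
      β-Integral = power-ValueBelow⇒Integral β p (ValueBelow-resp (sym β^p≈) (ValueBelow-+ β
          (sum-closed (ValueBelow β p) ([] , (λ _ _ → ≡.refl) , refl) (ValueBelow-+ β) p′ (λ j → t j * β ^ p′) term-ValueBelow)
          (constant-ValueBelow (ℤ.- d ℤ.* q ^ᶻ r))))
        where
        -- In the term `y * δ ^ p′ * β ^ p′` the integer `q ^ p′` appears; its factor p cancels `y`,
        -- the inverse of p, and leaves an integer constant.
        β^p≈ : β ^ p ≈ sum (λ j → t j * β ^ p′) + φ (ℤ.- d ℤ.* q ^ᶻ r)
        β^p≈ = begin
          (T + y * δ ^ p′) * β ^ p′               ≈⟨ solve 4 (λ T y d b → (T :+ y :* d) :* b := T :* b :+ y :* (d :* b)) refl T y (δ ^ p′) (β ^ p′) ⟩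
          T * β ^ p′ + y * (δ ^ p′ * β ^ p′)      ≈⟨ +-cong (*-distribʳ-sum (β ^ p′) t) (begin
            y * (δ ^ p′ * β ^ p′)                 ≈⟨ *-congˡ (trans (q-power p′) (trans (φ-* q (q ^ᶻ r)) (*-congʳ (φ-* (+ p) (ℤ.- d))))) ⟩
            y * (P * φ (ℤ.- d) * φ (q ^ᶻ r))      ≈⟨ solve 4 (λ y P d z → y :* (P :* d :* z) := P :* y :* (d :* z)) refl y P (φ (ℤ.- d)) (φ (q ^ᶻ r)) ⟩
            P * y * (φ (ℤ.- d) * φ (q ^ᶻ r))      ≈⟨ trans (*-congʳ Py≈1) (*-identityˡ _) ⟩
            φ (ℤ.- d) * φ (q ^ᶻ r)                ≈⟨ φ-* (ℤ.- d) (q ^ᶻ r) ⟨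
            φ (ℤ.- d ℤ.* q ^ᶻ r)                  ∎) ⟩
          sum (λ j → t j * β ^ p′) + φ (ℤ.- d ℤ.* q ^ᶻ r) ∎

      β∈K : β ∈ ℚ⟮_⟯ L α
      β∈K = let τ , T≈τ = T∈ℤ[α] in
        plus (respects (sym T≈τ) (ev∈ℚ⟮⟯ τ α))
             (times (inverse Py≈1 (rational (fromℤ (+ p)))) (respects (ev-^ H p′ α) (ev∈ℚ⟮⟯ (H ℤᵖ.^ᵖ p′) α)))

    -- If β lay in A, then δ ^ (p - 1) = p (β - T) would lie in p A, although it is monic in α of
    -- degree n - k < n.
    absurd : ⊥
    absurd =
      let τ , T≈τ = T∈ℤ[α]
          a , β≈a = closed β β∈K β-Integral
      in monic-not-divisible (p′ ℕ.* k) (H ℤᵖ.^ᵖ p′) (a ℤᵖ.⊕ map ℤ.-_ τ)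
           (≡.subst (p′ ℕ.* k <_) (≡.trans (ℕₚ.*-comm p k) (≡.sym n≡)) (ℕₚ.m<n+m (p′ ℕ.* k) 0<k))
           (ℤᵖ.^-Monic k H p′ H-Monic) (begin
             ev (H ℤᵖ.^ᵖ p′) α                             ≈⟨ ev-^ H p′ α ⟩
             δ ^ p′                                        ≈⟨ solve 3 (λ P T e → e := (P :* T :+ e) :- P :* T) refl P T (δ ^ p′) ⟩
             (P * T + δ ^ p′) - P * T                      ≈⟨ +-congʳ Pβ≈ ⟨
             P * β - P * T                                 ≈⟨ solve 3 (λ P b T → P :* b :- P :* T := P :* (b :- T)) refl P β T ⟩
             P * (β - T)                                   ≈⟨ *-congˡ (+-cong β≈a (-‿cong T≈τ)) ⟩
             P * (ev a α - ev τ α)                         ≈⟨ *-congˡ (trans (ev-⊕ a (map ℤ.-_ τ) α) (+-congˡ (ev-neg τ α))) ⟨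
             P * ev (a ℤᵖ.⊕ map ℤ.-_ τ) α                  ∎)

  p²∤m^p-m : 1 < n → (∀ x → x ∈ ℚ⟮_⟯ L α → Integral L x → ∃[ a ] x ≈ ev a α) →
             ∀ p → Prime p → p ℕᵈ.∣ n ℕ.* ∣ m ∣ → ¬ p ℕ.* p ℕᵈ.∣ ∣ m ^ᶻ p ℤ.- m ∣
  p²∤m^p-m 1<n closed zero          pp _ _ = contradiction pp ¬prime[0]
  p²∤m^p-m 1<n closed (suc zero)    pp _ _ = contradiction pp ¬prime[1]
  p²∤m^p-m 1<n closed p@(suc (suc r)) pp p∣nm p²∣ with p ℕᵈ.∣? ∣ m ∣
  ... | yes p∣m =
    let m′ , m≡ = ∣⇒∣ᶻ {+ p} {m} p∣m
        m″ , m′≡ = ∣⇒∣ᶻ {+ p} {m′} (p²∣m^p-m⇒p²∣m pp m m′ m≡ p²∣)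
    in Converse.p²∤m closed pp m″ 1<n (≡.trans m≡ (cong (+ p ℤ.*_) m′≡))
  ... | no p∤m with euclidsLemma n ∣ m ∣ pp p∣nm
  ...   | inj₂ p∣m = p∤m p∣m
  ...   | inj₁ (ℕᵈ.divides k n≡) =
    let d , e = ∣⇒∣ᶻ {+ p ℤ.* + p} {m ^ᶻ p ℤ.- m} (≡.subst (ℕᵈ._∣ ∣ m ^ᶻ p ℤ.- m ∣) (≡.sym (ℤₚ.abs-* (+ p) (+ p))) p²∣)
    in Wild.absurd closed r pp k n≡ d e

-- The equivalence in terms of valuations

open import Data.Integer.Base using (_*_; _-_; _^_)
open import Data.Integer.Divisibility using (_∣_)

theorem4p2 :
    ∀ (n : ℕ) → 2 ≤ n → (m : ℤ) →
    IrreducibleOverℚ (X^ n - m) →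
    (∀ p → Prime p → ν p (fromℤ m) <⁺ [ + n ]) →
    ∀ {c ℓ₁ ℓ₂} (L : FieldExtensionOfℚ c ℓ₁ ℓ₂) (α : FieldExtensionOfℚ.Carrier L) →
    IsRoot L (X^ n - m) α →
    (ℤ[_] L α ≐ RingOfIntegers L (ℚ⟮_⟯ L α)) ⇔
    (∀ p → Prime p → + p ∣ + n * m → ν p (fromℤ (m ^ p - m)) ≡ [ + 1 ])
theorem4p2 n 2≤n m irreducible _ L α isRoot = mk⇔ to from
  where
  0<n = ℕₚ.<-trans (s≤s z≤n) 2≤n
  open Field L
  open Root n 0<n m irreducible α isRoot
  open Integrality L
  open Order L n 0<n m irreducible α isRoot
  open Evℤ

  to : ℤ[_] L α ≐ RingOfIntegers L (ℚ⟮_⟯ L α) →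
       ∀ p → Prime p → + p ∣ + n ℤ.* m → ν p (fromℤ (m ℤ.^ p ℤ.- m)) ≡ [ + 1 ]
  to (_ , closed) p pp p∣nm = ≡.subst (λ z → ν p (fromℤ (z ℤ.- m)) ≡ [ + 1 ]) (≡.sym (^≡^ᶻ m p))
    (⇒ν≡1 pp (m ^ᶻ p ℤ.- m)
      -- Divisibility by p is Fermat's little theorem; integral closedness serves to exclude p².
      (let t , e = fermat pp m in ∣ᶻ⇒∣ {+ p} (t , ≡.trans (cong (ℤ._- m) e) (ℤS.solve 2 (λ m z → m ℤS.:+ z ℤS.:- m ℤS.:= z) ≡.refl m (+ p ℤ.* t))))
      (p²∤m^p-m 2≤n (λ x x∈K integral → closed (x∈K , integral)) p pp (≡.subst (p ℕᵈ.∣_) (ℤₚ.abs-* (+ n) m) p∣nm)))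
    where module ℤS = IntegerSolver ℤ-ring

  from : (∀ p → Prime p → + p ∣ + n ℤ.* m → ν p (fromℤ (m ℤ.^ p ℤ.- m)) ≡ [ + 1 ]) →
         ℤ[_] L α ≐ RingOfIntegers L (ℚ⟮_⟯ L α)
  from hyp =
    (λ (g , x≈g) → respects (sym x≈g) (ev∈ℚ⟮⟯ g α) ,
      (let h , h-Monic , h≈0 = ℤ[]⇒Integral α n 0<n reduceℤ g in h , h-Monic , trans (ev-congˣ h x≈g) h≈0)) ,
    (λ {x} (x∈K , integral) → integrally-closed (maximal-at-primes p²∤) x x∈K integral)
    where
    p²∤ : ∀ p → Prime p → p ℕᵈ.∣ n ℕ.* ∣ m ∣ → ¬ p ℕ.* p ℕᵈ.∣ ∣ m ^ᶻ p ℤ.- m ∣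
    p²∤ p pp p∣nm = proj₂ (ν≡1⇒ pp (m ^ᶻ p ℤ.- m) (≡.subst (λ z → ν p (fromℤ (z ℤ.- m)) ≡ [ + 1 ]) (^≡^ᶻ m p)
      (hyp p pp (≡.subst (p ℕᵈ.∣_) (≡.sym (ℤₚ.abs-* (+ n) m)) p∣nm))))
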